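{- Let $G(V,E)$ be a graph on $n$ vertices and let $G^{(1)},\ldots,G^{(k)}$ be a random $k$-partition of $G$. For any $\varepsilon\in(0,1)$, set $\lambda:=\Theta\big((\varepsilon/\log n)^2\big)$ and $\beta:=\Theta(\varepsilon^{ -6}\log^7 n)$ (for suitable absolute constants in the $\Theta$-notation). Consider the coreset which, on input $G^{(i)}$, outputs an arbitrary $C^{(i)}=\mathrm{EDCS}(G^{(i)},\beta,(1-\lambda)\beta)$ together with the vertex set $F^{(i)}$ of vertices whose degree in $C^{(i)}$ is larger than $(1-\Theta(\varepsilon))\cdot\beta/2$ (for a suitable absolute constant in the $\Theta$). Then this is a $(2+\varepsilon)$-approximation randomized composable coreset of size $O(n\cdot\beta)$ for the minimum vertex cover problem: with high probability over the random partition, the set $F^{(1)}\cup\cdots\cup F^{(k)}$ together with a minimum vertex cover of the graph $C^{(1)}\cup\cdots\cup C^{(k)}$ is a vertex cover of $G$ of size at most $(2+\varepsilon)$ times the size of a minimum vertex cover of $G$.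
   Context: $\deg_H(v)$ is the degree of $v$ in subgraph $H$. A random $k$-partition of $G(V,E)$ is obtained by sending each edge independently to one of $k$ edge sets $E^{(1)},\ldots,E^{(k)}$ chosen uniformly at random, with $G^{(i)}=(V,E^{(i)})$. For $\beta>\beta^-$, an $\mathrm{EDCS}(G,\beta,\beta^-)$ is a subgraph $H$ of $G$ such that (P1) every edge $(u,v)\in H$ has $\deg_H(u)+\deg_H(v)\le\beta$ and (P2) every edge $(u,v)\in G\setminus H$ has $\deg_H(u)+\deg_H(v)\ge\beta^-$. For vertex cover, a randomized composable coreset is allowed to output, on each piece, both a set of edges and a set of vertices to be added directly to the final solution; the final solution is the union of all output vertex sets plus a vertex cover of the union of all output edge sets, and the size of the coreset is the number of edges (and vertices) output. "With high probability" means with probability $1-1/\mathrm{poly}(n)$.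
   Formalization: The parameter ε ranges over the rational numbers in (0,1) instead of the real numbers. -}

module Defs where

open import Data.Nat as ℕ using (ℕ; zero; suc)
open import Data.Bool using (Bool; true; false; _∧_; _∨_; if_then_else_)
open import Data.Fin using (Fin)
open import Data.Fin.Properties using () renaming (_≟_ to _≟ᶠ_)
open import Data.Fin.Subset using (Subset; _∈_; _∉_; _∪_; ⋃; ∣_∣)
open import Data.Integer using (+_) renaming (∣_∣ to absℤ)
open import Data.Rational as ℚ using (ℚ; 0ℚ; 1ℚ; _/_; 1/_; Positive; ceiling)
open import Data.Rational.Properties using (pos⇒nonZero; _<?_)
open import Data.Product using (_×_; _,_; proj₁; proj₂)
open import Data.Sum using (_⊎_)
open import Data.List using (List)
open import Data.Vec as Vec using (Vec; lookup; tabulate; toList)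
open import Relation.Binary.PropositionalEquality using (_≡_; _≢_)
open import Relation.Nullary.Decidable using (⌊_⌋)
open import Data.Nat.Logarithm using (⌈log₂_⌉)

toℚ : ℕ → ℚ
toℚ n = + n / 1

_^ℚ_ : ℚ → ℕ → ℚ
p ^ℚ zero  = 1ℚ
p ^ℚ suc k = p ℚ.* (p ^ℚ k)

recipPos : (p : ℚ) → Positive p → ℚ
recipPos p pos = (1/ p) {{pos⇒nonZero p {{pos}}}}

-- ceiling of a rational, as a natural (used for nonnegative arguments)
ceilℕ : ℚ → ℕ
ceilℕ q = absℤ (ceiling q)

SameEdge : ∀ {n} → Fin n × Fin n → Fin n × Fin n → Set
SameEdge (a , b) (c , d) = (a ≡ c × b ≡ d) ⊎ (a ≡ d × b ≡ c)

record Graph (n : ℕ) : Set where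
  field
    m      : ℕ
    edge   : Fin m → Fin n × Fin n
    noLoop : ∀ j → proj₁ (edge j) ≢ proj₂ (edge j)
    noDup  : ∀ i j → SameEdge (edge i) (edge j) → i ≡ j
open Graph public

Partition : ∀ {n} → Graph n → ℕ → Set
Partition G k = Vec (Fin k) (m G)

InPiece : ∀ {n k} (G : Graph n) → Partition G k → Fin k → Fin (m G) → Set
InPiece G p i j = lookup p j ≡ i

countF : ∀ {m} → (Fin m → Bool) → ℕ
countF {zero}  f = 0
countF {suc m} f = (if f Fin.zero then 1 else 0) ℕ.+ countF (λ j → f (Fin.suc j))

isEnd : ∀ {n} (G : Graph n) → Fin (m G) → Fin n → Bool
isEnd G j v = ⌊ proj₁ (edge G j) ≟ᶠ v ⌋ ∨ ⌊ proj₂ (edge G j) ≟ᶠ v ⌋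

deg : ∀ {n} (G : Graph n) → Subset (m G) → Fin n → ℕ
deg G H v = countF (λ j → lookup H j ∧ isEnd G j v)

record IsEDCS {n k} (G : Graph n) (p : Partition G k) (i : Fin k)
              (H : Subset (m G)) (β : ℕ) (β⁻ : ℚ) : Set where
  field
    sub : ∀ j → j ∈ H → InPiece G p i j
    P1  : ∀ j → j ∈ H →
          deg G H (proj₁ (edge G j)) ℕ.+ deg G H (proj₂ (edge G j)) ℕ.≤ β
    P2  : ∀ j → InPiece G p i j → j ∉ H →
          β⁻ ℚ.≤ toℚ (deg G H (proj₁ (edge G j)) ℕ.+ deg G H (proj₂ (edge G j)))

CoversEdges : ∀ {n} (G : Graph n) → Subset (m G) → Subset n → Set
CoversEdges G X S = ∀ j → j ∈ X → (proj₁ (edge G j) ∈ S) ⊎ (proj₂ (edge G j) ∈ S)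

IsVertexCover : ∀ {n} (G : Graph n) → Subset n → Set
IsVertexCover G S = ∀ j → (proj₁ (edge G j) ∈ S) ⊎ (proj₂ (edge G j) ∈ S)

IsMinVCOf : ∀ {n} (G : Graph n) → Subset (m G) → Subset n → Set
IsMinVCOf G X S = CoversEdges G X S × (∀ T → CoversEdges G X T → ∣ S ∣ ℕ.≤ ∣ T ∣)

unionEdges : ∀ {n k} (G : Graph n) → (Fin k → Subset (m G)) → Subset (m G)
unionEdges G C = ⋃ (toList (tabulate C))

heavy : ∀ {n} (G : Graph n) → Subset (m G) → ℚ → Subset n
heavy G C thr = tabulate (λ v → ⌊ thr <? toℚ (deg G C v) ⌋)

logN : ℕ → ℕ
logN n = ⌈log₂ n ⌉

-- λ = cλ · (ε / L)^2   (junk value 0 if L = 0, excluded by n ≥ n₀ ≥ 2)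
lamParam : (cλ ε : ℚ) (n : ℕ) → ℚ
lamParam cλ ε n with logN n
... | zero  = 0ℚ
... | suc l = cλ ℚ.* ((ε ℚ.* (+ 1 / suc l)) ^ℚ 2)

betaParam : (cβ ε : ℚ) → Positive ε → (n : ℕ) → ℕ
betaParam cβ ε pos n = ceilℕ (cβ ℚ.* ((recipPos ε pos) ^ℚ 6) ℚ.* toℚ (logN n ℕ.^ 7))

thrParam : (cF ε : ℚ) (β : ℕ) → ℚ
thrParam cF ε β = (1ℚ ℚ.- cF ℚ.* ε) ℚ.* toℚ β ℚ.* (+ 1 / 2)

Good : ∀ {n k} (G : Graph n) (β : ℕ) (β⁻ thr ε : ℚ) → Partition G k → Set
Good {n} {k} G β β⁻ thr ε p =
  (C : Fin k → Subset (m G)) → (∀ i → IsEDCS G p i (C i) β β⁻) →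
  (S : Subset n) → IsMinVCOf G (unionEdges G C) S →
  let Fin∪ = ⋃ (toList (tabulate (λ i → heavy G (C i) thr))) ∪ S in
  IsVertexCover G Fin∪ ×
  (∀ T → IsVertexCover G T → toℚ ∣ Fin∪ ∣ ℚ.≤ (toℚ 2 ℚ.+ ε) ℚ.* toℚ ∣ T ∣)

{-# OPTIONS --safe #-}
module Submission where

-- Minimising Σ_v deg_H(v)² + 2kβ |E ∖ H| over all subgraphs yields a subgraph H of G whose edges have
-- degree sum at most kβ + 1 and whose non-edges have degree sum at least kβ − 1. By a Chernoff bound the
-- restrictions of H to the k pieces are, up to an additive error λβ, EDCSs of the pieces with all degrees
-- about deg_H(v)/k. Two EDCSs A and B of the same graph have close degrees: if deg_A − deg_B ≥ D somewhere,
-- the A ∖ B edges there lead to vertices with deg_B − deg_A ≥ D − λβ, and the number of edges involved grows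
-- by a factor 1 + Ω(ε) with each exchange of A and B, which is impossible for more than O(log n / ε) rounds.
-- Hence a vertex has nearly the same degree in all C⁽ⁱ⁾, so that every vertex of F⁽¹⁾ ∪ … ∪ F⁽ᵏ⁾ has degree
-- about β/2 or more in a single C⁽ʲ⁾, and counting the edges of C⁽ʲ⁾ between the union ∖ S and S bounds the
-- union ∖ S by (1 + ε)|S|. That F⁽¹⁾ ∪ … ∪ F⁽ᵏ⁾ ∪ S covers G needs no randomness.
-- If k > n², no vertex has more than O(log n) edges in any piece, and all F⁽ⁱ⁾ are empty.

open import Defs

-- The coresets are arbitrary and may depend on the whole partition, so concentration cannot be
-- applied to them directly, and there are far too many EDCSs for a union bound. The randomness is
-- therefore spent on one subgraph `H` fixed before the partition is drawn: only the deviations of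
-- its degrees, over all vertices and pieces, are controlled, and what follows is deterministic.
-- Different pieces share no edges, so `H` is also the only link through which their coresets can be
-- compared. The union bound over pieces costs a factor `k`, while β depends on `n` and ε alone.
-- This is affordable for `k ≤ n²`; for larger `k` the tail bound itself must carry a factor `1/k`,
-- and such a bound is available because a star then has fewer edges than there are pieces. All of
-- this takes place in ℕ. Probabilities are lengths of lists of equally likely words, and
-- exponentials are integer powers of `1 + 1/Y` with denominators cleared, so neither reals nor
-- logarithms of reals enter.

module Combinatorics where

  open import Data.Nat
  open import Data.Nat.Properties
  open import Data.Nat.DivMod using (m≡m%n+[m/n]*n; m%n<n; m/n*n≤m)
  open import Data.Nat.Induction using (<-wellFounded)
  open import Data.Nat.Logarithm using (⌈log₂_⌉; ⌈log₂⌉-mono-≤; ⌈log₂⌈n/2⌉⌉≡⌈log₂n⌉∸1)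
  open import Data.Nat.Tactic.RingSolver using (solve-∀)
  open import Algebra.Properties.Semiring.Sum +-*-semiring using (sum; sum-cong-≋; ∑-distrib-+; ∑-comm; *-distribˡ-sum; *-distribʳ-sum)
  open import Data.Bool using (Bool; true; false; _∧_; _∨_; not; if_then_else_)
  open import Data.Bool.Properties using (∧-zeroʳ)
  open import Data.Empty using (⊥-elim)
  open import Data.Fin using (Fin; combine; fromℕ<)
  open import Data.Fin.Properties using (injective⇒≤; combine-injective) renaming (_≟_ to _≟ᶠ_)
  open import Data.Fin.Subset using (Subset; ∣_∣; _∪_; ⋃; _∈_; _∉_)
  open import Data.Fin.Subset.Properties using (x∈p∪q⁺; x∈p∪q⁻; ∉⊥)
  open import Data.List using (List; []; _∷_; _++_; cartesianProductWith; map; length; filter; allFin) renaming (tabulate to tabulateˡ)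
  open import Data.List.Extrema ≤-totalOrder using (argmin; f[argmin]≤f[xs])
  open import Data.List.Membership.Propositional using () renaming (_∈_ to _∈ˡ_; _∉_ to _∉ˡ_)
  open import Data.List.Membership.Propositional.Properties using (∈-cartesianProductWith⁺; ∈-filter⁺; ∈-++⁺ˡ; ∈-++⁺ʳ; ∈-allFin)
  open import Data.List.Properties using (length-++; length-tabulate)
  open import Data.List.Relation.Unary.All as All using ()
  open import Data.List.Relation.Unary.Any using (here; there)
  open import Data.Product using (Σ; ∃; _×_; _,_; proj₁; proj₂)
  open import Data.Rational as ℚ using (ℚ)
  open import Data.Rational.Properties using () renaming (_<?_ to _<ℚ?_)
  open import Data.Sum using (_⊎_; inj₁; inj₂; [_,_]′)
  open import Data.Vec using (Vec; lookup; []; _∷_; _[_]≔_; replicate; tabulate; toList)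
  open import Data.Vec.Properties using (lookup∘update; lookup∘update′; lookup-zipWith; lookup∘tabulate; lookup⇒[]=; []=⇒lookup)
  open import Induction.WellFounded using (Acc; acc)
  open import Relation.Binary.PropositionalEquality
  open import Relation.Nullary using (Dec; yes; no; ¬_)
  open import Relation.Nullary.Decidable using (⌊_⌋)
  open import Relation.Unary using (Decidable)

  -- Weighted degrees and the handshake identity

  sum-mono-≤ : ∀ {N} {f g : Fin N → ℕ} → (∀ i → f i ≤ g i) → sum f ≤ sum g
  sum-mono-≤ {zero}  f≤g = z≤n
  sum-mono-≤ {suc N} f≤g = +-mono-≤ (f≤g Fin.zero) (sum-mono-≤ (λ i → f≤g (Fin.suc i)))

  sum-const : ∀ N c → sum {N} (λ _ → c) ≡ N * c
  sum-const zero    c = refl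
  sum-const (suc N) c = cong (c +_) (sum-const N c)

  member≤sum : ∀ {N} (f : Fin N → ℕ) i → f i ≤ sum f
  member≤sum f Fin.zero    = m≤m+n _ _
  member≤sum f (Fin.suc i) = ≤-trans (member≤sum (λ j → f (Fin.suc j)) i) (m≤n+m _ _)

  𝟙 : Bool → ℕ
  𝟙 b = if b then 1 else 0

  𝟙≤1 : ∀ b → 𝟙 b ≤ 1
  𝟙≤1 true  = ≤-refl
  𝟙≤1 false = z≤n

  δ : ∀ {N} → Fin N → Fin N → ℕ
  δ i j = 𝟙 ⌊ i ≟ᶠ j ⌋

  sum-δ : ∀ {N} (i : Fin N) (w : Fin N → ℕ) → sum (λ j → w j * δ i j) ≡ w i
  sum-δ {suc N} Fin.zero w = begin
    w Fin.zero * 1 + sum (λ j → w (Fin.suc j) * 0) ≡⟨ cong₂ _+_ (*-identityʳ _) (sum-cong-≋ {N} (λ j → *-zeroʳ (w (Fin.suc j)))) ⟩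
    w Fin.zero + sum {N} (λ _ → 0)                 ≡⟨ cong (w Fin.zero +_) (trans (sum-const N 0) (*-zeroʳ N)) ⟩
    w Fin.zero + 0                                 ≡⟨ +-identityʳ _ ⟩
    w Fin.zero                                     ∎
    where open ≡-Reasoning
  sum-δ {suc N} (Fin.suc i) w = begin
    w Fin.zero * 0 + sum (λ j → w (Fin.suc j) * δ (Fin.suc i) (Fin.suc j))
      ≡⟨ cong₂ _+_ (*-zeroʳ (w Fin.zero)) (sum-cong-≋ {N} (λ j → cong (w (Fin.suc j) *_) (δ-suc j))) ⟩
    sum (λ j → w (Fin.suc j) * δ i j)
      ≡⟨ sum-δ i (λ j → w (Fin.suc j)) ⟩
    w (Fin.suc i) ∎
    where
    open ≡-Reasoning
    δ-suc : ∀ j → δ (Fin.suc i) (Fin.suc j) ≡ δ i j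
    δ-suc j with i ≟ᶠ j
    ... | yes _ = refl
    ... | no  _ = refl

  countF≡sum : ∀ {N} (f : Fin N → Bool) → countF f ≡ sum (λ j → 𝟙 (f j))
  countF≡sum {zero}  f = refl
  countF≡sum {suc N} f = cong (𝟙 (f Fin.zero) +_) (countF≡sum (λ j → f (Fin.suc j)))

  ∣∣≡sum : ∀ {N} (S : Subset N) → ∣ S ∣ ≡ sum (λ v → 𝟙 (lookup S v))
  ∣∣≡sum []          = refl
  ∣∣≡sum (true  ∷ S) = cong suc (∣∣≡sum S)
  ∣∣≡sum (false ∷ S) = ∣∣≡sum S

  𝟙-∧ : ∀ a b → 𝟙 (a ∧ b) ≡ 𝟙 a * 𝟙 b
  𝟙-∧ true  true  = refl
  𝟙-∧ true  false = refl
  𝟙-∧ false b     = refl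

  module _ {n} (G : Graph n) where

    src tgt : Fin (m G) → Fin n
    src j = proj₁ (edge G j)
    tgt j = proj₂ (edge G j)

    -- Degrees with respect to an arbitrary edge weighting; deg is the case of a 0/1 weighting.
    wdeg : (Fin (m G) → ℕ) → Fin n → ℕ
    wdeg x v = sum (λ j → x j * (δ (src j) v + δ (tgt j) v))

    -- By `noLoop` an edge meets `v` in at most one of its ends, so the Boolean disjunction is an
    -- honest sum.
    𝟙-isEnd : ∀ j v → 𝟙 (isEnd G j v) ≡ δ (src j) v + δ (tgt j) v
    𝟙-isEnd j v with src j ≟ᶠ v | tgt j ≟ᶠ v
    ... | yes p | yes q = ⊥-elim (noLoop G j (trans p (sym q)))
    ... | yes p | no  _ = refl
    ... | no  _ | yes q = refl
    ... | no  _ | no  _ = refl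

    countEnds≡wdeg : ∀ (f : Fin (m G) → Bool) v → countF (λ j → f j ∧ isEnd G j v) ≡ wdeg (λ j → 𝟙 (f j)) v
    countEnds≡wdeg f v = trans (countF≡sum (λ j → f j ∧ isEnd G j v))
      (sum-cong-≋ {m G} (λ j → trans (𝟙-∧ (f j) (isEnd G j v)) (cong (𝟙 (f j) *_) (𝟙-isEnd j v))))

    wdeg-cong : ∀ {x y} → (∀ j → x j ≡ y j) → ∀ v → wdeg x v ≡ wdeg y v
    wdeg-cong x≗y v = sum-cong-≋ {m G} (λ j → cong (_* (δ (src j) v + δ (tgt j) v)) (x≗y j))

    wdeg-+ : ∀ x y v → wdeg (λ j → x j + y j) v ≡ wdeg x v + wdeg y v
    wdeg-+ x y v = trans
      (sum-cong-≋ {m G} (λ j → *-distribʳ-+ (δ (src j) v + δ (tgt j) v) (x j) (y j)))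
      (∑-distrib-+ (λ j → x j * (δ (src j) v + δ (tgt j) v)) (λ j → y j * (δ (src j) v + δ (tgt j) v)))

    wdeg-mono : ∀ {x y} → (∀ j → x j ≤ y j) → ∀ v → wdeg x v ≤ wdeg y v
    wdeg-mono x≤y v = sum-mono-≤ (λ j → *-monoˡ-≤ (δ (src j) v + δ (tgt j) v) (x≤y j))

    -- Double counting of edge ends, each weighted by its vertex. With `w` the indicator of a vertex
    -- set it turns degree sums over the set into sums over edges, where hypotheses on the two ends
    -- of an edge can be applied.
    handshake : ∀ (w : Fin n → ℕ) x → sum (λ v → w v * wdeg x v) ≡ sum (λ j → x j * (w (src j) + w (tgt j)))
    handshake w x = begin
      sum (λ v → w v * wdeg x v)
        ≡⟨ sum-cong-≋ {n} (λ v → *-distribˡ-sum (w v) (λ j → x j * (δ (src j) v + δ (tgt j) v))) ⟩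
      sum (λ v → sum (λ j → w v * (x j * (δ (src j) v + δ (tgt j) v))))
        ≡⟨ ∑-comm (λ v j → w v * (x j * (δ (src j) v + δ (tgt j) v))) ⟩
      sum (λ j → sum (λ v → w v * (x j * (δ (src j) v + δ (tgt j) v))))
        ≡⟨ sum-cong-≋ {m G} inner ⟩
      sum (λ j → x j * (w (src j) + w (tgt j))) ∎
      where
      open ≡-Reasoning
      assoc : ∀ a b c d → a * (b * (c + d)) ≡ b * (a * c + a * d)
      assoc = solve-∀
      inner : ∀ j → sum (λ v → w v * (x j * (δ (src j) v + δ (tgt j) v))) ≡ x j * (w (src j) + w (tgt j))
      inner j = begin
        sum (λ v → w v * (x j * (δ (src j) v + δ (tgt j) v)))
          ≡⟨ sum-cong-≋ {n} (λ v → assoc (w v) (x j) (δ (src j) v) (δ (tgt j) v)) ⟩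
        sum (λ v → x j * (w v * δ (src j) v + w v * δ (tgt j) v))
          ≡⟨ *-distribˡ-sum (x j) (λ v → w v * δ (src j) v + w v * δ (tgt j) v) ⟨
        x j * sum (λ v → w v * δ (src j) v + w v * δ (tgt j) v)
          ≡⟨ cong (x j *_) (∑-distrib-+ (λ v → w v * δ (src j) v) (λ v → w v * δ (tgt j) v)) ⟩
        x j * (sum (λ v → w v * δ (src j) v) + sum (λ v → w v * δ (tgt j) v))
          ≡⟨ cong (x j *_) (cong₂ _+_ (sum-δ (src j) w) (sum-δ (tgt j) w)) ⟩
        x j * (w (src j) + w (tgt j)) ∎

  -- Degrees in two almost-EDCSs of the same graph

  ^-distribʳ-* : ∀ e a b → (a * b) ^ e ≡ a ^ e * b ^ e
  ^-distribʳ-* zero    a b = refl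
  ^-distribʳ-* (suc e) a b = trans (cong (a * b *_) (^-distribʳ-* e a b)) (swap a b (a ^ e) (b ^ e))
    where
    swap : ∀ a b c d → a * b * (c * d) ≡ a * c * (b * d)
    swap = solve-∀

  -- Bernoulli's inequality for `(1 + 1/y)^j`, multiplied through by `y^(j+1)`.
  bernoulli : ∀ y j → y ^ j * (y + j) ≤ suc y ^ j * y
  bernoulli y zero    = ≤-reflexive (cong (1 *_) (+-identityʳ y))
  bernoulli y (suc j) = begin
    y * y ^ j * (y + suc j)               ≤⟨ m≤m+n _ (y ^ j * j) ⟩
    y * y ^ j * (y + suc j) + y ^ j * j   ≡⟨ lhs y j (y ^ j) ⟩
    suc y * (y ^ j * (y + j))             ≤⟨ *-monoʳ-≤ (suc y) (bernoulli y j) ⟩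
    suc y * (suc y ^ j * y)               ≡⟨ *-assoc (suc y) (suc y ^ j) y ⟨
    suc y * suc y ^ j * y                 ∎
    where
    open ≤-Reasoning
    lhs : ∀ y j p → y * p * (y + (1 + j)) + p * j ≡ (1 + y) * (p * (y + j))
    lhs = solve-∀

  -- Bernoulli gives `(1 + 1/y)^y ≥ 2`, so every `y` factors `1 + 1/y` double the product. This
  -- bounds numbers of rounds and expresses `2 ^ z` in powers of `1 + 1/Y`.
  2^z-growth : ∀ y z .{{_ : NonZero y}} → 2 ^ z * y ^ (y * z) ≤ suc y ^ (y * z)
  2^z-growth y z = begin
    2 ^ z * y ^ (y * z)    ≡⟨ cong (2 ^ z *_) (^-*-assoc y y z) ⟨
    2 ^ z * (y ^ y) ^ z    ≡⟨ ^-distribʳ-* z 2 (y ^ y) ⟨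
    (2 * y ^ y) ^ z        ≤⟨ ^-monoˡ-≤ z doubling ⟩
    (suc y ^ y) ^ z        ≡⟨ ^-*-assoc (suc y) y z ⟩
    suc y ^ (y * z)        ∎
    where
    open ≤-Reasoning
    arr : ∀ y p → 2 * p * y ≡ p * (y + y)
    arr = solve-∀
    doubling : 2 * y ^ y ≤ suc y ^ y
    doubling = *-cancelʳ-≤ (2 * y ^ y) (suc y ^ y) y
      (≤-trans (≤-reflexive (arr y (y ^ y))) (bernoulli y y))

  module _ {n} (G : Graph n) where

    diff : (A B : Fin (m G) → Bool) → Fin (m G) → Bool
    diff A B j = A j ∧ not (B j)

    degᵇ : (Fin (m G) → Bool) → Fin n → ℕ
    degᵇ A = wdeg G (λ j → 𝟙 (A j))

    -- Both sides are the degree in `A ∪ B`. Hence a surplus of one set at `v` is a surplus of its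
    -- private edges, which is how a gap in degrees produces edges.
    degᵇ-balance : ∀ A B v → degᵇ A v + degᵇ (diff B A) v ≡ degᵇ B v + degᵇ (diff A B) v
    degᵇ-balance A B v = begin
      degᵇ A v + degᵇ (diff B A) v                     ≡⟨ wdeg-+ G (λ j → 𝟙 (A j)) (λ j → 𝟙 (diff B A j)) v ⟨
      wdeg G (λ j → 𝟙 (A j) + 𝟙 (diff B A j)) v        ≡⟨ wdeg-cong G (λ j → bool (A j) (B j)) v ⟩
      wdeg G (λ j → 𝟙 (B j) + 𝟙 (diff A B j)) v        ≡⟨ wdeg-+ G (λ j → 𝟙 (B j)) (λ j → 𝟙 (diff A B j)) v ⟩
      degᵇ B v + degᵇ (diff A B) v                     ∎
      where
      open ≡-Reasoning
      bool : ∀ a b → 𝟙 a + 𝟙 (b ∧ not a) ≡ 𝟙 b + 𝟙 (a ∧ not b)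
      bool true  true  = refl
      bool true  false = refl
      bool false true  = refl
      bool false false = refl

    degᵇ-diff≤ : ∀ A B v → degᵇ (diff A B) v ≤ degᵇ A v
    degᵇ-diff≤ A B = wdeg-mono G (λ j → bool (A j) (B j))
      where
      bool : ∀ a b → 𝟙 (a ∧ not b) ≤ 𝟙 a
      bool true  b = 𝟙≤1 (not b)
      bool false b = z≤n

    gap : ∀ A B D v → Bool
    gap A B D v = ⌊ degᵇ B v + D ≤? degᵇ A v ⌋

    -- The potential of the exchange argument: the number of ends of `A ∖ B` edges at vertices where
    -- `A` has surplus at least `D`.
    gapMass : (A B : Fin (m G) → Bool) → ℕ → ℕ
    gapMass A B D = sum (λ v → 𝟙 (gap A B D v) * degᵇ (diff A B) v)

    -- What remains of P1 for `A` and P2 for `B` on an edge of `A ∖ B` once β is eliminated. It is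
    -- one-sided so that `A` and `B` can exchange roles between rounds.
    AlmostDominated : ℕ → (A B : Fin (m G) → Bool) → Set
    AlmostDominated ℓ A B = ∀ j → diff A B j ≡ true →
      degᵇ A (src G j) + degᵇ A (tgt G j) ≤ degᵇ B (src G j) + degᵇ B (tgt G j) + ℓ

    -- An edge of A ∖ B cannot have a large degree surplus at both ends, so the A ∖ B edges
    -- leaving the vertices with surplus D + ℓ all end in vertices with deficit D; there B ∖ A
    -- is larger than A ∖ B by D.
    gapMass-step : ∀ A B D E M ℓ → E ≤ D → (∀ v → degᵇ A v ≤ M) → AlmostDominated ℓ A B →
      gapMass A B (D + ℓ) * (M + E) ≤ M * gapMass B A D
    gapMass-step A B D E M ℓ E≤D A≤M dom = begin
      gapMass A B (D + ℓ) * (M + E)                                         ≡⟨ cong (_* (M + E)) (handshake G (λ v → 𝟙 (P v)) (λ j → 𝟙 (diff A B j))) ⟩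
      sum (λ j → 𝟙 (diff A B j) * (𝟙 (P (src G j)) + 𝟙 (P (tgt G j)))) * (M + E)
        ≤⟨ *-monoˡ-≤ (M + E) (sum-mono-≤ edgewise) ⟩
      sum (λ j → 𝟙 (diff A B j) * (𝟙 (N (src G j)) + 𝟙 (N (tgt G j)))) * (M + E)
        ≡⟨ cong (_* (M + E)) (handshake G (λ v → 𝟙 (N v)) (λ j → 𝟙 (diff A B j))) ⟨
      sum (λ v → 𝟙 (N v) * degᵇ (diff A B) v) * (M + E)                     ≡⟨ *-distribʳ-sum (M + E) (λ v → 𝟙 (N v) * degᵇ (diff A B) v) ⟩
      sum (λ v → 𝟙 (N v) * degᵇ (diff A B) v * (M + E))                     ≤⟨ sum-mono-≤ vertexwise ⟩
      sum (λ v → M * (𝟙 (N v) * degᵇ (diff B A) v))                         ≡⟨ *-distribˡ-sum M (λ v → 𝟙 (N v) * degᵇ (diff B A) v) ⟨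
      M * gapMass B A D                                                     ∎
      where
      open ≤-Reasoning
      P N : Fin n → Bool
      P = gap A B (D + ℓ)
      N = gap B A D
      cross : ∀ u v → degᵇ A u + degᵇ A v ≤ degᵇ B u + degᵇ B v + ℓ → 𝟙 (P u) ≤ 𝟙 (N v)
      cross u v hyp with degᵇ B u + (D + ℓ) ≤? degᵇ A u | degᵇ A v + D ≤? degᵇ B v
      ... | no  _ | _     = z≤n
      ... | yes _ | yes _ = ≤-refl
      ... | yes p | no ¬q = ⊥-elim (¬q (+-cancelʳ-≤ (degᵇ B u + ℓ) _ _ (begin
        degᵇ A v + D + (degᵇ B u + ℓ)     ≡⟨ arr₁ (degᵇ A v) D (degᵇ B u) ℓ ⟩
        degᵇ B u + (D + ℓ) + degᵇ A v     ≤⟨ +-monoˡ-≤ (degᵇ A v) p ⟩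
        degᵇ A u + degᵇ A v               ≤⟨ hyp ⟩
        degᵇ B u + degᵇ B v + ℓ           ≡⟨ arr₂ (degᵇ B u) (degᵇ B v) ℓ ⟩
        degᵇ B v + (degᵇ B u + ℓ)         ∎)))
        where
        arr₁ : ∀ a d b l → a + d + (b + l) ≡ b + (d + l) + a
        arr₁ = solve-∀
        arr₂ : ∀ a b l → a + b + l ≡ b + (a + l)
        arr₂ = solve-∀
      edgewise : ∀ j → 𝟙 (diff A B j) * (𝟙 (P (src G j)) + 𝟙 (P (tgt G j))) ≤ 𝟙 (diff A B j) * (𝟙 (N (src G j)) + 𝟙 (N (tgt G j)))
      edgewise j with diff A B j in eq
      ... | false = z≤n
      ... | true  = +-monoˡ-≤ 0 (≤-trans
        (+-mono-≤ (cross (src G j) (tgt G j) (dom j eq))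
          (cross (tgt G j) (src G j) (≤-trans (≤-reflexive (+-comm (degᵇ A (tgt G j)) _)) (≤-trans (dom j eq) (≤-reflexive (cong (_+ ℓ) (+-comm (degᵇ B (src G j)) _)))))))
        (≤-reflexive (+-comm (𝟙 (N (tgt G j))) _)))
      -- At a deficit vertex `a + D ≤ b`, and `a ≤ M` turns this into `b ≥ a (1 + D/M)`. Using the
      -- fixed `E ≤ D` makes the gain the same factor `(M + E)/M` in every round.
      vertexwise : ∀ v → 𝟙 (N v) * degᵇ (diff A B) v * (M + E) ≤ M * (𝟙 (N v) * degᵇ (diff B A) v)
      vertexwise v with degᵇ A v + D ≤? degᵇ B v
      ... | no  _ = z≤n
      ... | yes q = begin
        1 * a * (M + E)   ≡⟨ arr a M E ⟩
        M * a + E * a     ≤⟨ +-monoʳ-≤ (M * a) (*-mono-≤ E≤D (≤-trans (degᵇ-diff≤ A B v) (A≤M v))) ⟩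
        M * a + D * M     ≡⟨ arr′ a M D ⟩
        M * (1 * (a + D)) ≤⟨ *-monoʳ-≤ M (*-monoʳ-≤ 1 a+D≤b) ⟩
        M * (1 * b)       ∎
        where
        a b : ℕ
        a = degᵇ (diff A B) v
        b = degᵇ (diff B A) v
        arr : ∀ a M E → 1 * a * (M + E) ≡ M * a + E * a
        arr = solve-∀
        arr′ : ∀ a M D → M * a + D * M ≡ M * (1 * (a + D))
        arr′ = solve-∀
        arr″ : ∀ a D A → a + D + A ≡ A + D + a
        arr″ = solve-∀
        a+D≤b : a + D ≤ b
        a+D≤b = +-cancelʳ-≤ (degᵇ A v) _ _ (begin
          a + D + degᵇ A v   ≡⟨ arr″ a D (degᵇ A v) ⟩
          degᵇ A v + D + a   ≤⟨ +-monoˡ-≤ a q ⟩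
          degᵇ B v + a       ≡⟨ degᵇ-balance A B v ⟨
          degᵇ A v + b       ≡⟨ +-comm (degᵇ A v) b ⟩
          b + degᵇ A v       ∎)

    gapMass-total : ∀ A B D → gapMass A B D ≤ 2 * m G
    gapMass-total A B D = begin
      gapMass A B D                                                                         ≡⟨ handshake G (λ v → 𝟙 (gap A B D v)) (λ j → 𝟙 (diff A B j)) ⟩
      sum (λ j → 𝟙 (diff A B j) * (𝟙 (gap A B D (src G j)) + 𝟙 (gap A B D (tgt G j))))       ≤⟨ sum-mono-≤ (λ j → *-mono-≤ (𝟙≤1 (diff A B j)) (+-mono-≤ (𝟙≤1 (gap A B D (src G j))) (𝟙≤1 (gap A B D (tgt G j))))) ⟩
      sum {m G} (λ _ → 2)                                                                   ≡⟨ sum-const (m G) 2 ⟩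
      m G * 2                                                                               ≡⟨ *-comm (m G) 2 ⟩
      2 * m G                                                                               ∎
      where open ≤-Reasoning

    -- Each round swaps `A` and `B` and lowers the threshold by `ℓ`. Starting from `E + t * ℓ` keeps
    -- it at least `E`, so that all `t` rounds gain the full factor; then the trivial bound by the
    -- number of edge ends applies.
    gapMass-decay : ∀ t A B E M ℓ → (∀ v → degᵇ A v ≤ M) → (∀ v → degᵇ B v ≤ M) →
      AlmostDominated ℓ A B → AlmostDominated ℓ B A →
      gapMass A B (E + t * ℓ) * (M + E) ^ t ≤ M ^ t * (2 * m G)
    gapMass-decay zero    A B E M ℓ _ _ _ _ = ≤-trans (≤-reflexive (*-identityʳ _))
      (≤-trans (gapMass-total A B (E + 0)) (m≤m+n (2 * m G) 0))
    gapMass-decay (suc t) A B E M ℓ A≤M B≤M domA domB = begin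
      gapMass A B (E + (ℓ + t * ℓ)) * ((M + E) * (M + E) ^ t) ≡⟨ cong (λ D → gapMass A B D * ((M + E) * (M + E) ^ t)) (arr E ℓ (t * ℓ)) ⟩
      gapMass A B (E + t * ℓ + ℓ) * ((M + E) * (M + E) ^ t)   ≡⟨ *-assoc (gapMass A B (E + t * ℓ + ℓ)) (M + E) _ ⟨
      gapMass A B (E + t * ℓ + ℓ) * (M + E) * (M + E) ^ t     ≤⟨ *-monoˡ-≤ ((M + E) ^ t) (gapMass-step A B (E + t * ℓ) E M ℓ (m≤m+n E _) A≤M domA) ⟩
      M * gapMass B A (E + t * ℓ) * (M + E) ^ t               ≡⟨ *-assoc M _ _ ⟩
      M * (gapMass B A (E + t * ℓ) * (M + E) ^ t)             ≤⟨ *-monoʳ-≤ M (gapMass-decay t B A E M ℓ B≤M A≤M domB domA) ⟩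
      M * (M ^ t * (2 * m G))                                 ≡⟨ *-assoc M (M ^ t) _ ⟨
      M * M ^ t * (2 * m G)                                   ∎
      where
      open ≤-Reasoning
      arr : ∀ e l s → e + (l + s) ≡ e + s + l
      arr = solve-∀

    -- With degree bound `r * E` a round gains the factor `1 + 1/r`, so `r * z` rounds gain `2 ^ z`,
    -- more than there are edge ends. One violating vertex is enough to start, because its surplus
    -- of at least `E ≥ 1` forces an edge of `A ∖ B` there.
    degree-uniqueness : ∀ A B r E ℓ z → 1 ≤ r → 1 ≤ E → 2 * m G < 2 ^ z →
      (∀ v → degᵇ A v ≤ r * E) → (∀ v → degᵇ B v ≤ r * E) →
      AlmostDominated ℓ A B → AlmostDominated ℓ B A →
      ∀ v → degᵇ A v < degᵇ B v + (E + r * z * ℓ)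
    degree-uniqueness A B r E ℓ z 1≤r 1≤E 2m<2^z A≤M B≤M domA domB v
      with degᵇ B v + (E + r * z * ℓ) ≤? degᵇ A v in eq
    ... | no ¬q = ≰⇒> ¬q
    ... | yes q = ⊥-elim (<⇒≱ 2m<2^z (*-cancelʳ-≤ (2 ^ z) (2 * m G) (r ^ t * E ^ t) (begin
      2 ^ z * (r ^ t * E ^ t)                     ≡⟨ *-assoc (2 ^ z) _ _ ⟨
      2 ^ z * r ^ t * E ^ t                       ≤⟨ *-monoˡ-≤ (E ^ t) (2^z-growth r z {{>-nonZero 1≤r}}) ⟩
      suc r ^ t * E ^ t                           ≡⟨ ^-distribʳ-* t (suc r) E ⟨
      (suc r * E) ^ t                             ≡⟨ cong (_^ t) (+-comm E (r * E)) ⟩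
      (r * E + E) ^ t                             ≤⟨ m≤m*n′ ⟩
      gapMass A B (E + t * ℓ) * (r * E + E) ^ t   ≤⟨ gapMass-decay t A B E (r * E) ℓ A≤M B≤M domA domB ⟩
      (r * E) ^ t * (2 * m G)                     ≡⟨ cong (_* (2 * m G)) (^-distribʳ-* t r E) ⟩
      r ^ t * E ^ t * (2 * m G)                   ≡⟨ *-comm (r ^ t * E ^ t) (2 * m G) ⟩
      2 * m G * (r ^ t * E ^ t)                   ∎)))
      where
      open ≤-Reasoning
      t : ℕ
      t = r * z
      instance
        pos : NonZero (r ^ t * E ^ t)
        pos = m*n≢0 (r ^ t) (E ^ t) {{m^n≢0 r t {{>-nonZero 1≤r}}}} {{m^n≢0 E t {{>-nonZero 1≤E}}}}
      1≤a : 1 ≤ degᵇ (diff A B) v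
      1≤a = ≤-trans 1≤E (≤-trans (m≤m+n E (t * ℓ)) (+-cancelˡ-≤ (degᵇ B v) _ _ (begin
        degᵇ B v + (E + t * ℓ)         ≤⟨ q ⟩
        degᵇ A v                       ≤⟨ m≤m+n _ _ ⟩
        degᵇ A v + degᵇ (diff B A) v   ≡⟨ degᵇ-balance A B v ⟩
        degᵇ B v + degᵇ (diff A B) v   ∎)))
      1≤mass : 1 ≤ gapMass A B (E + t * ℓ)
      1≤mass = begin
        1                                                             ≤⟨ 1≤a ⟩
        degᵇ (diff A B) v                                             ≡⟨ *-identityˡ _ ⟨
        1 * degᵇ (diff A B) v                                         ≡⟨ cong (λ d → 𝟙 ⌊ d ⌋ * degᵇ (diff A B) v) eq ⟨
        𝟙 (gap A B (E + t * ℓ) v) * degᵇ (diff A B) v                 ≤⟨ member≤sum (λ v → 𝟙 (gap A B (E + t * ℓ) v) * degᵇ (diff A B) v) v ⟩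
        gapMass A B (E + t * ℓ)                                       ∎
      m≤m*n′ : (r * E + E) ^ t ≤ gapMass A B (E + t * ℓ) * (r * E + E) ^ t
      m≤m*n′ = ≤-trans (≤-reflexive (sym (*-identityˡ _))) (*-monoˡ-≤ ((r * E + E) ^ t) 1≤mass)

  -- Existence of a balanced subgraph

  -- Used for two purposes: Boolean words are the candidates of the minimisation, and words over
  -- `allFin k` are the equally likely partitions.
  words : ∀ {A : Set} → List A → ∀ N → List (Vec A N)
  words xs zero    = [] ∷ []
  words xs (suc N) = cartesianProductWith _∷_ xs (words xs N)

  ∈-words : ∀ {A : Set} {xs : List A} → (∀ x → x ∈ˡ xs) → ∀ {N} (w : Vec A N) → w ∈ˡ words xs N
  ∈-words all []      = here refl
  ∈-words all (x ∷ w) = ∈-cartesianProductWith⁺ _∷_ (all x) (∈-words all w)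

  module _ {n} (G : Graph n) where

    cost : ℕ → (Fin (m G) → Bool) → ℕ
    cost c f = sum (λ v → degᵇ G f v * degᵇ G f v) + 2 * c * sum (λ j → 𝟙 (not (f j)))

    endpoints : Fin (m G) → Fin n → ℕ
    endpoints e v = δ (src G e) v + δ (tgt G e) v

    sum-endpoints : ∀ e (w : Fin n → ℕ) → sum (λ v → w v * endpoints e v) ≡ w (src G e) + w (tgt G e)
    sum-endpoints e w = begin
      sum (λ v → w v * endpoints e v)                                 ≡⟨ sum-cong-≋ {n} (λ v → *-distribˡ-+ (w v) _ _) ⟩
      sum (λ v → w v * δ (src G e) v + w v * δ (tgt G e) v)            ≡⟨ ∑-distrib-+ (λ v → w v * δ (src G e) v) (λ v → w v * δ (tgt G e) v) ⟩
      sum (λ v → w v * δ (src G e) v) + sum (λ v → w v * δ (tgt G e) v) ≡⟨ cong₂ _+_ (sum-δ (src G e) w) (sum-δ (tgt G e) w) ⟩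
      w (src G e) + w (tgt G e)                                       ∎
      where open ≡-Reasoning

    endpoints-src : ∀ e → endpoints e (src G e) ≡ 1
    endpoints-src e with src G e ≟ᶠ src G e | tgt G e ≟ᶠ src G e
    ... | no p  | _     = ⊥-elim (p refl)
    ... | yes _ | yes q = ⊥-elim (noLoop G e (sym q))
    ... | yes _ | no _  = refl

    endpoints-tgt : ∀ e → endpoints e (tgt G e) ≡ 1
    endpoints-tgt e with tgt G e ≟ᶠ tgt G e | src G e ≟ᶠ tgt G e
    ... | no p  | _     = ⊥-elim (p refl)
    ... | yes _ | yes q = ⊥-elim (noLoop G e q)
    ... | yes _ | no _  = refl

    module _ {f g : Fin (m G) → Bool} {e : Fin (m G)} (add : ∀ j → 𝟙 (g j) ≡ 𝟙 (f j) + δ e j) where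

      degᵇ-add : ∀ v → degᵇ G g v ≡ degᵇ G f v + endpoints e v
      degᵇ-add v = begin
        degᵇ G g v                                  ≡⟨ wdeg-cong G add v ⟩
        wdeg G (λ j → 𝟙 (f j) + δ e j) v            ≡⟨ wdeg-+ G (λ j → 𝟙 (f j)) (δ e) v ⟩
        degᵇ G f v + wdeg G (δ e) v                 ≡⟨ cong (degᵇ G f v +_) (sum-cong-≋ {m G} (λ j → *-comm (δ e j) (endpoints j v))) ⟩
        degᵇ G f v + sum (λ j → endpoints j v * δ e j) ≡⟨ cong (degᵇ G f v +_) (sum-δ e (λ j → endpoints j v)) ⟩
        degᵇ G f v + endpoints e v                  ∎
        where open ≡-Reasoning

      degᵇ-add-ends : degᵇ G g (src G e) + degᵇ G g (tgt G e) ≡ degᵇ G f (src G e) + degᵇ G f (tgt G e) + 2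
      degᵇ-add-ends = begin
        degᵇ G g (src G e) + degᵇ G g (tgt G e)
          ≡⟨ cong₂ _+_ (trans (degᵇ-add (src G e)) (cong (degᵇ G f (src G e) +_) (endpoints-src e)))
                       (trans (degᵇ-add (tgt G e)) (cong (degᵇ G f (tgt G e) +_) (endpoints-tgt e))) ⟩
        degᵇ G f (src G e) + 1 + (degᵇ G f (tgt G e) + 1)   ≡⟨ arr (degᵇ G f (src G e)) (degᵇ G f (tgt G e)) ⟩
        degᵇ G f (src G e) + degᵇ G f (tgt G e) + 2         ∎
        where
        open ≡-Reasoning
        arr : ∀ a b → a + 1 + (b + 1) ≡ a + b + 2
        arr = solve-∀

      missing-add : sum (λ j → 𝟙 (not (f j))) ≡ sum (λ j → 𝟙 (not (g j))) + 1
      missing-add = begin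
        sum (λ j → 𝟙 (not (f j)))                                  ≡⟨ sum-cong-≋ {m G} (λ j → bool (f j) (g j) (δ e j) (add j)) ⟩
        sum (λ j → 𝟙 (not (g j)) + 1 * δ e j)                      ≡⟨ ∑-distrib-+ (λ j → 𝟙 (not (g j))) (λ j → 1 * δ e j) ⟩
        sum (λ j → 𝟙 (not (g j))) + sum (λ j → 1 * δ e j)          ≡⟨ cong (sum (λ j → 𝟙 (not (g j))) +_) (sum-δ e (λ _ → 1)) ⟩
        sum (λ j → 𝟙 (not (g j))) + 1                              ∎
        where
        open ≡-Reasoning
        bool : ∀ a b d → 𝟙 b ≡ 𝟙 a + d → 𝟙 (not a) ≡ 𝟙 (not b) + 1 * d
        bool true  true  zero    _ = refl
        bool false true  (suc zero) _ = refl
        bool false false zero    _ = refl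

      -- Inserting `e` raises the sum of squares by `2 (deg u + deg v + 1)` and saves the penalty
      -- `2c`, so at a minimum `deg u + deg v + 1` is compared with `c`. Deletion is the same
      -- equation with the minimiser in the place of `g`.
      cost-add : ∀ c → cost c g + 2 * c ≡ cost c f + 2 * (degᵇ G f (src G e) + degᵇ G f (tgt G e) + 1)
      cost-add c = begin
        sum (λ v → degᵇ G g v * degᵇ G g v) + 2 * c * M′ + 2 * c
          ≡⟨ cong (λ s → s + 2 * c * M′ + 2 * c) squares ⟩
        (Q + (2 * D + 2)) + 2 * c * M′ + 2 * c
          ≡⟨ arr Q D c M′ ⟩
        Q + 2 * c * (M′ + 1) + 2 * (D + 1)
          ≡⟨ cong (λ s → Q + 2 * c * s + 2 * (D + 1)) missing-add ⟨
        cost c f + 2 * (D + 1) ∎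
        where
        open ≡-Reasoning
        Q M′ D : ℕ
        Q  = sum (λ v → degᵇ G f v * degᵇ G f v)
        M′ = sum (λ j → 𝟙 (not (g j)))
        D  = degᵇ G f (src G e) + degᵇ G f (tgt G e)
        arr : ∀ Q D c M → (Q + (2 * D + 2)) + 2 * c * M + 2 * c ≡ Q + 2 * c * (M + 1) + 2 * (D + 1)
        arr = solve-∀
        sq : ∀ d i → (d + i) * (d + i) ≡ d * d + (2 * d + i) * i
        sq = solve-∀
        arr′ : ∀ a b → 2 * a + 1 + (2 * b + 1) ≡ 2 * (a + b) + 2
        arr′ = solve-∀
        squares : sum (λ v → degᵇ G g v * degᵇ G g v) ≡ Q + (2 * D + 2)
        squares = begin
          sum (λ v → degᵇ G g v * degᵇ G g v)
            ≡⟨ sum-cong-≋ {n} (λ v → trans (cong₂ _*_ (degᵇ-add v) (degᵇ-add v)) (sq (degᵇ G f v) (endpoints e v))) ⟩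
          sum (λ v → degᵇ G f v * degᵇ G f v + (2 * degᵇ G f v + endpoints e v) * endpoints e v)
            ≡⟨ ∑-distrib-+ (λ v → degᵇ G f v * degᵇ G f v) (λ v → (2 * degᵇ G f v + endpoints e v) * endpoints e v) ⟩
          Q + sum (λ v → (2 * degᵇ G f v + endpoints e v) * endpoints e v)
            ≡⟨ cong (Q +_) (sum-endpoints e (λ v → 2 * degᵇ G f v + endpoints e v)) ⟩
          Q + (2 * degᵇ G f (src G e) + endpoints e (src G e) + (2 * degᵇ G f (tgt G e) + endpoints e (tgt G e)))
            ≡⟨ cong (Q +_) (cong₂ (λ a b → 2 * degᵇ G f (src G e) + a + (2 * degᵇ G f (tgt G e) + b)) (endpoints-src e) (endpoints-tgt e)) ⟩
          Q + (2 * degᵇ G f (src G e) + 1 + (2 * degᵇ G f (tgt G e) + 1))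
            ≡⟨ cong (Q +_) (arr′ (degᵇ G f (src G e)) (degᵇ G f (tgt G e))) ⟩
          Q + (2 * D + 2) ∎

    update-true : ∀ (H : Subset (m G)) e → lookup H e ≡ false →
      ∀ j → 𝟙 (lookup (H [ e ]≔ true) j) ≡ 𝟙 (lookup H j) + δ e j
    update-true H e He j with e ≟ᶠ j
    ... | yes refl = trans (cong 𝟙 (lookup∘update e H true)) (cong (λ b → 𝟙 b + 1) (sym He))
    ... | no e≢j   = trans (cong 𝟙 (lookup∘update′ (λ j≡e → e≢j (sym j≡e)) H true)) (sym (+-identityʳ _))

    update-false : ∀ (H : Subset (m G)) e → lookup H e ≡ true →
      ∀ j → 𝟙 (lookup H j) ≡ 𝟙 (lookup (H [ e ]≔ false) j) + δ e j
    update-false H e He j with e ≟ᶠ j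
    ... | yes refl = trans (cong 𝟙 He) (cong (λ b → 𝟙 b + 1) (sym (lookup∘update e H false)))
    ... | no e≢j   = trans (cong 𝟙 (sym (lookup∘update′ (λ j≡e → e≢j (sym j≡e)) H false))) (sym (+-identityʳ _))

    -- A minimiser of Σ deg² + 2c · #(missing edges) is an EDCS with gap 2: toggling an edge must not decrease the cost.
    balanced-subgraph : ∀ c → Σ (Subset (m G)) λ H →
      (∀ e → lookup H e ≡ true → degᵇ G (lookup H) (src G e) + degᵇ G (lookup H) (tgt G e) ≤ c + 1) ×
      (∀ e → lookup H e ≡ false → c ≤ degᵇ G (lookup H) (src G e) + degᵇ G (lookup H) (tgt G e) + 1)
    balanced-subgraph c = H , upper , lower
      where
      open ≤-Reasoning
      subsets : List (Subset (m G))
      subsets = words (true ∷ false ∷ []) (m G)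
      -- `argmin` asks for a start value; the empty subgraph is taken, and the list contains every
      -- subgraph.
      H : Subset (m G)
      H = argmin (λ X → cost c (lookup X)) (replicate (m G) false) subsets
      bools : ∀ b → b ∈ˡ true ∷ false ∷ []
      bools true  = here refl
      bools false = there (here refl)
      minimal : ∀ X → cost c (lookup H) ≤ cost c (lookup X)
      minimal X = All.lookup (f[argmin]≤f[xs] (replicate (m G) false) subsets) (∈-words bools X)
      upper : ∀ e → lookup H e ≡ true → degᵇ G (lookup H) (src G e) + degᵇ G (lookup H) (tgt G e) ≤ c + 1
      upper e He = begin
        degᵇ G (lookup H) (src G e) + degᵇ G (lookup H) (tgt G e) ≡⟨ degᵇ-add-ends (update-false H e He) ⟩
        D + 2                                                     ≡⟨ +-assoc D 1 1 ⟨
        D + 1 + 1                                                 ≤⟨ +-monoˡ-≤ 1 D+1≤c ⟩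
        c + 1                                                     ∎
        where
        D : ℕ
        D = degᵇ G (lookup (H [ e ]≔ false)) (src G e) + degᵇ G (lookup (H [ e ]≔ false)) (tgt G e)
        -- `D` is measured after the deletion of `e`. Putting `e` back adds one at either end, so
        -- the degree sum is `D + 2`, at most `c + 1`.
        D+1≤c : D + 1 ≤ c
        D+1≤c = *-cancelˡ-≤ 2 (+-cancelˡ-≤ (cost c (lookup H)) _ _ (begin
          cost c (lookup H) + 2 * (D + 1)                     ≤⟨ +-monoˡ-≤ _ (minimal (H [ e ]≔ false)) ⟩
          cost c (lookup (H [ e ]≔ false)) + 2 * (D + 1)      ≡⟨ cost-add (update-false H e He) c ⟨
          cost c (lookup H) + 2 * c                           ∎))
      lower : ∀ e → lookup H e ≡ false → c ≤ degᵇ G (lookup H) (src G e) + degᵇ G (lookup H) (tgt G e) + 1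
      lower e He = *-cancelˡ-≤ 2 (+-cancelˡ-≤ (cost c (lookup H)) _ _ (begin
        cost c (lookup H) + 2 * c                          ≤⟨ +-monoˡ-≤ _ (minimal (H [ e ]≔ true)) ⟩
        cost c (lookup (H [ e ]≔ true)) + 2 * c            ≡⟨ cost-add (update-true H e He) c ⟩
        cost c (lookup H) + 2 * (degᵇ G (lookup H) (src G e) + degᵇ G (lookup H) (tgt G e) + 1) ∎))

  -- Counting outcomes of the random partition

  total : ∀ {X : Set} → (X → ℕ) → List X → ℕ
  total g []       = 0
  total g (x ∷ xs) = g x + total g xs

  total-++ : ∀ {X : Set} (g : X → ℕ) xs ys → total g (xs ++ ys) ≡ total g xs + total g ys
  total-++ g []       ys = refl
  total-++ g (x ∷ xs) ys = trans (cong (g x +_) (total-++ g xs ys)) (sym (+-assoc (g x) _ _))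

  total-map : ∀ {X Y : Set} (g : Y → ℕ) (h : X → Y) (w : X → ℕ) c → (∀ x → g (h x) ≡ c * w x) →
    ∀ xs → total g (map h xs) ≡ c * total w xs
  total-map g h w c eq []       = sym (*-zeroʳ c)
  total-map g h w c eq (x ∷ xs) = trans (cong₂ _+_ (eq x) (total-map g h w c eq xs)) (sym (*-distribˡ-+ c _ _))

  -- Independence of coordinates: the sum over all words of a product of functions of the
  -- coordinates factors. It yields both the number of words and the exponential moments.
  total-product : ∀ {X Y Z : Set} (_·_ : X → Y → Z) {g : Z → ℕ} {w : X → ℕ} {h : Y → ℕ} →
    (∀ x y → g (x · y) ≡ w x * h y) → ∀ xs ys → total g (cartesianProductWith _·_ xs ys) ≡ total w xs * total h ys
  total-product _·_ eq []       ys = refl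
  total-product _·_ {g} {w} {h} eq (x ∷ xs) ys = begin
    total g (map (x ·_) ys ++ cartesianProductWith _·_ xs ys)          ≡⟨ total-++ g (map (x ·_) ys) _ ⟩
    total g (map (x ·_) ys) + total g (cartesianProductWith _·_ xs ys) ≡⟨ cong₂ _+_ (total-map g (x ·_) h (w x) (eq x) ys) (total-product _·_ eq xs ys) ⟩
    w x * total h ys + total w xs * total h ys                         ≡⟨ *-distribʳ-+ (total h ys) (w x) _ ⟨
    (w x + total w xs) * total h ys                                    ∎
    where open ≡-Reasoning

  total-tabulate : ∀ {X : Set} {N} (g : X → ℕ) (h : Fin N → X) → total g (tabulateˡ h) ≡ sum (λ i → g (h i))
  total-tabulate {N = zero}  g h = refl
  total-tabulate {N = suc N} g h = cong (g (h Fin.zero) +_) (total-tabulate g (λ i → h (Fin.suc i)))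

  total-1 : ∀ {X : Set} (xs : List X) → total (λ _ → 1) xs ≡ length xs
  total-1 []       = refl
  total-1 (x ∷ xs) = cong suc (total-1 xs)

  length-words : ∀ k N → length (words (allFin k) N) ≡ k ^ N
  length-words k zero    = refl
  length-words k (suc N) = begin
    length (words (allFin k) (suc N))                             ≡⟨ total-1 (words (allFin k) (suc N)) ⟨
    total (λ _ → 1) (words (allFin k) (suc N))                    ≡⟨ total-product _∷_ (λ _ _ → refl) (allFin k) (words (allFin k) N) ⟩
    total (λ _ → 1) (allFin k) * total (λ _ → 1) (words (allFin k) N)
      ≡⟨ cong₂ _*_ (trans (total-1 (allFin k)) (length-tabulate {n = k} (λ i → i))) (trans (total-1 (words (allFin k) N)) (length-words k N)) ⟩
    k * k ^ N                                                     ∎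
    where open ≡-Reasoning

  -- Markov's inequality for `W - c`, arranged without subtraction. The case `c = 0` is the usual
  -- one; a positive `c` sharpens it when `W` rarely exceeds its minimum.
  markov : ∀ {X : Set} {P : X → Set} (P? : Decidable P) (W : X → ℕ) c Z →
    (∀ x → c ≤ W x) → (∀ x → P x → c + Z ≤ W x) →
    ∀ xs → length (filter P? xs) * Z + length xs * c ≤ total W xs
  markov P? W c Z c≤W Z≤W []       = z≤n
  markov P? W c Z c≤W Z≤W (x ∷ xs) with P? x | markov P? W c Z c≤W Z≤W xs
  ... | yes Px | ih = ≤-trans (≤-reflexive (arr Z (length (filter P? xs) * Z) c (length xs * c))) (+-mono-≤ (Z≤W x Px) ih)
    where
    arr : ∀ z s c t → z + s + (c + t) ≡ c + z + (s + t)
    arr = solve-∀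
  ... | no _ | ih = ≤-trans (≤-reflexive (arr (length (filter P? xs) * Z) c (length xs * c))) (+-mono-≤ (c≤W x) ih)
    where
    arr : ∀ s c t → s + (c + t) ≡ c + (s + t)
    arr = solve-∀

  -- Out of T equally likely outcomes, P has probability at most N / Z.
  record Rare {X : Set} (T N Z : ℕ) (P : X → Set) : Set where
    constructor rarely
    field
      bad     : List X
      few     : length bad * Z ≤ N * T
      catches : ∀ x → P x → x ∈ˡ bad

  -- The union bound. Keeping `Z` common to all events lets the numerators simply add.
  rare-⊎ : ∀ {X : Set} {T N N′ Z} {P Q : X → Set} → Rare T N Z P → Rare T N′ Z Q → Rare T (N + N′) Z (λ x → P x ⊎ Q x)
  rare-⊎ {T = T} {N} {N′} {Z} {P} {Q} (rarely B ∣B∣ P⇒B) (rarely B′ ∣B′∣ Q⇒B′) = rarely (B ++ B′) bound mem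
    where
    open ≤-Reasoning
    bound : length (B ++ B′) * Z ≤ (N + N′) * T
    bound = begin
      length (B ++ B′) * Z          ≡⟨ cong (_* Z) (length-++ B) ⟩
      (length B + length B′) * Z    ≡⟨ *-distribʳ-+ Z (length B) _ ⟩
      length B * Z + length B′ * Z  ≤⟨ +-mono-≤ ∣B∣ ∣B′∣ ⟩
      N * T + N′ * T                ≡⟨ *-distribʳ-+ T N N′ ⟨
      (N + N′) * T                  ∎
    mem : ∀ x → P x ⊎ Q x → x ∈ˡ B ++ B′
    mem x (inj₁ p) = ∈-++⁺ˡ (P⇒B x p)
    mem x (inj₂ q) = ∈-++⁺ʳ B (Q⇒B′ x q)

  rare-map : ∀ {X : Set} {T N Z} {P Q : X → Set} → (∀ x → Q x → P x) → Rare T N Z P → Rare T N Z Q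
  rare-map Q⇒P (rarely B ∣B∣ P⇒B) = rarely B ∣B∣ (λ x q → P⇒B x (Q⇒P x q))

  rare-∃ : ∀ {X : Set} {T N Z r} {P : Fin r → X → Set} → (∀ i → Rare T N Z (P i)) → Rare T (r * N) Z (λ x → ∃ λ i → P i x)
  rare-∃ {r = zero}  rare = rarely [] z≤n (λ { x (() , _) })
  rare-∃ {r = suc r} {P} rare = rare-map
    (λ { x (Fin.zero , p) → inj₁ p ; x (Fin.suc i , p) → inj₂ (i , p) })
    (rare-⊎ (rare Fin.zero) (rare-∃ (λ i → rare (Fin.suc i))))

  module _ {k : ℕ} (i : Fin k) where

    hit : Fin k → Bool
    hit c = ⌊ c ≟ᶠ i ⌋

    hits : ∀ {N} → (Fin N → Bool) → Vec (Fin k) N → ℕ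
    hits f p = sum (λ j → 𝟙 (f j ∧ hit (lookup p j)))

    factor : ℕ → ℕ → Bool → Fin k → ℕ
    factor a b active c = if active then (if hit c then a else b) else 1

    -- The exponential moment `b^d (a/b)^hits` in integral form, `d` being the number of active
    -- edges. Taking `a > b` serves upper tails and `a < b` the lower tail.
    weight : ℕ → ℕ → ∀ {N} → (Fin N → Bool) → Vec (Fin k) N → ℕ
    weight a b f []      = 1
    weight a b f (c ∷ p) = factor a b (f Fin.zero) c * weight a b (λ j → f (Fin.suc j)) p

    weight-hits : ∀ a b {N} (f : Fin N → Bool) p → weight a b f p * b ^ hits f p ≡ a ^ hits f p * b ^ sum (λ j → 𝟙 (f j))
    weight-hits a b f []      = refl
    weight-hits a b f (c ∷ p) with f Fin.zero
    ... | false = trans (cong (_* b ^ hits f′ p) (*-identityˡ (weight a b f′ p))) (weight-hits a b f′ p)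
      where
      f′ : Fin _ → Bool
      f′ j = f (Fin.suc j)
    ... | true with hit c
    ... | true  = trans (arr a b (weight a b f′ p) (b ^ hits f′ p))
          (trans (cong (a * b *_) (weight-hits a b f′ p)) (arr′ a b (a ^ hits f′ p) _))
      where
      f′ : Fin _ → Bool
      f′ j = f (Fin.suc j)
      arr : ∀ a b w h → a * w * (b * h) ≡ a * b * (w * h)
      arr = solve-∀
      arr′ : ∀ a b x y → a * b * (x * y) ≡ a * x * (b * y)
      arr′ = solve-∀
    ... | false = trans (*-assoc b _ _)
          (trans (cong (b *_) (weight-hits a b f′ p)) (arr′ b (a ^ hits f′ p) _))
      where
      f′ : Fin _ → Bool
      f′ j = f (Fin.suc j)
      arr′ : ∀ b x y → b * (x * y) ≡ x * (b * y)
      arr′ = solve-∀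

    -- Over its `k` possible pieces an active edge contributes `(k - 1) b + a`; the hypothesis names
    -- this number without subtraction.
    sum-factor : ∀ a b R → R + b ≡ k * b + a → total (factor a b true) (allFin k) ≡ R
    sum-factor a b R R≡ = +-cancelʳ-≡ b _ _ (begin
      total (factor a b true) (allFin k) + b                        ≡⟨ cong (_+ b) (total-tabulate (factor a b true) (λ c → c)) ⟩
      sum (factor a b true) + b                                     ≡⟨ cong (sum (factor a b true) +_) (sum-δ i (λ _ → b)) ⟨
      sum (factor a b true) + sum (λ c → b * δ i c)                 ≡⟨ ∑-distrib-+ (factor a b true) (λ c → b * δ i c) ⟨
      sum (λ c → factor a b true c + b * δ i c)                     ≡⟨ sum-cong-≋ {k} pointwise ⟩
      sum (λ c → b + a * δ i c)                                     ≡⟨ ∑-distrib-+ {k} (λ _ → b) (λ c → a * δ i c) ⟩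
      sum {k} (λ _ → b) + sum (λ c → a * δ i c)                     ≡⟨ cong₂ _+_ (sum-const k b) (sum-δ i (λ _ → a)) ⟩
      k * b + a                                                     ≡⟨ R≡ ⟨
      R + b                                                         ∎)
      where
      open ≡-Reasoning
      pointwise : ∀ c → factor a b true c + b * δ i c ≡ b + a * δ i c
      pointwise c with c ≟ᶠ i | i ≟ᶠ c
      ... | yes _ | yes _ = trans (cong₂ _+_ (sym (*-identityʳ a)) (*-identityʳ b)) (+-comm _ b)
      ... | no _  | no _  = trans (cong (b +_) (*-zeroʳ b)) (cong (b +_) (sym (*-zeroʳ a)))
      ... | yes p | no q  = ⊥-elim (q (sym p))
      ... | no q  | yes p = ⊥-elim (q (sym p))

    -- Every active edge contributes `R` and every inactive one `k`, so the total is `R^d k^(N-d)`;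
    -- the factor `k^d` on the left removes the difference in the exponent.
    total-weight : ∀ a b R → R + b ≡ k * b + a → ∀ N (f : Fin N → Bool) →
      total (weight a b f) (words (allFin k) N) * k ^ sum (λ j → 𝟙 (f j)) ≡ R ^ sum (λ j → 𝟙 (f j)) * k ^ N
    total-weight a b R R≡ zero    f = refl
    total-weight a b R R≡ (suc N) f = begin
      total (weight a b f) (words (allFin k) (suc N)) * k ^ (𝟙 (f Fin.zero) + s)
        ≡⟨ cong (_* k ^ (𝟙 (f Fin.zero) + s)) (total-product _∷_ (λ c p → refl) (allFin k) (words (allFin k) N)) ⟩
      total (factor a b (f Fin.zero)) (allFin k) * t * k ^ (𝟙 (f Fin.zero) + s)
        ≡⟨ cases (f Fin.zero) ⟩
      R ^ (𝟙 (f Fin.zero) + s) * k ^ suc N ∎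
      where
      open ≡-Reasoning
      f′ : Fin N → Bool
      f′ j = f (Fin.suc j)
      s t : ℕ
      s = sum (λ j → 𝟙 (f′ j))
      t = total (weight a b f′) (words (allFin k) N)
      arr₁ : ∀ r t k x → r * t * (k * x) ≡ r * k * (t * x)
      arr₁ = solve-∀
      arr₂ : ∀ r k y z → r * k * (y * z) ≡ r * y * (k * z)
      arr₂ = solve-∀
      arr₃ : ∀ k y z → k * (y * z) ≡ y * (k * z)
      arr₃ = solve-∀
      cases : ∀ active → total (factor a b active) (allFin k) * t * k ^ (𝟙 active + s) ≡ R ^ (𝟙 active + s) * k ^ suc N
      cases true = begin
        total (factor a b true) (allFin k) * t * (k * k ^ s) ≡⟨ cong (λ r → r * t * (k * k ^ s)) (sum-factor a b R R≡) ⟩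
        R * t * (k * k ^ s)                                  ≡⟨ arr₁ R t k (k ^ s) ⟩
        R * k * (t * k ^ s)                                  ≡⟨ cong (R * k *_) (total-weight a b R R≡ N f′) ⟩
        R * k * (R ^ s * k ^ N)                              ≡⟨ arr₂ R k (R ^ s) (k ^ N) ⟩
        R * R ^ s * (k * k ^ N)                              ∎
      cases false = begin
        total (factor a b false) (allFin k) * t * k ^ s      ≡⟨ cong (λ r → r * t * k ^ s) (trans (total-tabulate (factor a b false) (λ c → c)) (trans (sum-const k 1) (*-identityʳ k))) ⟩
        k * t * k ^ s                                        ≡⟨ *-assoc k t _ ⟩
        k * (t * k ^ s)                                      ≡⟨ cong (k *_) (total-weight a b R R≡ N f′) ⟩
        k * (R ^ s * k ^ N)                                  ≡⟨ arr₃ k (R ^ s) (k ^ N) ⟩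
        R ^ s * (k * k ^ N)                                  ∎

  -- Chernoff bounds by counting

  -- The counterpart of Bernoulli from above: `(1 + 1/y)^j ≤ 1 + x + x²` for `x = j/y ≤ 1`,
  -- multiplied by `y^(j+2)`. It replaces the quadratic bound on the exponential function.
  1+1/y-power : ∀ y j → j ≤ y → suc y ^ j * (y * y) ≤ y ^ j * (y * y + j * y + j * j)
  1+1/y-power y zero    _   = ≤-reflexive (cong (1 *_) (sym (trans (+-identityʳ _) (+-identityʳ _))))
  1+1/y-power y (suc j) j<y = begin
    suc y * suc y ^ j * (y * y)                       ≡⟨ *-assoc (suc y) (suc y ^ j) (y * y) ⟩
    suc y * (suc y ^ j * (y * y))                     ≤⟨ *-monoʳ-≤ (suc y) (1+1/y-power y j (<⇒≤ j<y)) ⟩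
    suc y * (y ^ j * (y * y + j * y + j * j))         ≡⟨ arr₁ y j (y ^ j) ⟩
    y ^ j * (y * (y * y + suc j * y + j * j + j) + j * j) ≤⟨ *-monoʳ-≤ (y ^ j) (+-monoʳ-≤ (y * (y * y + suc j * y + j * j + j)) (*-monoˡ-≤ j (<⇒≤ j<y))) ⟩
    y ^ j * (y * (y * y + suc j * y + j * j + j) + y * j) ≤⟨ m≤m+n _ (y * y ^ j) ⟩
    y ^ j * (y * (y * y + suc j * y + j * j + j) + y * j) + y * y ^ j ≡⟨ arr₂ y j (y ^ j) ⟩
    y * y ^ j * (y * y + suc j * y + suc j * suc j)   ∎
    where
    open ≤-Reasoning
    arr₁ : ∀ y j p → (1 + y) * (p * (y * y + j * y + j * j)) ≡ p * (y * (y * y + (1 + j) * y + j * j + j) + j * j)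
    arr₁ = solve-∀
    arr₂ : ∀ y j p → p * (y * (y * y + (1 + j) * y + j * j + j) + y * j) + y * p ≡ y * p * (y * y + (1 + j) * y + (1 + j) * (1 + j))
    arr₂ = solve-∀

  -- With y = 1 + 1/Y, the hypotheses read R/B ≤ y^g, y^h ≤ C/S and Z ≤ y^e, so that
  -- Z (R/B)^d ≤ y^(gd+e) ≤ y^(hx) ≤ (C/S)^x.
  compare-powers : ∀ Y .{{_ : NonZero Y}} {R B S C Z g h e d x} →
    R * Y ^ g ≤ B * suc Y ^ g → S * suc Y ^ h ≤ C * Y ^ h → Z * Y ^ e ≤ suc Y ^ e → g * d + e ≤ h * x →
    Z * R ^ d * S ^ x ≤ B ^ d * C ^ x
  compare-powers Y {R} {B} {S} {C} {Z} {g} {h} {e} {d} {x} R/B C/S Z≤ exponents =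
    *-cancelʳ-≤ _ _ (Y ^ (h * x)) {{m^n≢0 Y (h * x)}} (begin
      Z * R ^ d * S ^ x * Y ^ (h * x)                          ≡⟨ cong (Z * R ^ d * S ^ x *_) (split Y) ⟩
      Z * R ^ d * S ^ x * ((Y ^ g) ^ d * Y ^ e * Y ^ f)        ≡⟨ arr₁ Z (R ^ d) (S ^ x) ((Y ^ g) ^ d) (Y ^ e) (Y ^ f) ⟩
      (R ^ d * (Y ^ g) ^ d) * (Z * Y ^ e) * Y ^ f * S ^ x      ≡⟨ cong (λ q → q * (Z * Y ^ e) * Y ^ f * S ^ x) (^-distribʳ-* d R (Y ^ g)) ⟨
      (R * Y ^ g) ^ d * (Z * Y ^ e) * Y ^ f * S ^ x
        ≤⟨ *-monoˡ-≤ (S ^ x) (*-mono-≤ (*-mono-≤ (^-monoˡ-≤ d R/B) Z≤) (^-monoˡ-≤ f (n≤1+n Y))) ⟩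
      (B * suc Y ^ g) ^ d * suc Y ^ e * suc Y ^ f * S ^ x      ≡⟨ cong (λ q → q * suc Y ^ e * suc Y ^ f * S ^ x) (^-distribʳ-* d B (suc Y ^ g)) ⟩
      B ^ d * (suc Y ^ g) ^ d * suc Y ^ e * suc Y ^ f * S ^ x  ≡⟨ arr₂ (B ^ d) ((suc Y ^ g) ^ d) (suc Y ^ e) (suc Y ^ f) (S ^ x) ⟩
      B ^ d * (S ^ x * ((suc Y ^ g) ^ d * suc Y ^ e * suc Y ^ f)) ≡⟨ cong (λ q → B ^ d * (S ^ x * q)) (split (suc Y)) ⟨
      B ^ d * (S ^ x * suc Y ^ (h * x))                        ≡⟨ cong (λ q → B ^ d * (S ^ x * q)) (^-*-assoc (suc Y) h x) ⟨
      B ^ d * (S ^ x * (suc Y ^ h) ^ x)                        ≡⟨ cong (B ^ d *_) (^-distribʳ-* x S (suc Y ^ h)) ⟨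
      B ^ d * (S * suc Y ^ h) ^ x                              ≤⟨ *-monoʳ-≤ (B ^ d) (^-monoˡ-≤ x C/S) ⟩
      B ^ d * (C * Y ^ h) ^ x                                  ≡⟨ cong (B ^ d *_) (^-distribʳ-* x C (Y ^ h)) ⟩
      B ^ d * (C ^ x * (Y ^ h) ^ x)                            ≡⟨ cong (λ q → B ^ d * (C ^ x * q)) (^-*-assoc Y h x) ⟩
      B ^ d * (C ^ x * Y ^ (h * x))                            ≡⟨ *-assoc (B ^ d) _ _ ⟨
      B ^ d * C ^ x * Y ^ (h * x)                              ∎)
    where
    open ≤-Reasoning
    -- The slack in the exponents, spent on the trivial `Y ^ f ≤ suc Y ^ f`.
    f : ℕ
    f = h * x ∸ (g * d + e)
    split : ∀ b → b ^ (h * x) ≡ (b ^ g) ^ d * b ^ e * b ^ f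
    split b = begin-equality
      b ^ (h * x)                    ≡⟨ cong (b ^_) (m+[n∸m]≡n exponents) ⟨
      b ^ (g * d + e + f)            ≡⟨ ^-distribˡ-+-* b (g * d + e) f ⟩
      b ^ (g * d + e) * b ^ f        ≡⟨ cong (_* b ^ f) (^-distribˡ-+-* b (g * d) e) ⟩
      b ^ (g * d) * b ^ e * b ^ f    ≡⟨ cong (λ q → q * b ^ e * b ^ f) (^-*-assoc b g d) ⟨
      (b ^ g) ^ d * b ^ e * b ^ f    ∎
    arr₁ : ∀ z r s a b c → z * r * s * (a * b * c) ≡ (r * a) * (z * b) * c * s
    arr₁ = solve-∀
    arr₂ : ∀ b p q r s → b * p * q * r * s ≡ b * (s * (p * q * r))
    arr₂ = solve-∀

  private
    power≤ : ∀ Y .{{_ : NonZero Y}} {S C h} → h ≤ Y → S * (Y * Y + h * Y + h * h) ≤ C * (Y * Y) → S * suc Y ^ h ≤ C * Y ^ h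
    power≤ Y {S} {C} {h} h≤Y hyp = *-cancelʳ-≤ _ _ (Y * Y) {{m*n≢0 Y Y}} (begin
      S * suc Y ^ h * (Y * Y)                  ≡⟨ *-assoc S _ _ ⟩
      S * (suc Y ^ h * (Y * Y))                ≤⟨ *-monoʳ-≤ S (1+1/y-power Y h h≤Y) ⟩
      S * (Y ^ h * (Y * Y + h * Y + h * h))    ≡⟨ arr₁ S (Y ^ h) (Y * Y + h * Y + h * h) ⟩
      S * (Y * Y + h * Y + h * h) * Y ^ h      ≤⟨ *-monoˡ-≤ (Y ^ h) hyp ⟩
      C * (Y * Y) * Y ^ h                      ≡⟨ arr₂ C (Y * Y) (Y ^ h) ⟩
      C * Y ^ h * (Y * Y)                      ∎)
      where
      open ≤-Reasoning
      arr₁ : ∀ s p q → s * (p * q) ≡ s * q * p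
      arr₁ = solve-∀
      arr₂ : ∀ c y p → c * y * p ≡ c * p * y
      arr₂ = solve-∀

  -- The base of the weight is `1 + 1/σ`, and everything is measured in powers of `1 + 1/Y` with
  -- `Y = kσ²`. By Bernoulli the mean factor `1 + 1/(kσ)` is at most the power `σ`. The base
  -- `1 + 1/σ` is at least the power `kρ`, where `ρ = σ - 1` in place of `σ` absorbs the quadratic
  -- term. The difference between `σd` and `ρd` is `d ≤ kM`, whence the `M` in the last hypothesis.
  upper-tail-powers : ∀ k ρ .{{_ : NonZero k}} {d x τ M z} → let σ = suc ρ in
    d + k * τ ≤ k * x → d ≤ k * M → M + σ * σ * z ≤ ρ * τ →
    2 ^ z * suc (k * σ) ^ d * σ ^ x ≤ (k * σ) ^ d * suc σ ^ x
  upper-tail-powers k ρ {d} {x} {τ} {M} {z} x-large d≤kM params =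
    compare-powers Y {suc (k * σ)} {k * σ} {σ} {suc σ} {2 ^ z} {σ} {k * ρ} {Y * z} {d} {x} R/B C/S (2^z-growth Y z) exponents
    where
    open ≤-Reasoning
    σ Y : ℕ
    σ = suc ρ
    Y = k * σ * σ
    instance
      k*σ≢0 : NonZero (k * σ)
      k*σ≢0 = m*n≢0 k σ
      Y≢0 : NonZero Y
      Y≢0 = m*n≢0 (k * σ) σ
    R/B : suc (k * σ) * Y ^ σ ≤ k * σ * suc Y ^ σ
    R/B = *-cancelʳ-≤ _ _ σ (begin
      suc (k * σ) * Y ^ σ * σ     ≡⟨ arr₁ (k * σ) (Y ^ σ) σ ⟩
      Y ^ σ * (Y + σ)             ≤⟨ bernoulli Y σ ⟩
      suc Y ^ σ * Y               ≡⟨ arr₂ (suc Y ^ σ) (k * σ) σ ⟩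
      k * σ * suc Y ^ σ * σ       ∎)
      where
      arr₁ : ∀ a p s → (1 + a) * p * s ≡ p * (a * s + s)
      arr₁ = solve-∀
      arr₂ : ∀ p a s → p * (a * s) ≡ a * p * s
      arr₂ = solve-∀
    h≤Y : k * ρ ≤ Y
    h≤Y = ≤-trans (*-monoʳ-≤ k (n≤1+n ρ)) (m≤m*n (k * σ) σ)
    C/S : σ * suc Y ^ (k * ρ) ≤ suc σ * Y ^ (k * ρ)
    C/S = power≤ Y {σ} {suc σ} {k * ρ} h≤Y (≤-trans (m≤m+n _ (k * k * σ * (1 + 2 * ρ))) (≤-reflexive (arr k ρ)))
      where
      arr : ∀ k ρ → (1 + ρ) * (k * (1 + ρ) * (1 + ρ) * (k * (1 + ρ) * (1 + ρ)) + k * ρ * (k * (1 + ρ) * (1 + ρ)) + k * ρ * (k * ρ)) + k * k * (1 + ρ) * (1 + 2 * ρ)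
            ≡ (2 + ρ) * (k * (1 + ρ) * (1 + ρ) * (k * (1 + ρ) * (1 + ρ)))
      arr = solve-∀
    exponents : σ * d + Y * z ≤ k * ρ * x
    exponents = begin
      σ * d + Y * z                    ≡⟨ arr₁ ρ d (Y * z) ⟩
      ρ * d + (d + Y * z)              ≤⟨ +-monoʳ-≤ (ρ * d) (+-monoˡ-≤ (Y * z) d≤kM) ⟩
      ρ * d + (k * M + Y * z)          ≡⟨ cong (ρ * d +_) (arr₂ k M σ z) ⟩
      ρ * d + k * (M + σ * σ * z)      ≤⟨ +-monoʳ-≤ (ρ * d) (*-monoʳ-≤ k params) ⟩
      ρ * d + k * (ρ * τ)              ≡⟨ arr₃ ρ d k τ ⟩
      ρ * (d + k * τ)                  ≤⟨ *-monoʳ-≤ ρ x-large ⟩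
      ρ * (k * x)                      ≡⟨ arr₄ ρ k x ⟩
      k * ρ * x                        ∎
      where
      arr₁ : ∀ r d q → (1 + r) * d + q ≡ r * d + (d + q)
      arr₁ = solve-∀
      arr₂ : ∀ k M s z → k * M + k * s * s * z ≡ k * (M + s * s * z)
      arr₂ = solve-∀
      arr₃ : ∀ r d k t → r * d + k * (r * t) ≡ r * (d + k * t)
      arr₃ = solve-∀
      arr₄ : ∀ r k x → r * (k * x) ≡ k * r * x
      arr₄ = solve-∀

  -- The mirror image, with base `σ/(σ + 1)` and mean factor `R/(k(σ + 1))`. Here `1 + 1/σ` is at
  -- most the power `g = k(σ + 1)²` of `1 + 1/Y`, but `k(σ + 1)/R` is only shown to be at least the
  -- power `σ²`. The shortfall `(2σ + 1) d` between `(σ + 1)² d` and `σ² d` is charged to `M`.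
  lower-tail-powers : ∀ k σ .{{_ : NonZero k}} .{{_ : NonZero σ}} {R d x τ M z} → R + 1 ≡ k * suc σ →
    k * x + k * τ ≤ d → d ≤ k * M → σ * (suc σ * suc σ) * z + (2 * σ + 1) * M ≤ suc σ * suc σ * τ →
    2 ^ z * suc σ ^ x * R ^ d ≤ σ ^ x * (k * suc σ) ^ d
  lower-tail-powers k σ {R} {d} {x} {τ} {M} {z} R+1≡ x-small d≤kM params =
    compare-powers Y {suc σ} {σ} {R} {k * suc σ} {2 ^ z} {g} {σ * σ} {Y * z} {x} {d} R/B C/S (2^z-growth Y z) exponents
    where
    open ≤-Reasoning
    g Y N : ℕ
    g = k * (suc σ * suc σ)
    Y = g * σ
    N = k * suc σ
    instance
      g≢0 : NonZero g
      g≢0 = m*n≢0 k (suc σ * suc σ)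
      Y≢0 : NonZero Y
      Y≢0 = m*n≢0 g σ
    R/B : suc σ * Y ^ g ≤ σ * suc Y ^ g
    R/B = *-cancelʳ-≤ _ _ g (begin
      suc σ * Y ^ g * g     ≡⟨ arr₁ σ (Y ^ g) g ⟩
      Y ^ g * (Y + g)       ≤⟨ bernoulli Y g ⟩
      suc Y ^ g * Y         ≡⟨ arr₂ (suc Y ^ g) g σ ⟩
      σ * suc Y ^ g * g     ∎)
      where
      arr₁ : ∀ s p g → (1 + s) * p * g ≡ p * (g * s + g)
      arr₁ = solve-∀
      arr₂ : ∀ p g s → p * (g * s) ≡ s * p * g
      arr₂ = solve-∀
    σσ≤Y : σ * σ ≤ Y
    σσ≤Y = *-monoˡ-≤ σ (≤-trans (n≤1+n σ) (≤-trans (m≤m*n (suc σ) (suc σ)) (m≤n*m (suc σ * suc σ) k)))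
    R≤N : R ≤ N
    R≤N = ≤-trans (m≤m+n R 1) (≤-reflexive R+1≡)
    C/S : R * suc Y ^ (σ * σ) ≤ N * Y ^ (σ * σ)
    C/S = power≤ Y {R} {N} {σ * σ} σσ≤Y (begin
      R * (Y * Y + σ * σ * Y + σ * σ * (σ * σ))                    ≡⟨ arr₁ R Y σ ⟩
      R * (Y * Y) + R * (σ * σ * (Y + σ * σ))                      ≤⟨ +-monoʳ-≤ (R * (Y * Y)) (*-monoˡ-≤ (σ * σ * (Y + σ * σ)) R≤N) ⟩
      R * (Y * Y) + N * (σ * σ * (Y + σ * σ))                      ≤⟨ +-monoʳ-≤ (R * (Y * Y)) (*-monoʳ-≤ N (*-monoʳ-≤ (σ * σ) (+-monoʳ-≤ Y σσ≤g))) ⟩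
      R * (Y * Y) + N * (σ * σ * (Y + g))                          ≡⟨ cong (R * (Y * Y) +_) (arr₂ k σ) ⟩
      R * (Y * Y) + Y * Y                                          ≡⟨ arr₃ R (Y * Y) ⟩
      (R + 1) * (Y * Y)                                            ≡⟨ cong (_* (Y * Y)) R+1≡ ⟩
      N * (Y * Y)                                                  ∎)
      where
      σσ≤g : σ * σ ≤ g
      σσ≤g = ≤-trans (*-mono-≤ (n≤1+n σ) (n≤1+n σ)) (m≤n*m (suc σ * suc σ) k)
      arr₁ : ∀ R Y s → R * (Y * Y + s * s * Y + s * s * (s * s)) ≡ R * (Y * Y) + R * (s * s * (Y + s * s))
      arr₁ = solve-∀
      arr₂ : ∀ k s → k * (1 + s) * (s * s * (k * ((1 + s) * (1 + s)) * s + k * ((1 + s) * (1 + s)))) ≡ k * ((1 + s) * (1 + s)) * s * (k * ((1 + s) * (1 + s)) * s)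
      arr₂ = solve-∀
      arr₃ : ∀ R y → R * y + y ≡ (R + 1) * y
      arr₃ = solve-∀
    exponents : g * x + Y * z ≤ σ * σ * d
    exponents = +-cancelʳ-≤ ((2 * σ + 1) * d) _ _ (begin
      g * x + Y * z + (2 * σ + 1) * d                                             ≤⟨ +-monoʳ-≤ (g * x + Y * z) (*-monoʳ-≤ (2 * σ + 1) d≤kM) ⟩
      g * x + Y * z + (2 * σ + 1) * (k * M)                                       ≡⟨ arr₁ k σ x z M ⟩
      suc σ * suc σ * (k * x) + k * (σ * (suc σ * suc σ) * z + (2 * σ + 1) * M)   ≤⟨ +-monoʳ-≤ (suc σ * suc σ * (k * x)) (*-monoʳ-≤ k params) ⟩
      suc σ * suc σ * (k * x) + k * (suc σ * suc σ * τ)                           ≡⟨ arr₂ k σ x τ ⟩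
      suc σ * suc σ * (k * x + k * τ)                                             ≤⟨ *-monoʳ-≤ (suc σ * suc σ) x-small ⟩
      suc σ * suc σ * d                                                           ≡⟨ arr₃ σ d ⟩
      σ * σ * d + (2 * σ + 1) * d                                                 ∎)
      where
      arr₁ : ∀ k s x z M → k * ((1 + s) * (1 + s)) * x + k * ((1 + s) * (1 + s)) * s * z + (2 * s + 1) * (k * M)
             ≡ (1 + s) * (1 + s) * (k * x) + k * (s * ((1 + s) * (1 + s)) * z + (2 * s + 1) * M)
      arr₁ = solve-∀
      arr₂ : ∀ k s x t → (1 + s) * (1 + s) * (k * x) + k * ((1 + s) * (1 + s) * t) ≡ (1 + s) * (1 + s) * (k * x + k * t)
      arr₂ = solve-∀
      arr₃ : ∀ s d → (1 + s) * (1 + s) * d ≡ s * s * d + (2 * s + 1) * d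
      arr₃ = solve-∀

  module _ {k : ℕ} .{{_ : NonZero k}} (i : Fin k) {N : ℕ} (f : Fin N → Bool) where

    private
      d : ℕ
      d = sum (λ j → 𝟙 (f j))
      outcomes : List (Vec (Fin k) N)
      outcomes = words (allFin k) N

    -- The average weight is `(R/k)^d`; the last hypothesis, with powers of `b` cleared, says that
    -- on `P` the weight is at least `Z` times this average.
    rare-by-weight : ∀ a b R Z .{{_ : NonZero b}} .{{_ : NonZero R}} → R + b ≡ k * b + a →
      {P : Vec (Fin k) N → Set} → Decidable P →
      (∀ p → P p → Z * R ^ d * b ^ hits i f p ≤ k ^ d * (a ^ hits i f p * b ^ d)) → Rare (k ^ N) 1 Z P
    rare-by-weight a b R Z R≡ {P} P? large = rarely (filter P? outcomes)
      (*-cancelʳ-≤ _ _ (R ^ d) {{m^n≢0 R d}} (begin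
        length (filter P? outcomes) * Z * R ^ d                              ≡⟨ *-assoc (length (filter P? outcomes)) Z _ ⟩
        length (filter P? outcomes) * (Z * R ^ d)                            ≤⟨ m≤m+n _ _ ⟩
        length (filter P? outcomes) * (Z * R ^ d) + length outcomes * 0
          ≤⟨ markov P? (λ p → k ^ d * weight i a b f p) 0 (Z * R ^ d) (λ _ → z≤n) heavy-weight outcomes ⟩
        total (λ p → k ^ d * weight i a b f p) outcomes                      ≡⟨ total-scale outcomes ⟩
        total (weight i a b f) outcomes * k ^ d                              ≡⟨ total-weight i a b R R≡ N f ⟩
        R ^ d * k ^ N                                                        ≡⟨ arr (R ^ d) (k ^ N) ⟩
        1 * k ^ N * R ^ d                                                    ∎))
      (λ p Pp → ∈-filter⁺ P? (∈-words ∈-allFin p) Pp)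
      where
      open ≤-Reasoning
      arr : ∀ r t → r * t ≡ 1 * t * r
      arr = solve-∀
      total-scale : ∀ ps → total (λ p → k ^ d * weight i a b f p) ps ≡ total (weight i a b f) ps * k ^ d
      total-scale []       = refl
      total-scale (p ∷ ps) = trans (cong₂ _+_ (*-comm (k ^ d) _) (total-scale ps)) (sym (*-distribʳ-+ (k ^ d) (weight i a b f p) _))
      heavy-weight : ∀ p → P p → 0 + Z * R ^ d ≤ k ^ d * weight i a b f p
      heavy-weight p Pp = *-cancelʳ-≤ _ _ (b ^ hits i f p) {{m^n≢0 b (hits i f p)}} (begin
        Z * R ^ d * b ^ hits i f p                     ≤⟨ large p Pp ⟩
        k ^ d * (a ^ hits i f p * b ^ d)               ≡⟨ cong (k ^ d *_) (weight-hits i a b f p) ⟨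
        k ^ d * (weight i a b f p * b ^ hits i f p)    ≡⟨ *-assoc (k ^ d) _ _ ⟨
        k ^ d * weight i a b f p * b ^ hits i f p      ∎)

    rare-upper-tail : ∀ ρ τ M z → d ≤ k * M → M + suc ρ * suc ρ * z ≤ ρ * τ →
      Rare (k ^ N) 1 (2 ^ z) (λ p → d + k * τ ≤ k * hits i f p)
    rare-upper-tail ρ τ M z d≤kM params = rare-by-weight (suc σ) σ (suc (k * σ)) (2 ^ z) (arr (k * σ) σ) (λ p → _ ≤? _)
      (λ p x-large → ≤-trans (upper-tail-powers k ρ x-large d≤kM params)
        (≤-reflexive (trans (cong (_* suc σ ^ hits i f p) (^-distribʳ-* d k σ)) (arr′ (k ^ d) (σ ^ d) (suc σ ^ hits i f p)))))
      where
      σ : ℕ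
      σ = suc ρ
      arr : ∀ a s → 1 + a + s ≡ a + (1 + s)
      arr = solve-∀
      arr′ : ∀ a b c → a * b * c ≡ a * (c * b)
      arr′ = solve-∀

    rare-lower-tail : ∀ σ τ M z .{{_ : NonZero σ}} → d ≤ k * M → σ * (suc σ * suc σ) * z + (2 * σ + 1) * M ≤ suc σ * suc σ * τ →
      Rare (k ^ N) 1 (2 ^ z) (λ p → k * hits i f p + k * τ ≤ d)
    rare-lower-tail σ τ M z d≤kM params = rare-by-weight σ (suc σ) R (2 ^ z) R≡ (λ p → _ ≤? _)
      (λ p x-small → ≤-trans (≤-reflexive (arr′ (2 ^ z) (R ^ d) (suc σ ^ hits i f p)))
        (≤-trans (lower-tail-powers k σ R+1≡ x-small d≤kM params)
        (≤-reflexive (trans (cong (σ ^ hits i f p *_) (^-distribʳ-* d k (suc σ))) (arr″ (σ ^ hits i f p) (k ^ d) (suc σ ^ d))))))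
      where
      R : ℕ
      R = k * suc σ ∸ 1
      1<kσ : 1 < k * suc σ
      1<kσ = ≤-trans (s≤s (>-nonZero⁻¹ σ)) (m≤n*m (suc σ) k)
      R+1≡ : R + 1 ≡ k * suc σ
      R+1≡ = m∸n+n≡m (<⇒≤ 1<kσ)
      instance
        R≢0 : NonZero R
        R≢0 = >-nonZero (m<n⇒0<n∸m 1<kσ)
      R≡ : R + suc σ ≡ k * suc σ + σ
      R≡ = trans (sym (+-assoc R 1 σ)) (cong (_+ σ) R+1≡)
      arr′ : ∀ a b c → a * b * c ≡ a * c * b
      arr′ = solve-∀
      arr″ : ∀ a b c → a * (b * c) ≡ b * (a * c)
      arr″ = solve-∀

    -- Subtracting the trivial lower bound 1 of the weight 2^hits gains the factor d/k that
    -- makes a union bound over all k pieces possible, however large k is.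
    rare-crowded : ∀ t Z → suc Z ≤ 2 ^ t → d ≤ k → Rare (k ^ N) (2 * d) (k * Z) (λ p → t ≤ hits i f p)
    rare-crowded t Z Z<2^t d≤k = rarely (filter t? outcomes)
      (+-cancelʳ-≤ (k * k ^ N) _ _ (*-cancelʳ-≤ _ _ (k ^ d * k) {{m*n≢0 (k ^ d) k {{m^n≢0 k d}}}} (begin
        (F * (k * Z) + k * k ^ N) * (k ^ d * k)            ≡⟨ arr₁ F k Z (k ^ N) (k ^ d) ⟩
        (F * Z + k ^ N * 1) * k ^ d * (k * k)              ≡⟨ cong (λ l → (F * Z + l * 1) * k ^ d * (k * k)) (length-words k N) ⟨
        (F * Z + length outcomes * 1) * k ^ d * (k * k)    ≤⟨ *-monoˡ-≤ (k * k) (*-monoˡ-≤ (k ^ d) (markov t? (weight i 2 1 f) 1 Z at-least-1 at-least-Z outcomes)) ⟩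
        total (weight i 2 1 f) outcomes * k ^ d * (k * k)  ≡⟨ cong (_* (k * k)) (total-weight i 2 1 (suc k) (arr₂ k) N f) ⟩
        suc k ^ d * k ^ N * (k * k)                        ≡⟨ arr₃ (suc k ^ d) (k ^ N) (k * k) ⟩
        -- For `d ≤ k` this gives `(1 + 1/k)^d ≤ 1 + d/k + (d/k)² ≤ 1 + 2d/k`. The leading 1 cancels
        -- against the subtracted lower bound of the weight, and `2 * d` remains as numerator.
        suc k ^ d * (k * k) * k ^ N                        ≤⟨ *-monoˡ-≤ (k ^ N) (1+1/y-power k d d≤k) ⟩
        k ^ d * (k * k + d * k + d * d) * k ^ N            ≤⟨ *-monoˡ-≤ (k ^ N) (*-monoʳ-≤ (k ^ d) (+-monoʳ-≤ (k * k + d * k) (*-monoʳ-≤ d d≤k))) ⟩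
        k ^ d * (k * k + d * k + d * k) * k ^ N            ≡⟨ arr₄ (k ^ d) k d (k ^ N) ⟩
        (2 * d * k ^ N + k * k ^ N) * (k ^ d * k)          ∎)))
      (λ p t≤ → ∈-filter⁺ t? (∈-words ∈-allFin p) t≤)
      where
      open ≤-Reasoning
      t? : Decidable (λ p → t ≤ hits i f p)
      t? p = t ≤? hits i f p
      F : ℕ
      F = length (filter t? outcomes)
      weight≡ : ∀ p → weight i 2 1 f p ≡ 2 ^ hits i f p
      weight≡ p = begin-equality
        weight i 2 1 f p                        ≡⟨ *-identityʳ _ ⟨
        weight i 2 1 f p * 1                    ≡⟨ cong (weight i 2 1 f p *_) (^-zeroˡ (hits i f p)) ⟨
        weight i 2 1 f p * 1 ^ hits i f p       ≡⟨ weight-hits i 2 1 f p ⟩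
        2 ^ hits i f p * 1 ^ d                  ≡⟨ cong (2 ^ hits i f p *_) (^-zeroˡ d) ⟩
        2 ^ hits i f p * 1                      ≡⟨ *-identityʳ _ ⟩
        2 ^ hits i f p                          ∎
      at-least-1 : ∀ p → 1 ≤ weight i 2 1 f p
      at-least-1 p = ≤-trans (m^n>0 2 (hits i f p)) (≤-reflexive (sym (weight≡ p)))
      at-least-Z : ∀ p → t ≤ hits i f p → 1 + Z ≤ weight i 2 1 f p
      at-least-Z p t≤ = ≤-trans Z<2^t (≤-trans (^-monoʳ-≤ 2 t≤) (≤-reflexive (sym (weight≡ p))))
      arr₁ : ∀ F k Z T K → (F * (k * Z) + k * T) * (K * k) ≡ (F * Z + T * 1) * K * (k * k)
      arr₁ = solve-∀
      arr₂ : ∀ k → 1 + k + 1 ≡ k * 1 + 2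
      arr₂ = solve-∀
      arr₃ : ∀ a b c → a * b * c ≡ a * c * b
      arr₃ = solve-∀
      arr₄ : ∀ K k d T → K * (k * k + d * k + d * k) * T ≡ (2 * d * T + k * T) * (K * k)
      arr₄ = solve-∀

  -- Approximation ratio for degree-balanced coresets

  lookup⇒∈ : ∀ {N} {x : Fin N} {S : Subset N} → lookup S x ≡ true → x ∈ S
  lookup⇒∈ {x = x} {S} = lookup⇒[]= x S

  lookup⇒∉ : ∀ {N} {x : Fin N} {S : Subset N} → lookup S x ≡ false → x ∉ S
  lookup⇒∉ eq x∈S with trans (sym ([]=⇒lookup x∈S)) eq
  ... | ()

  ⌊⌋⁺ : ∀ {P : Set} (d : Dec P) → P → ⌊ d ⌋ ≡ true
  ⌊⌋⁺ (yes _) _ = refl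
  ⌊⌋⁺ (no ¬p) p = ⊥-elim (¬p p)

  ⌊⌋⁻ : ∀ {P : Set} (d : Dec P) → ⌊ d ⌋ ≡ true → P
  ⌊⌋⁻ (yes p) _ = p

  ∈-⋃⁺ : ∀ {N k} (F : Fin k → Subset N) i {x} → x ∈ F i → x ∈ ⋃ (toList (tabulate F))
  ∈-⋃⁺ F Fin.zero    x∈ = x∈p∪q⁺ (inj₁ x∈)
  ∈-⋃⁺ F (Fin.suc i) x∈ = x∈p∪q⁺ (inj₂ (∈-⋃⁺ (λ j → F (Fin.suc j)) i x∈))

  ∈-⋃⁻ : ∀ {N k} (F : Fin k → Subset N) {x} → x ∈ ⋃ (toList (tabulate F)) → ∃ λ i → x ∈ F i
  ∈-⋃⁻ {k = zero}  F x∈ = ⊥-elim (∉⊥ x∈)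
  ∈-⋃⁻ {k = suc k} F x∈ with x∈p∪q⁻ (F Fin.zero) _ x∈
  ... | inj₁ x∈₀ = Fin.zero , x∈₀
  ... | inj₂ x∈₊ with ∈-⋃⁻ (λ j → F (Fin.suc j)) x∈₊
  ... | i , x∈ᵢ = Fin.suc i , x∈ᵢ

  positive-term : ∀ {N} (f : Fin N → ℕ) → 1 ≤ sum f → ∃ λ i → 1 ≤ f i
  positive-term {suc N} f 1≤ with f Fin.zero in eq
  ... | suc _ = Fin.zero , ≤-trans (s≤s z≤n) (≤-reflexive (sym eq))
  ... | zero with positive-term (λ i → f (Fin.suc i)) 1≤
  ... | i , 1≤fi = Fin.suc i , 1≤fi

  -- Cancelling β leaves `(4q - 1) a ≤ (4q + 1) s`, and `(4q + 1)/(4q - 1) ≤ 1 + 1/q`. Matching on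
  -- the successor writes `4q - 1` without subtraction.
  ratio-bound : ∀ q β a s → 1 ≤ q → 1 ≤ β → a * (4 * q * β) ≤ s * (4 * q * β + β) + a * β → q * a ≤ (q + 1) * s
  ratio-bound (suc q) β a s _ 1≤β hyp = *-cancelˡ-≤ (4 * q + 3) {{>-nonZero (≤-trans (s≤s z≤n) (m≤n+m 3 (4 * q)))}} (begin
    (4 * q + 3) * (suc q * a)                            ≡⟨ arr₁ q a ⟩
    suc q * ((4 * q + 3) * a)                            ≤⟨ *-monoʳ-≤ (suc q) reduced ⟩
    suc q * ((4 * q + 5) * s)                            ≤⟨ m≤m+n _ ((2 * q + 1) * s) ⟩
    suc q * ((4 * q + 5) * s) + (2 * q + 1) * s          ≡⟨ arr₂ q s ⟩
    (4 * q + 3) * ((suc q + 1) * s)                      ∎)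
    where
    open ≤-Reasoning
    arr₁ : ∀ q a → (4 * q + 3) * ((1 + q) * a) ≡ (1 + q) * ((4 * q + 3) * a)
    arr₁ = solve-∀
    arr₂ : ∀ q s → (1 + q) * ((4 * q + 5) * s) + (2 * q + 1) * s ≡ (4 * q + 3) * ((1 + q + 1) * s)
    arr₂ = solve-∀
    arr₃ : ∀ b q a → b * ((4 * q + 3) * a) + a * b ≡ a * (4 * (1 + q) * b)
    arr₃ = solve-∀
    arr₄ : ∀ b q s → s * (4 * (1 + q) * b + b) ≡ b * ((4 * q + 5) * s)
    arr₄ = solve-∀
    reduced : (4 * q + 3) * a ≤ (4 * q + 5) * s
    reduced = *-cancelˡ-≤ β {{>-nonZero 1≤β}} (+-cancelʳ-≤ (a * β) _ _ (begin
      β * ((4 * q + 3) * a) + a * β      ≡⟨ arr₃ β q a ⟩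
      a * (4 * suc q * β)                ≤⟨ hyp ⟩
      s * (4 * suc q * β + β) + a * β    ≡⟨ cong (_+ a * β) (arr₄ β q s) ⟩
      β * ((4 * q + 5) * s) + a * β      ∎))

  module _ {n} (G : Graph n) where

    deg≡degᵇ : ∀ H v → deg G H v ≡ degᵇ G (lookup H) v
    deg≡degᵇ H = countEnds≡wdeg G (lookup H)

    -- A vertex of positive degree lies on some edge of `f`, and the degree sum of that edge already
    -- bounds its degree.
    degᵇ-bounded : ∀ (f : Fin (m G) → Bool) M →
      (∀ j → f j ≡ true → degᵇ G f (src G j) + degᵇ G f (tgt G j) ≤ M) → ∀ v → degᵇ G f v ≤ M
    degᵇ-bounded f M edges v with degᵇ G f v in eq
    ... | zero  = z≤n
    ... | suc d with positive-term (λ j → 𝟙 (f j) * (δ (src G j) v + δ (tgt G j) v)) (≤-trans (s≤s z≤n) (≤-reflexive (sym eq)))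
    ... | j , 1≤ with f j in fj | src G j ≟ᶠ v | tgt G j ≟ᶠ v
    ... | true | yes refl | _ = ≤-trans (≤-reflexive (sym eq)) (≤-trans (m≤m+n _ _) (edges j fj))
    ... | true | no _ | yes refl = ≤-trans (≤-reflexive (sym eq)) (≤-trans (m≤n+m _ _) (edges j fj))

    -- If every vertex of F ∖ S has C-degree about β/2 or more, the C-neighbours of F ∖ S lie in S and,
    -- by the degree condition on edges, have C-degree about β/2 or less; count the edges between them.
    cover-bound : ∀ (C : Fin (m G) → Bool) q β (F S : Fin n → Bool) → 1 ≤ q → 1 ≤ β →
      (∀ j → C j ≡ true → degᵇ G C (src G j) + degᵇ G C (tgt G j) ≤ β) →
      (∀ j → C j ≡ true → S (src G j) ≡ true ⊎ S (tgt G j) ≡ true) →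
      (∀ v → F v ≡ true → 4 * q * β ≤ 8 * q * degᵇ G C v + β) →
      q * sum (λ v → 𝟙 (F v ∨ S v)) ≤ (2 * q + 1) * sum (λ v → 𝟙 (S v))
    cover-bound C q β F S 1≤q 1≤β P1 covers large = begin
      q * sum (λ v → 𝟙 (F v ∨ S v))                    ≡⟨ cong (q *_) (trans (sum-cong-≋ {n} (λ v → or (F v) (S v))) (∑-distrib-+ a (λ v → 𝟙 (S v)))) ⟩
      q * (∣A∣ + ∣S∣)                                  ≡⟨ *-distribˡ-+ q ∣A∣ ∣S∣ ⟩
      q * ∣A∣ + q * ∣S∣                                ≤⟨ +-monoˡ-≤ (q * ∣S∣) (ratio-bound q β ∣A∣ ∣S∣ 1≤q 1≤β main) ⟩
      (q + 1) * ∣S∣ + q * ∣S∣                          ≡⟨ fin q ∣S∣ ⟩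
      (2 * q + 1) * ∣S∣                                ∎
      where
      open ≤-Reasoning
      -- `a` marks `F ∖ S`, where degrees are at least `β/2 - β/(8q)`; `s` marks the vertices of `S`
      -- of degree at most `β/2 + β/(8q)`. The two margins are equal so that P1 sends every edge at
      -- `a` into `s`.
      a s : Fin n → ℕ
      a v = 𝟙 (F v ∧ not (S v))
      s v = 𝟙 (S v ∧ ⌊ 8 * q * degᵇ G C v ≤? 4 * q * β + β ⌋)
      ∣A∣ ∣S∣ : ℕ
      ∣A∣ = sum a
      ∣S∣ = sum (λ v → 𝟙 (S v))
      or : ∀ x y → 𝟙 (x ∨ y) ≡ 𝟙 (x ∧ not y) + 𝟙 y
      or true  true  = refl
      or true  false = refl
      or false y     = refl
      fin : ∀ q s → (q + 1) * s + q * s ≡ (2 * q + 1) * s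
      fin = solve-∀
      cross : ∀ u v → degᵇ G C u + degᵇ G C v ≤ β → S u ≡ true ⊎ S v ≡ true → a u ≤ s v
      cross u v sum≤ cover with F u in Fu | S u | S v | 8 * q * degᵇ G C v ≤? 4 * q * β + β
      ... | false | _     | _     | _     = z≤n
      ... | true  | true  | _     | _     = z≤n
      ... | true  | false | true  | yes _ = ≤-refl
      ... | true  | false | false | _     = ⊥-elim ([ (λ ()) , (λ ()) ]′ cover)
      ... | true  | false | true  | no ¬small = ⊥-elim (¬small (+-cancelˡ-≤ (4 * q * β) _ _ (begin
        4 * q * β + 8 * q * degᵇ G C v                         ≤⟨ +-monoˡ-≤ _ (large u Fu) ⟩
        8 * q * degᵇ G C u + β + 8 * q * degᵇ G C v            ≡⟨ arr q (degᵇ G C u) β (degᵇ G C v) ⟩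
        8 * q * (degᵇ G C u + degᵇ G C v) + β                  ≤⟨ +-monoˡ-≤ β (*-monoʳ-≤ (8 * q) sum≤) ⟩
        8 * q * β + β                                          ≡⟨ arr′ q β ⟩
        4 * q * β + (4 * q * β + β)                            ∎)))
        where
        arr : ∀ q x b y → 8 * q * x + b + 8 * q * y ≡ 8 * q * (x + y) + b
        arr = solve-∀
        arr′ : ∀ q b → 8 * q * b + b ≡ 4 * q * b + (4 * q * b + b)
        arr′ = solve-∀
      edgewise : ∀ j → 𝟙 (C j) * (a (src G j) + a (tgt G j)) ≤ 𝟙 (C j) * (s (src G j) + s (tgt G j))
      edgewise j with C j in Cj
      ... | false = z≤n
      ... | true  = +-monoˡ-≤ 0 (≤-trans
        (+-mono-≤ (cross (src G j) (tgt G j) (P1 j Cj) (covers j Cj))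
                  (cross (tgt G j) (src G j) (≤-trans (≤-reflexive (+-comm (degᵇ G C (tgt G j)) _)) (P1 j Cj)) ([ inj₂ , inj₁ ]′ (covers j Cj))))
        (≤-reflexive (+-comm (s (tgt G j)) _)))
      a-mass s-mass : ℕ
      a-mass = sum (λ v → a v * degᵇ G C v)
      s-mass = sum (λ v → s v * degᵇ G C v)
      mass≤ : a-mass ≤ s-mass
      mass≤ = ≤-trans (≤-reflexive (handshake G a (λ j → 𝟙 (C j))))
        (≤-trans (sum-mono-≤ edgewise) (≤-reflexive (sym (handshake G s (λ j → 𝟙 (C j))))))
      s-vertex : ∀ v → 8 * q * (s v * degᵇ G C v) ≤ 𝟙 (S v) * (4 * q * β + β)
      s-vertex v with S v | 8 * q * degᵇ G C v ≤? 4 * q * β + β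
      ... | false | _ = ≤-reflexive (*-zeroʳ (8 * q))
      ... | true  | no _ = ≤-trans (≤-reflexive (*-zeroʳ (8 * q))) z≤n
      ... | true  | yes small = ≤-trans (≤-reflexive (cong (8 * q *_) (*-identityˡ (degᵇ G C v)))) (≤-trans small (≤-reflexive (sym (*-identityˡ _))))
      a-vertex : ∀ v → a v * (4 * q * β) ≤ 8 * q * (a v * degᵇ G C v) + a v * β
      a-vertex v with F v in Fv | S v
      ... | false | _     = z≤n
      ... | true  | true  = z≤n
      ... | true  | false = ≤-trans (≤-reflexive (*-identityˡ _)) (≤-trans (large v Fv)
        (≤-reflexive (cong₂ _+_ (cong (8 * q *_) (sym (*-identityˡ (degᵇ G C v)))) (sym (*-identityˡ β)))))
      main : ∣A∣ * (4 * q * β) ≤ ∣S∣ * (4 * q * β + β) + ∣A∣ * β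
      main = begin
        ∣A∣ * (4 * q * β)                                          ≡⟨ *-distribʳ-sum (4 * q * β) a ⟩
        sum (λ v → a v * (4 * q * β))                              ≤⟨ sum-mono-≤ a-vertex ⟩
        sum (λ v → 8 * q * (a v * degᵇ G C v) + a v * β)           ≡⟨ ∑-distrib-+ (λ v → 8 * q * (a v * degᵇ G C v)) (λ v → a v * β) ⟩
        sum (λ v → 8 * q * (a v * degᵇ G C v)) + sum (λ v → a v * β)
          ≡⟨ cong₂ _+_ (*-distribˡ-sum (8 * q) (λ v → a v * degᵇ G C v)) (*-distribʳ-sum β a) ⟨
        8 * q * a-mass + ∣A∣ * β                                   ≤⟨ +-monoˡ-≤ (∣A∣ * β) (*-monoʳ-≤ (8 * q) mass≤) ⟩
        8 * q * s-mass + ∣A∣ * β                                   ≡⟨ cong (_+ ∣A∣ * β) (*-distribˡ-sum (8 * q) (λ v → s v * degᵇ G C v)) ⟩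
        sum (λ v → 8 * q * (s v * degᵇ G C v)) + ∣A∣ * β           ≤⟨ +-monoˡ-≤ (∣A∣ * β) (sum-mono-≤ s-vertex) ⟩
        sum (λ v → 𝟙 (S v) * (4 * q * β + β)) + ∣A∣ * β            ≡⟨ cong (_+ ∣A∣ * β) (*-distribʳ-sum (4 * q * β + β) (λ v → 𝟙 (S v))) ⟨
        ∣S∣ * (4 * q * β + β) + ∣A∣ * β                            ∎

    ∈-heavy⁺ : ∀ C thr v → thr ℚ.< toℚ (deg G C v) → v ∈ heavy G C thr
    ∈-heavy⁺ C thr v thr< = lookup⇒∈ (trans (lookup∘tabulate (λ u → ⌊ thr <ℚ? toℚ (deg G C u) ⌋) v) (⌊⌋⁺ (thr <ℚ? toℚ (deg G C v)) thr<))

    ∈-heavy⁻ : ∀ C thr v → v ∈ heavy G C thr → thr ℚ.< toℚ (deg G C v)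
    ∈-heavy⁻ C thr v v∈ = ⌊⌋⁻ (thr <ℚ? toℚ (deg G C v)) (trans (sym (lookup∘tabulate (λ u → ⌊ thr <ℚ? toℚ (deg G C u) ⌋) v)) ([]=⇒lookup v∈))

    module _ {k} {p : Partition G k} {i : Fin k} {C : Subset (m G)} {β β⁻} (edcs : IsEDCS G p i C β β⁻) where
      open IsEDCS edcs

      edcs-P1 : ∀ j → lookup C j ≡ true → degᵇ G (lookup C) (src G j) + degᵇ G (lookup C) (tgt G j) ≤ β
      edcs-P1 j Cj = ≤-trans (≤-reflexive (sym (cong₂ _+_ (deg≡degᵇ C (src G j)) (deg≡degᵇ C (tgt G j))))) (P1 j (lookup⇒∈ Cj))

      edcs-deg≤β : ∀ v → degᵇ G (lookup C) v ≤ β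
      edcs-deg≤β = degᵇ-bounded (lookup C) β edcs-P1

    -- All degrees are at most β, which allows `nβ` edges, and the heavy vertices number at most
    -- `n ≤ nβ`; hence the 2.
    coreset-size : ∀ {k} {p : Partition G k} {i C β β⁻} thr → IsEDCS G p i C β β⁻ → 1 ≤ β →
      ∣ C ∣ + ∣ heavy G C thr ∣ ≤ 2 * n * β
    coreset-size {C = C} {β} thr edcs 1≤β = begin
      ∣ C ∣ + ∣ heavy G C thr ∣                   ≤⟨ +-mono-≤ edges vertices ⟩
      n * β + n * β                               ≡⟨ arr n β ⟩
      2 * n * β                                   ∎
      where
      open ≤-Reasoning
      arr : ∀ n b → n * b + n * b ≡ 2 * n * b
      arr = solve-∀
      vertices : ∣ heavy G C thr ∣ ≤ n * β
      vertices = begin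
        ∣ heavy G C thr ∣                         ≡⟨ ∣∣≡sum (heavy G C thr) ⟩
        sum (λ v → 𝟙 (lookup (heavy G C thr) v))  ≤⟨ sum-mono-≤ (λ v → ≤-trans (𝟙≤1 (lookup (heavy G C thr) v)) 1≤β) ⟩
        sum {n} (λ _ → β)                         ≡⟨ sum-const n β ⟩
        n * β                                     ∎
      edges : ∣ C ∣ ≤ n * β
      edges = begin
        ∣ C ∣                                     ≡⟨ ∣∣≡sum C ⟩
        sum (λ j → 𝟙 (lookup C j))                ≤⟨ sum-mono-≤ (λ j → m≤m*n (𝟙 (lookup C j)) 2) ⟩
        sum (λ j → 𝟙 (lookup C j) * (1 + 1))      ≡⟨ handshake G (λ _ → 1) (λ j → 𝟙 (lookup C j)) ⟨
        sum (λ v → 1 * degᵇ G (lookup C) v)       ≤⟨ sum-mono-≤ (λ v → ≤-trans (≤-reflexive (*-identityˡ _)) (edcs-deg≤β edcs v)) ⟩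
        sum {n} (λ _ → β)                         ≡⟨ sum-const n β ⟩
        n * β                                     ∎

    -- An edge in the coreset of its own piece is covered by `S`; any other edge has an end above
    -- `thr` by P2 and `split`. For the size, all heavy vertices are transferred to the single piece
    -- `i₀`. There `S` covers `C i₀` because it covers the union, and it is no larger than a cover
    -- `T` of `G` by minimality.
    good-if-balanced : ∀ {k q β β⁻ thr ε} (p : Partition G k) (i₀ : Fin k) → 1 ≤ q → 1 ≤ β →
      (∀ a b → β⁻ ℚ.≤ toℚ (a + b) → (thr ℚ.< toℚ a) ⊎ (thr ℚ.< toℚ b)) →
      (∀ a b → q * a ≤ (2 * q + 1) * b → toℚ a ℚ.≤ (toℚ 2 ℚ.+ ε) ℚ.* toℚ b) →
      (∀ (C : Fin k → Subset (m G)) → (∀ i → IsEDCS G p i (C i) β β⁻) → ∀ i v →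
        thr ℚ.< toℚ (deg G (C i) v) → 4 * q * β ≤ 8 * q * degᵇ G (lookup (C i₀)) v + β) →
      Good G β β⁻ thr ε p
    good-if-balanced {k} {q} {β} {β⁻} {thr} {ε} p i₀ 1≤q 1≤β split approx balanced C edcs S (S-covers , S-min) = covers , small
      where
      open ≤-Reasoning
      F : Subset n
      F = ⋃ (toList (tabulate (λ i → heavy G (C i) thr)))
      covers : IsVertexCover G (F ∪ S)
      covers j = cases (lookup (C (lookup p j)) j) refl
        where
        into-F : ∀ v → thr ℚ.< toℚ (deg G (C (lookup p j)) v) → v ∈ F ∪ S
        into-F v thr< = x∈p∪q⁺ (inj₁ (∈-⋃⁺ (λ i → heavy G (C i) thr) (lookup p j) (∈-heavy⁺ (C (lookup p j)) thr v thr<)))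
        cases : ∀ b → lookup (C (lookup p j)) j ≡ b → src G j ∈ F ∪ S ⊎ tgt G j ∈ F ∪ S
        cases true  eq = [ (λ u → inj₁ (x∈p∪q⁺ (inj₂ u))) , (λ v → inj₂ (x∈p∪q⁺ (inj₂ v))) ]′
                      (S-covers j (∈-⋃⁺ C (lookup p j) (lookup⇒∈ eq)))
        cases false eq = [ (λ u → inj₁ (into-F (src G j) u)) , (λ v → inj₂ (into-F (tgt G j) v)) ]′
                      (split (deg G (C (lookup p j)) (src G j)) (deg G (C (lookup p j)) (tgt G j)) (IsEDCS.P2 (edcs (lookup p j)) j refl (lookup⇒∉ eq)))
      F-large : ∀ v → lookup F v ≡ true → 4 * q * β ≤ 8 * q * degᵇ G (lookup (C i₀)) v + β
      F-large v Fv = balanced C edcs (proj₁ piece) v (∈-heavy⁻ (C (proj₁ piece)) thr v (proj₂ piece))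
        where
        piece : ∃ λ i → v ∈ heavy G (C i) thr
        piece = ∈-⋃⁻ (λ i → heavy G (C i) thr) (lookup⇒∈ Fv)
      S-covers₀ : ∀ j → lookup (C i₀) j ≡ true → lookup S (src G j) ≡ true ⊎ lookup S (tgt G j) ≡ true
      S-covers₀ j Cj = [ (λ u → inj₁ ([]=⇒lookup u)) , (λ v → inj₂ ([]=⇒lookup v)) ]′ (S-covers j (∈-⋃⁺ C i₀ (lookup⇒∈ Cj)))
      small : ∀ T → IsVertexCover G T → toℚ ∣ F ∪ S ∣ ℚ.≤ (toℚ 2 ℚ.+ ε) ℚ.* toℚ ∣ T ∣
      small T T-covers = approx ∣ F ∪ S ∣ ∣ T ∣ (begin
        q * ∣ F ∪ S ∣                                        ≡⟨ cong (q *_) (trans (∣∣≡sum (F ∪ S)) (sum-cong-≋ {n} (λ v → cong 𝟙 (lookup-zipWith _∨_ v F S)))) ⟩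
        q * sum (λ v → 𝟙 (lookup F v ∨ lookup S v))          ≤⟨ cover-bound (lookup (C i₀)) q β (lookup F) (lookup S) 1≤q 1≤β (edcs-P1 (edcs i₀)) S-covers₀ F-large ⟩
        (2 * q + 1) * sum (λ v → 𝟙 (lookup S v))             ≡⟨ cong ((2 * q + 1) *_) (∣∣≡sum S) ⟨
        (2 * q + 1) * ∣ S ∣                                  ≤⟨ *-monoʳ-≤ (2 * q + 1) (S-min T (λ j _ → T-covers j)) ⟩
        (2 * q + 1) * ∣ T ∣                                  ∎)

  -- Typical partitions

  module _ {n} (G : Graph n) where

    m≤n² : m G ≤ n * n
    m≤n² = injective⇒≤ {f = λ j → combine (src G j) (tgt G j)} (λ {i} {j} eq →
      let same = combine-injective (src G i) (tgt G i) (src G j) (tgt G j) eq in noDup G i j (inj₁ same))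

    -- These are the active edges of the random experiment for `v`: their number is the degree of
    -- `v`, and their hits are its degree within a piece.
    starᵇ : (Fin (m G) → Bool) → Fin n → Fin (m G) → Bool
    starᵇ f v j = f j ∧ isEnd G j v

    star-size : ∀ f v → sum (λ j → 𝟙 (starᵇ f v j)) ≡ degᵇ G f v
    star-size f v = trans (sym (countF≡sum (starᵇ f v))) (countEnds≡wdeg G f v)

    module _ {k} (p : Partition G k) (i : Fin k) where

      restrict : (Fin (m G) → Bool) → Fin (m G) → Bool
      restrict f j = f j ∧ hit i (lookup p j)

      star-hits : ∀ f v → hits i (starᵇ f v) p ≡ degᵇ G (restrict f) v
      star-hits f v = sum-cong-≋ {m G} (λ j → trans (bool (f j) (isEnd G j v) (hit i (lookup p j))) (cong (𝟙 (restrict f j) *_) (𝟙-isEnd G j v)))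
        where
        bool : ∀ a b c → 𝟙 ((a ∧ b) ∧ c) ≡ 𝟙 (a ∧ c) * 𝟙 b
        bool false b     c     = refl
        bool true  b     false = cong 𝟙 (∧-zeroʳ b)
        bool true  true  true  = refl
        bool true  false true  = refl

    ∧-true : ∀ {a b} → a ∧ b ≡ true → a ≡ true × b ≡ true
    ∧-true {true} {true} _ = refl , refl

    not-true : ∀ {a} → not a ≡ true → a ≡ false
    not-true {false} _ = refl

    -- The degree in each piece is within `τ` of its mean, the degree in `H` divided by `k`; both
    -- inequalities are multiplied by `k`.
    Typical : ∀ {k} → Subset (m G) → ℕ → Partition G k → Set
    Typical {k} H τ p = ∀ i v →
      k * degᵇ G (restrict p i (lookup H)) v ≤ degᵇ G (lookup H) v + k * τ ×
      degᵇ G (lookup H) v ≤ k * degᵇ G (restrict p i (lookup H)) v + k * τ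

    -- Stated positively and with non-strict inequalities, so that it is literally a union of the
    -- events bounded by `rare-upper-tail` and `rare-lower-tail`.
    Atypical : ∀ {k} → Subset (m G) → ℕ → Partition G k → Set
    Atypical {k} H τ p = ∃ λ i → ∃ λ v →
      (degᵇ G (lookup H) v + k * τ ≤ k * degᵇ G (restrict p i (lookup H)) v) ⊎
      (k * degᵇ G (restrict p i (lookup H)) v + k * τ ≤ degᵇ G (lookup H) v)

    not-atypical⇒typical : ∀ {k} (H : Subset (m G)) {τ} (p : Partition G k) → ¬ Atypical H τ p → Typical H τ p
    not-atypical⇒typical H p ¬at i v = <⇒≤ (≰⇒> (λ le → ¬at (i , v , inj₁ le))) , <⇒≤ (≰⇒> (λ le → ¬at (i , v , inj₂ le)))

    module _ {k} .{{_ : NonZero k}} {β τ ℓ₀} {β⁻ : ℚ}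
      (P2→ : ∀ d → β⁻ ℚ.≤ toℚ d → β ≤ d + ℓ₀)
      {H : Subset (m G)}
      (H-upper : ∀ e → lookup H e ≡ true → degᵇ G (lookup H) (src G e) + degᵇ G (lookup H) (tgt G e) ≤ k * β + 1)
      (H-lower : ∀ e → lookup H e ≡ false → k * β ≤ degᵇ G (lookup H) (src G e) + degᵇ G (lookup H) (tgt G e) + 1)
      {p : Partition G k} (typical : Typical H τ p) where

      private
        h : Fin n → ℕ
        h = degᵇ G (lookup H)
        X : Fin k → Fin n → ℕ
        X i = degᵇ G (restrict p i (lookup H))

      -- This is the balance of `H` divided by `k`: either end deviates by at most `τ`, and the
      -- rounding term stays at most 1 because `1 ≤ k`.
      restrict-upper : ∀ i j → lookup H j ≡ true → X i (src G j) + X i (tgt G j) ≤ β + (2 * τ + 1)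
      restrict-upper i j Hj = *-cancelˡ-≤ k (begin
        k * (X i (src G j) + X i (tgt G j))               ≡⟨ *-distribˡ-+ k _ _ ⟩
        k * X i (src G j) + k * X i (tgt G j)             ≤⟨ +-mono-≤ (proj₁ (typical i (src G j))) (proj₁ (typical i (tgt G j))) ⟩
        h (src G j) + k * τ + (h (tgt G j) + k * τ)       ≡⟨ arr₁ (h (src G j)) (h (tgt G j)) k τ ⟩
        h (src G j) + h (tgt G j) + 2 * (k * τ)           ≤⟨ +-monoˡ-≤ (2 * (k * τ)) (H-upper j Hj) ⟩
        k * β + 1 + 2 * (k * τ)                           ≤⟨ +-monoˡ-≤ (2 * (k * τ)) (+-monoʳ-≤ (k * β) (>-nonZero⁻¹ k)) ⟩
        k * β + k + 2 * (k * τ)                           ≡⟨ arr₂ k β τ ⟩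
        k * (β + (2 * τ + 1))                             ∎)
        where
        open ≤-Reasoning
        arr₁ : ∀ a b k t → a + k * t + (b + k * t) ≡ a + b + 2 * (k * t)
        arr₁ = solve-∀
        arr₂ : ∀ k b t → k * b + k + 2 * (k * t) ≡ k * (b + (2 * t + 1))
        arr₂ = solve-∀

      restrict-lower : ∀ i j → lookup H j ≡ false → β ≤ X i (src G j) + X i (tgt G j) + (2 * τ + 1)
      restrict-lower i j Hj = *-cancelˡ-≤ k (begin
        k * β                                                        ≤⟨ H-lower j Hj ⟩
        h (src G j) + h (tgt G j) + 1                                ≤⟨ +-mono-≤ (+-mono-≤ (proj₂ (typical i (src G j))) (proj₂ (typical i (tgt G j)))) (>-nonZero⁻¹ k) ⟩
        k * X i (src G j) + k * τ + (k * X i (tgt G j) + k * τ) + k  ≡⟨ arr k (X i (src G j)) (X i (tgt G j)) τ ⟩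
        k * (X i (src G j) + X i (tgt G j) + (2 * τ + 1))            ∎)
        where
        open ≤-Reasoning
        arr : ∀ k a b t → k * a + k * t + (k * b + k * t) + k ≡ k * (a + b + (2 * t + 1))
        arr = solve-∀

      module _ {i} {C : Subset (m G)} (edcs : IsEDCS G p i C β β⁻) where

        private
          ℓ : ℕ
          ℓ = ℓ₀ + (2 * τ + 1)

        -- A coreset edge lies in piece `i`, so if the restriction of `H` misses it then `H` itself
        -- does. The lower balance of `H` and P1 of the coreset then meet at β.
        coreset≲reference : AlmostDominated G ℓ (lookup C) (restrict p i (lookup H))
        coreset≲reference j diff = begin
          degᵇ G (lookup C) (src G j) + degᵇ G (lookup C) (tgt G j)        ≤⟨ edcs-P1 G edcs j Cj ⟩
          β                                                               ≤⟨ restrict-lower i j Hj ⟩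
          X i (src G j) + X i (tgt G j) + (2 * τ + 1)                     ≤⟨ +-monoʳ-≤ (X i (src G j) + X i (tgt G j)) (m≤n+m _ ℓ₀) ⟩
          X i (src G j) + X i (tgt G j) + ℓ                               ∎
          where
          open ≤-Reasoning
          Cj : lookup C j ≡ true
          Cj = proj₁ (∧-true {lookup C j} diff)
          Hj : lookup H j ≡ false
          Hj = other (lookup H j) (hit i (lookup p j)) (⌊⌋⁺ (lookup p j ≟ᶠ i) (IsEDCS.sub edcs j (lookup⇒∈ Cj)))
            (not-true (proj₂ (∧-true {lookup C j} diff)))
            where
            other : ∀ a b → b ≡ true → a ∧ b ≡ false → a ≡ false
            other false b    _ _ = refl
            other true  true _ ()

        reference≲coreset : AlmostDominated G ℓ (restrict p i (lookup H)) (lookup C)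
        reference≲coreset j diff = begin
          X i (src G j) + X i (tgt G j)                       ≤⟨ restrict-upper i j (proj₁ Hj∧hit) ⟩
          β + (2 * τ + 1)                                     ≤⟨ +-monoˡ-≤ (2 * τ + 1) (P2→ (deg G C (src G j) + deg G C (tgt G j)) (IsEDCS.P2 edcs j inPiece (lookup⇒∉ C∌j))) ⟩
          deg G C (src G j) + deg G C (tgt G j) + ℓ₀ + (2 * τ + 1) ≡⟨ +-assoc (deg G C (src G j) + deg G C (tgt G j)) ℓ₀ _ ⟩
          deg G C (src G j) + deg G C (tgt G j) + ℓ           ≡⟨ cong₂ (λ a b → a + b + ℓ) (deg≡degᵇ G C (src G j)) (deg≡degᵇ G C (tgt G j)) ⟩
          degᵇ G (lookup C) (src G j) + degᵇ G (lookup C) (tgt G j) + ℓ ∎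
          where
          open ≤-Reasoning
          Hj∧hit : lookup H j ≡ true × hit i (lookup p j) ≡ true
          Hj∧hit = ∧-true (proj₁ (∧-true {restrict p i (lookup H) j} diff))
          C∌j : lookup C j ≡ false
          C∌j = not-true (proj₂ (∧-true {restrict p i (lookup H) j} diff))
          inPiece : lookup p j ≡ i
          inPiece = ⌊⌋⁻ (lookup p j ≟ᶠ i) (proj₂ Hj∧hit)

        module _ (r E z : ℕ) (1≤r : 1 ≤ r) (1≤E : 1 ≤ E) (2m<2^z : 2 * m G < 2 ^ z) (degrees≤ : β + (2 * τ + 1) ≤ r * E) where

          private
            C≤ : ∀ v → degᵇ G (lookup C) v ≤ r * E
            C≤ v = ≤-trans (edcs-deg≤β G edcs v) (≤-trans (m≤m+n β _) degrees≤)
            X≤ : ∀ v → X i v ≤ r * E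
            X≤ v = ≤-trans (degᵇ-bounded G (restrict p i (lookup H)) (β + (2 * τ + 1))
              (λ j e → restrict-upper i j (proj₁ (∧-true e))) v) degrees≤

          coreset-degree≤ : ∀ v → degᵇ G (lookup C) v ≤ X i v + (E + r * z * ℓ)
          coreset-degree≤ v = <⇒≤ (degree-uniqueness G (lookup C) (restrict p i (lookup H)) r E ℓ z 1≤r 1≤E 2m<2^z C≤ X≤ coreset≲reference reference≲coreset v)

          coreset-degree≥ : ∀ v → X i v ≤ degᵇ G (lookup C) v + (E + r * z * ℓ)
          coreset-degree≥ v = <⇒≤ (degree-uniqueness G (restrict p i (lookup H)) (lookup C) r E ℓ z 1≤r 1≤E 2m<2^z X≤ C≤ reference≲coreset coreset≲reference v)

      reference-degrees-agree : ∀ i i′ v → X i v ≤ X i′ v + 2 * τ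
      reference-degrees-agree i i′ v = *-cancelˡ-≤ k (begin
        k * X i v                          ≤⟨ proj₁ (typical i v) ⟩
        h v + k * τ                        ≤⟨ +-monoˡ-≤ (k * τ) (proj₂ (typical i′ v)) ⟩
        k * X i′ v + k * τ + k * τ         ≡⟨ arr k (X i′ v) τ ⟩
        k * (X i′ v + 2 * τ)               ∎)
        where
        open ≤-Reasoning
        arr : ∀ k x t → k * x + k * t + k * t ≡ k * (x + 2 * t)
        arr = solve-∀

      -- The comparison runs from `C i` to the part of `H` in piece `i`, across to its part in piece
      -- `i′` by concentration, and back to `C i′`.
      coreset-degrees-agree : ∀ (C : Fin k → Subset (m G)) → (∀ i → IsEDCS G p i (C i) β β⁻) →
        ∀ r E z → 1 ≤ r → 1 ≤ E → 2 * m G < 2 ^ z → β + (2 * τ + 1) ≤ r * E → ∀ i i′ v →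
        degᵇ G (lookup (C i)) v ≤ degᵇ G (lookup (C i′)) v + 2 * (E + r * z * (ℓ₀ + (2 * τ + 1)) + τ)
      coreset-degrees-agree C edcs r E z 1≤r 1≤E 2m<2^z degrees≤ i i′ v = begin
        degᵇ G (lookup (C i)) v                 ≤⟨ coreset-degree≤ (edcs i) r E z 1≤r 1≤E 2m<2^z degrees≤ v ⟩
        X i v + D                               ≤⟨ +-monoˡ-≤ D (reference-degrees-agree i i′ v) ⟩
        X i′ v + 2 * τ + D                      ≤⟨ +-monoˡ-≤ D (+-monoˡ-≤ (2 * τ) (coreset-degree≥ (edcs i′) r E z 1≤r 1≤E 2m<2^z degrees≤ v)) ⟩
        degᵇ G (lookup (C i′)) v + D + 2 * τ + D ≡⟨ arr (degᵇ G (lookup (C i′)) v) D τ ⟩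
        degᵇ G (lookup (C i′)) v + 2 * (D + τ)  ∎
        where
        open ≤-Reasoning
        D : ℕ
        D = E + r * z * (ℓ₀ + (2 * τ + 1))
        arr : ∀ x d t → x + d + 2 * t + d ≡ x + 2 * (d + t)
        arr = solve-∀

    module _ {k} .{{_ : NonZero k}} (H : Subset (m G)) {ρ τ M z}
      (h≤kM : ∀ v → degᵇ G (lookup H) v ≤ k * M)
      (upper : M + suc ρ * suc ρ * z ≤ ρ * τ)
      (lower : suc ρ * (suc (suc ρ) * suc (suc ρ)) * z + (2 * suc ρ + 1) * M ≤ suc (suc ρ) * suc (suc ρ) * τ) where

      rare-atypical : Rare (k ^ m G) (k * (n * (1 + 1))) (2 ^ z) (Atypical H τ)
      rare-atypical = rare-∃ (λ i → rare-∃ (λ v → rare-⊎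
        (rare-map (λ p → subst₂ (λ a b → a + k * τ ≤ k * b) (sym (star-size (lookup H) v)) (sym (star-hits p i (lookup H) v)))
          (rare-upper-tail i (starᵇ (lookup H) v) ρ τ M z (size≤ v) upper))
        (rare-map (λ p → subst₂ (λ a b → k * b + k * τ ≤ a) (sym (star-size (lookup H) v)) (sym (star-hits p i (lookup H) v)))
          (rare-lower-tail i (starᵇ (lookup H) v) (suc ρ) τ M z (size≤ v) lower))))
        where
        size≤ : ∀ v → sum (λ j → 𝟙 (starᵇ (lookup H) v j)) ≤ k * M
        size≤ v = ≤-trans (≤-reflexive (star-size (lookup H) v)) (h≤kM v)

  -- Choice of the parameters

  n≤2*⌈n/2⌉ : ∀ n → n ≤ 2 * ⌈ n /2⌉
  n≤2*⌈n/2⌉ n = begin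
    n                        ≡⟨ ⌊n/2⌋+⌈n/2⌉≡n n ⟨
    ⌊ n /2⌋ + ⌈ n /2⌉        ≤⟨ +-monoˡ-≤ ⌈ n /2⌉ (⌊n/2⌋≤⌈n/2⌉ n) ⟩
    ⌈ n /2⌉ + ⌈ n /2⌉        ≡⟨ cong (⌈ n /2⌉ +_) (+-identityʳ ⌈ n /2⌉) ⟨
    2 * ⌈ n /2⌉              ∎
    where open ≤-Reasoning

  1≤⌈log₂n⌉ : ∀ {n} → 2 ≤ n → 1 ≤ ⌈log₂ n ⌉
  1≤⌈log₂n⌉ = ⌈log₂⌉-mono-≤ {2}

  n≤2^⌈log₂n⌉ : ∀ n → n ≤ 2 ^ ⌈log₂ n ⌉
  n≤2^⌈log₂n⌉ n = go n (<-wellFounded n)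
    where
    go : ∀ n → Acc _<_ n → n ≤ 2 ^ ⌈log₂ n ⌉
    go zero          _         = z≤n
    go (suc zero)    _         = s≤s z≤n
    go n@(suc (suc n′)) (acc rec) = begin
      n                                      ≤⟨ n≤2*⌈n/2⌉ n ⟩
      2 * ⌈ n /2⌉                            ≤⟨ *-monoʳ-≤ 2 (go ⌈ n /2⌉ (rec (⌈n/2⌉<n n′))) ⟩
      2 * 2 ^ ⌈log₂ ⌈ n /2⌉ ⌉                ≡⟨ cong (λ l → 2 * 2 ^ l) (⌈log₂⌈n/2⌉⌉≡⌈log₂n⌉∸1 n) ⟩
      2 ^ suc (⌈log₂ n ⌉ ∸ 1)                ≡⟨ cong (2 ^_) (m+[n∸m]≡n (1≤⌈log₂n⌉ {n} (s≤s (s≤s z≤n)))) ⟩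
      2 ^ ⌈log₂ n ⌉                          ∎
      where open ≤-Reasoning

  rare-weaken : ∀ {X : Set} {T N N′ Z} {P : X → Set} → N ≤ N′ → Rare T N Z P → Rare T N′ Z P
  rare-weaken {T = T} N≤N′ (rarely B ∣B∣ P⇒B) = rarely B (≤-trans ∣B∣ (*-monoˡ-≤ T N≤N′)) P⇒B

  rare⇒bad-list : ∀ {X : Set} {T N Z n} {P : X → Set} → 1 ≤ Z → N * n ≤ Z → Rare T N Z P →
    Σ (List X) λ B → length B * n ^ 1 ≤ T × (∀ x → x ∉ˡ B → ¬ P x)
  rare⇒bad-list {T = T} {N} {Z} {n} 1≤Z Nn≤Z (rarely B ∣B∣ P⇒B) = B , bound , λ x x∉B Px → x∉B (P⇒B x Px)
    where
    open ≤-Reasoning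
    arr₁ : ∀ l n z → l * (n * 1) * z ≡ l * z * n
    arr₁ = solve-∀
    arr₂ : ∀ N T n → N * T * n ≡ T * (N * n)
    arr₂ = solve-∀
    bound : length B * n ^ 1 ≤ T
    bound = *-cancelʳ-≤ _ _ Z {{>-nonZero 1≤Z}} (begin
      length B * n ^ 1 * Z     ≡⟨ arr₁ (length B) n Z ⟩
      length B * Z * n         ≤⟨ *-monoˡ-≤ n ∣B∣ ⟩
      N * T * n                ≡⟨ arr₂ N T n ⟩
      T * (N * n)              ≤⟨ *-monoʳ-≤ T Nn≤Z ⟩
      T * Z                    ∎)

  -- Everything the combinatorial argument needs to know about β, β⁻ and the threshold;
  -- 1/q is ε up to a factor 2 and s is of order 1/λ.
  record Calibrated (q s β : ℕ) (β⁻ thr ε : ℚ) : Set where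
    field
      split  : ∀ a b → β⁻ ℚ.≤ toℚ (a + b) → (thr ℚ.< toℚ a) ⊎ (thr ℚ.< toℚ b)
      approx : ∀ a b → q * a ≤ (2 * q + 1) * b → toℚ a ℚ.≤ (toℚ 2 ℚ.+ ε) ℚ.* toℚ b
      above  : ∀ d → thr ℚ.< toℚ d → 8 * q * β ≤ 16 * q * d + β
      below  : ∀ d → β⁻ ℚ.≤ toℚ d → s * β ≤ s * d + β

  module _ (α q L β n s z : ℕ) (512≤α : 512 ≤ α) (1≤q : 1 ≤ q) (1≤L : 1 ≤ L) (n≤2^L : n ≤ 2 ^ L)
    (s≡ : s ≡ 5 * (α * α) * (q * q) * L) (z≡ : z ≡ 4 * L + 1) (β-large : s * (40 * s * z) ≤ β) where

      private
        1≤α : 1 ≤ α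
        1≤α = ≤-trans (s≤s z≤n) 512≤α

        5≤s : 5 ≤ s
        5≤s = ≤-trans (*-mono-≤ {5} {5 * (α * α) * (q * q)} {1} (*-mono-≤ {5} {5 * (α * α)} {1} (*-mono-≤ {5} {5} {1} ≤-refl (*-mono-≤ 1≤α 1≤α)) (*-mono-≤ 1≤q 1≤q)) 1≤L) (≤-reflexive (sym s≡))

        1≤s : 1 ≤ s
        1≤s = ≤-trans (s≤s z≤n) 5≤s

        instance
          s≢0 : NonZero s
          s≢0 = >-nonZero 1≤s

        1≤z : 1 ≤ z
        1≤z = ≤-trans (m≤n+m 1 (4 * L)) (≤-reflexive (sym z≡))

        -- The unit of error, of order λβ. It is the deviation `τ` allowed in the tail bounds and,
        -- as `u + 1` because of the rounded quotient, the loss in P2.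
        u : ℕ
        u = β / s

        su≤β : s * u ≤ β
        su≤β = ≤-trans (≤-reflexive (*-comm s u)) (m/n*n≤m β s)

        β<s[u+1] : β < s * (u + 1)
        β<s[u+1] = begin-strict
          β                    ≡⟨ m≡m%n+[m/n]*n β s ⟩
          β % s + u * s      <⟨ +-monoˡ-< (u * s) (m%n<n β s) ⟩
          s + u * s            ≡⟨ arr s u ⟩
          s * (u + 1)          ∎
          where
          open ≤-Reasoning
          arr : ∀ s u → s + u * s ≡ s * (u + 1)
          arr = solve-∀

        u-large : 40 * s * z ≤ u
        u-large = s≤s⁻¹ (≤-trans (*-cancelˡ-< s _ _ (≤-<-trans β-large β<s[u+1])) (≤-reflexive (+-comm u 1)))

        1≤u : 1 ≤ u
        1≤u = ≤-trans (*-mono-≤ {1} {40 * s} (*-mono-≤ {1} {40} (s≤s z≤n) 1≤s) 1≤z) u-large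

        1≤β : 1 ≤ β
        1≤β = ≤-trans (*-mono-≤ 1≤s 1≤u) su≤β

        M : ℕ
        M = 4 * s * u

        β≤2su : β ≤ 2 * (s * u)
        β≤2su = begin
          β                    ≤⟨ <⇒≤ β<s[u+1] ⟩
          s * (u + 1)          ≤⟨ *-monoʳ-≤ s (+-monoʳ-≤ u 1≤u) ⟩
          s * (u + u)          ≡⟨ arr s u ⟩
          2 * (s * u)          ∎
          where
          open ≤-Reasoning
          arr : ∀ s u → s * (u + u) ≡ 2 * (s * u)
          arr = solve-∀

        β+2u+1≤M : β + (2 * u + 1) ≤ M
        β+2u+1≤M = begin
          β + (2 * u + 1)                 ≤⟨ +-mono-≤ β≤2su (+-monoʳ-≤ (2 * u) 1≤u) ⟩
          2 * (s * u) + (2 * u + u)       ≤⟨ +-monoʳ-≤ (2 * (s * u)) (≤-trans (m≤m+n (2 * u + u) u) (≤-reflexive (arr₁ u))) ⟩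
          2 * (s * u) + 2 * (2 * u)       ≤⟨ +-monoʳ-≤ (2 * (s * u)) (*-monoʳ-≤ 2 (*-monoˡ-≤ u (≤-trans (s≤s (s≤s z≤n)) 5≤s))) ⟩
          2 * (s * u) + 2 * (s * u)       ≡⟨ arr₂ s u ⟩
          M                               ∎
          where
          open ≤-Reasoning
          arr₁ : ∀ u → 2 * u + u + u ≡ 2 * (2 * u)
          arr₁ = solve-∀
          arr₂ : ∀ s u → 2 * (s * u) + 2 * (s * u) ≡ 4 * s * u
          arr₂ = solve-∀

        -- The tail parameter is `ρ = 16s`. Of `16su`, a quarter pays for `M`, and the remaining
        -- `12su ≥ 480s²z` pays for `(17s)²z = 289s²z`, leaving the 191.
        upper-params : M + suc (16 * s) * suc (16 * s) * z ≤ 16 * s * u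
        upper-params = begin
          M + suc (16 * s) * suc (16 * s) * z          ≤⟨ +-monoʳ-≤ M (*-monoˡ-≤ z (*-mono-≤ σ≤ σ≤)) ⟩
          M + (17 * s) * (17 * s) * z                  ≤⟨ m≤m+n _ (191 * (s * s * z)) ⟩
          M + (17 * s) * (17 * s) * z + 191 * (s * s * z) ≡⟨ arr₁ s u z ⟩
          M + 12 * s * (40 * s * z)                    ≤⟨ +-monoʳ-≤ M (*-monoʳ-≤ (12 * s) u-large) ⟩
          M + 12 * s * u                               ≡⟨ arr₂ s u ⟩
          16 * s * u                                   ∎
          where
          open ≤-Reasoning
          σ≤ : suc (16 * s) ≤ 17 * s
          σ≤ = +-monoˡ-≤ (16 * s) 1≤s
          arr₁ : ∀ s u z → 4 * s * u + (17 * s) * (17 * s) * z + 191 * (s * s * z) ≡ 4 * s * u + 12 * s * (40 * s * z)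
          arr₁ = solve-∀
          arr₂ : ∀ s u → 4 * s * u + 12 * s * u ≡ 16 * s * u
          arr₂ = solve-∀

        lower-params : suc (16 * s) * (suc (suc (16 * s)) * suc (suc (16 * s))) * z + (2 * suc (16 * s) + 1) * M ≤ suc (suc (16 * s)) * suc (suc (16 * s)) * u
        lower-params = begin
          σ * (σ₁ * σ₁) * z + (2 * σ + 1) * M                      ≤⟨ +-mono-≤ first second ⟩
          σ₁ * (8 * s * u) + σ₁ * (8 * s * u)                      ≡⟨ arr σ₁ s u ⟩
          σ₁ * (16 * s) * u                                        ≤⟨ *-monoˡ-≤ u (*-monoʳ-≤ σ₁ (m≤n+m (16 * s) 2)) ⟩
          σ₁ * σ₁ * u                                              ∎
          where
          open ≤-Reasoning
          σ σ₁ : ℕ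
          σ  = suc (16 * s)
          σ₁ = suc σ
          arr : ∀ a s u → a * (8 * s * u) + a * (8 * s * u) ≡ a * (16 * s) * u
          arr = solve-∀
          arr₁ : ∀ a b z → a * (b * b) * z ≡ b * (a * b * z)
          arr₁ = solve-∀
          arr₂ : ∀ s z → (17 * s) * (18 * s) * z + 14 * (s * s * z) ≡ 8 * s * (40 * s * z)
          arr₂ = solve-∀
          arr₃ : ∀ s u → (2 * (1 + 16 * s) + 1) * (4 * s * u) + 4 * s * u ≡ (2 + 16 * s) * (8 * s * u)
          arr₃ = solve-∀
          first : σ * (σ₁ * σ₁) * z ≤ σ₁ * (8 * s * u)
          first = begin
            σ * (σ₁ * σ₁) * z                              ≡⟨ arr₁ σ σ₁ z ⟩
            σ₁ * (σ * σ₁ * z)                              ≤⟨ *-monoʳ-≤ σ₁ (*-monoˡ-≤ z (*-mono-≤ (+-monoˡ-≤ (16 * s) 1≤s) (+-mono-≤ 1≤s (+-monoˡ-≤ (16 * s) 1≤s)))) ⟩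
            σ₁ * ((17 * s) * (18 * s) * z)                 ≤⟨ *-monoʳ-≤ σ₁ (≤-trans (m≤m+n ((17 * s) * (18 * s) * z) (14 * (s * s * z))) (≤-reflexive (arr₂ s z))) ⟩
            σ₁ * (8 * s * (40 * s * z))                    ≤⟨ *-monoʳ-≤ σ₁ (*-monoʳ-≤ (8 * s) u-large) ⟩
            σ₁ * (8 * s * u)                               ∎
          second : (2 * σ + 1) * M ≤ σ₁ * (8 * s * u)
          second = ≤-trans (m≤m+n _ (4 * s * u)) (≤-reflexive (arr₃ s u))

        -- In both regimes of `k` the failure probability is at most `2n³ / 2^z`. Asking for `1/n`
        -- gives `2n⁴ ≤ 2^z`, hence `z = 4L + 1`.
        n⁴≤2^4L : 2 * (n * n * (n * n)) ≤ 2 ^ z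
        n⁴≤2^4L = begin
          2 * (n * n * (n * n))                            ≤⟨ *-monoʳ-≤ 2 (*-mono-≤ (*-mono-≤ n≤2^L n≤2^L) (*-mono-≤ n≤2^L n≤2^L)) ⟩
          2 * (2 ^ L * 2 ^ L * (2 ^ L * 2 ^ L))            ≡⟨ arr (2 ^ L) ⟩
          (2 ^ L) ^ 4 * 2                                  ≡⟨ cong (_* 2) (^-*-assoc 2 L 4) ⟩
          2 ^ (L * 4) * 2                                  ≡⟨ cong (λ e → 2 ^ e * 2) (*-comm L 4) ⟩
          2 ^ (4 * L) * 2                                  ≡⟨ ^-distribˡ-+-* 2 (4 * L) 1 ⟨
          2 ^ (4 * L + 1)                                  ≡⟨ cong (2 ^_) z≡ ⟨
          2 ^ z                                            ∎
          where
          open ≤-Reasoning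
          arr : ∀ x → 2 * (x * x * (x * x)) ≡ x * (x * (x * (x * 1))) * 2
          arr = solve-∀

      module _ (G : Graph n) {k : ℕ} .{{_ : NonZero k}} {β⁻ thr ε : ℚ} (cal : Calibrated q s β β⁻ thr ε) where

        open Calibrated cal

        private
          i₀ : Fin k
          i₀ = fromℕ< (>-nonZero⁻¹ k)

          -- The `r z′` rounds lose at most `5u` each, together at most `20αqLu`. `E` is set to the
          -- same amount, so `Δ` is the sum of the two, and `r E = M` then dictates `s = 5α²q²L`.
          r E z′ Δ : ℕ
          r  = α * q
          E  = 20 * (α * q * L * u)
          z′ = 2 * L + 2
          Δ  = 40 * (α * q * L * u)

          αqLu≥1 : 1 ≤ α * q * L * u
          αqLu≥1 = *-mono-≤ (*-mono-≤ (*-mono-≤ 1≤α 1≤q) 1≤L) 1≤u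

          2m<2^z′ : 2 * m G < 2 ^ z′
          2m<2^z′ = begin-strict
            2 * m G                  ≤⟨ *-monoʳ-≤ 2 (≤-trans (m≤n² G) (*-mono-≤ n≤2^L n≤2^L)) ⟩
            2 * (2 ^ L * 2 ^ L)      <⟨ *-monoˡ-< (2 ^ L * 2 ^ L) {{m*n≢0 (2 ^ L) (2 ^ L) {{m^n≢0 2 L}} {{m^n≢0 2 L}}}} {2} {4} (s≤s (s≤s (s≤s z≤n))) ⟩
            4 * (2 ^ L * 2 ^ L)      ≡⟨ arr (2 ^ L) ⟩
            (2 ^ L) ^ 2 * 2 ^ 2      ≡⟨ cong (_* 2 ^ 2) (trans (^-*-assoc 2 L 2) (cong (2 ^_) (*-comm L 2))) ⟩
            2 ^ (2 * L) * 2 ^ 2      ≡⟨ ^-distribˡ-+-* 2 (2 * L) 2 ⟨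
            2 ^ z′                   ∎
            where
            open ≤-Reasoning
            arr : ∀ x → 4 * (x * x) ≡ x * (x * 1) * 4
            arr = solve-∀

          rE≡M : r * E ≡ M
          rE≡M = trans (arr α q L u) (cong (λ x → 4 * x * u) (sym s≡))
            where
            arr : ∀ α q L u → α * q * (20 * (α * q * L * u)) ≡ 4 * (5 * (α * α) * (q * q) * L) * u
            arr = solve-∀

          drift≤Δ : E + r * z′ * ((u + 1) + (2 * u + 1)) ≤ Δ
          drift≤Δ = begin
            E + r * z′ * ((u + 1) + (2 * u + 1))
              ≤⟨ +-monoʳ-≤ E (*-mono-≤ (*-monoʳ-≤ r (+-monoʳ-≤ (2 * L) (*-monoʳ-≤ 2 1≤L))) (+-mono-≤ (+-monoʳ-≤ u 1≤u) (+-monoʳ-≤ (2 * u) 1≤u))) ⟩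
            E + r * (2 * L + 2 * L) * ((u + u) + (2 * u + u))     ≡⟨ arr α q L u ⟩
            Δ                                                     ∎
            where
            open ≤-Reasoning
            arr : ∀ α q L u → 20 * (α * q * L * u) + α * q * (2 * L + 2 * L) * ((u + u) + (2 * u + u)) ≡ 40 * (α * q * L * u)
            arr = solve-∀

          u≤Δ : u ≤ Δ
          u≤Δ = ≤-trans (m≤n*m u (α * q * L) {{>-nonZero (*-mono-≤ (*-mono-≤ 1≤α 1≤q) 1≤L)}}) (m≤n*m (α * q * L * u) 40)

          -- Coreset degrees in two pieces differ by at most `4Δ`. Scaled by the `16q` of `above`,
          -- this has to fit into the one further β by which the balance condition is weaker than
          -- `above`.
          64qΔ≤β : 64 * q * Δ ≤ β
          64qΔ≤β = begin
            64 * q * Δ                               ≡⟨ arr₁ α q L u ⟩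
            512 * (5 * (α * (q * q) * L * u))        ≤⟨ *-monoˡ-≤ (5 * (α * (q * q) * L * u)) 512≤α ⟩
            α * (5 * (α * (q * q) * L * u))          ≡⟨ arr₂ α q L u ⟩
            5 * (α * α) * (q * q) * L * u            ≡⟨ cong (_* u) s≡ ⟨
            s * u                                    ≤⟨ su≤β ⟩
            β                                        ∎
            where
            open ≤-Reasoning
            arr₁ : ∀ α q L u → 64 * q * (40 * (α * q * L * u)) ≡ 512 * (5 * (α * (q * q) * L * u))
            arr₁ = solve-∀
            arr₂ : ∀ α q L u → α * (5 * (α * (q * q) * L * u)) ≡ 5 * (α * α) * (q * q) * L * u
            arr₂ = solve-∀

          P2→ : ∀ d → β⁻ ℚ.≤ toℚ d → β ≤ d + (u + 1)
          P2→ d β⁻≤ = *-cancelˡ-≤ s (begin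
            s * β                      ≤⟨ below d β⁻≤ ⟩
            s * d + β                  ≤⟨ +-monoʳ-≤ (s * d) (<⇒≤ β<s[u+1]) ⟩
            s * d + s * (u + 1)        ≡⟨ *-distribˡ-+ s d (u + 1) ⟨
            s * (d + (u + 1))          ∎)
            where open ≤-Reasoning

        few-pieces-by : ∀ (H : Subset (m G)) →
          (∀ e → lookup H e ≡ true → degᵇ G (lookup H) (src G e) + degᵇ G (lookup H) (tgt G e) ≤ k * β + 1) →
          (∀ e → lookup H e ≡ false → k * β ≤ degᵇ G (lookup H) (src G e) + degᵇ G (lookup H) (tgt G e) + 1) →
          k ≤ n * n → Σ (List (Partition G k)) λ B → length B * n ^ 1 ≤ k ^ m G × (∀ p → p ∉ˡ B → Good G β β⁻ thr ε p)
        few-pieces-by H H-upper H-lower k≤n² = proj₁ bad , proj₁ (proj₂ bad) , good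
          where
          open ≤-Reasoning
          h≤kM : ∀ v → degᵇ G (lookup H) v ≤ k * M
          h≤kM v = begin
            degᵇ G (lookup H) v  ≤⟨ degᵇ-bounded G (lookup H) (k * β + 1) H-upper v ⟩
            k * β + 1            ≤⟨ +-monoʳ-≤ (k * β) (>-nonZero⁻¹ k) ⟩
            k * β + k            ≡⟨ arr k β ⟩
            k * (β + 1)          ≤⟨ *-monoʳ-≤ k (≤-trans (+-monoʳ-≤ β (m≤n+m 1 (2 * u))) β+2u+1≤M) ⟩
            k * M                ∎
            where
            arr : ∀ k b → k * b + k ≡ k * (b + 1)
            arr = solve-∀
          events≤ : k * (n * 2) * n ≤ 2 ^ z
          events≤ = begin
            k * (n * 2) * n          ≤⟨ *-monoˡ-≤ n (*-monoˡ-≤ (n * 2) k≤n²) ⟩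
            n * n * (n * 2) * n      ≡⟨ arr n ⟩
            2 * (n * n * (n * n))    ≤⟨ n⁴≤2^4L ⟩
            2 ^ z                    ∎
            where
            arr : ∀ n → n * n * (n * 2) * n ≡ 2 * (n * n * (n * n))
            arr = solve-∀
          bad : Σ (List (Partition G k)) λ B → length B * n ^ 1 ≤ k ^ m G × (∀ p → p ∉ˡ B → ¬ Atypical G H u p)
          bad = rare⇒bad-list {n = n} (m^n>0 2 z) events≤ (rare-atypical G H {16 * s} {u} {M} {z} h≤kM upper-params lower-params)
          balanced : ∀ p → Typical G H u p → ∀ (C : Fin k → Subset (m G)) → (∀ i → IsEDCS G p i (C i) β β⁻) → ∀ i v →
            thr ℚ.< toℚ (deg G (C i) v) → 4 * q * β ≤ 8 * q * degᵇ G (lookup (C i₀)) v + β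
          balanced p typical C edcs i v thr< = *-cancelˡ-≤ 2 (begin
            2 * (4 * q * β)                                              ≡⟨ arr₁ q β ⟩
            8 * q * β                                                    ≤⟨ above (deg G (C i) v) thr< ⟩
            16 * q * deg G (C i) v + β                                   ≡⟨ cong (λ d → 16 * q * d + β) (deg≡degᵇ G (C i) v) ⟩
            16 * q * degᵇ G (lookup (C i)) v + β                         ≤⟨ +-monoˡ-≤ β (*-monoʳ-≤ (16 * q) agree) ⟩
            16 * q * (degᵇ G (lookup (C i₀)) v + 2 * (Δ + Δ)) + β        ≡⟨ arr₂ q (degᵇ G (lookup (C i₀)) v) Δ β ⟩
            16 * q * degᵇ G (lookup (C i₀)) v + 64 * q * Δ + β           ≤⟨ +-monoˡ-≤ β (+-monoʳ-≤ (16 * q * degᵇ G (lookup (C i₀)) v) 64qΔ≤β) ⟩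
            16 * q * degᵇ G (lookup (C i₀)) v + β + β                    ≡⟨ arr₃ q (degᵇ G (lookup (C i₀)) v) β ⟩
            2 * (8 * q * degᵇ G (lookup (C i₀)) v + β)                   ∎)
            where
            arr₁ : ∀ q b → 2 * (4 * q * b) ≡ 8 * q * b
            arr₁ = solve-∀
            arr₂ : ∀ q d x b → 16 * q * (d + 2 * (x + x)) + b ≡ 16 * q * d + 64 * q * x + b
            arr₂ = solve-∀
            arr₃ : ∀ q d b → 16 * q * d + b + b ≡ 2 * (8 * q * d + b)
            arr₃ = solve-∀
            agree : degᵇ G (lookup (C i)) v ≤ degᵇ G (lookup (C i₀)) v + 2 * (Δ + Δ)
            agree = ≤-trans
              (coreset-degrees-agree G {k = k} {β} {u} {u + 1} {β⁻} P2→ {H} H-upper H-lower typical C edcs r E z′ (*-mono-≤ 1≤α 1≤q) (*-mono-≤ {1} {20} (s≤s z≤n) αqLu≥1) 2m<2^z′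
                (≤-trans β+2u+1≤M (≤-reflexive (sym rE≡M))) i i₀ v)
              (+-monoʳ-≤ (degᵇ G (lookup (C i₀)) v) (*-monoʳ-≤ 2 (+-mono-≤ drift≤Δ u≤Δ)))

          good : ∀ p → p ∉ˡ (proj₁ bad) → Good G β β⁻ thr ε p
          good p p∉B = good-if-balanced G {k = k} {q} {β} {β⁻} {thr} {ε} p i₀ 1≤q 1≤β split approx
                (balanced p (not-atypical⇒typical G H {u} p (proj₂ (proj₂ bad) p p∉B)))

        few-pieces : k ≤ n * n → Σ (List (Partition G k)) λ B → length B * n ^ 1 ≤ k ^ m G × (∀ p → p ∉ˡ B → Good G β β⁻ thr ε p)
        few-pieces = few-pieces-by (proj₁ ref) (proj₁ (proj₂ ref)) (proj₂ (proj₂ ref))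
          where
          ref : _
          ref = balanced-subgraph G (k * β)

        -- With at most `z` edges at a vertex in any piece, a heavy vertex would give `7β ≤ 16z`
        -- through `above`, whereas β is far larger than `z`.
        no-heavy : ∀ (p : Partition G k) → ¬ (∃ λ i → ∃ λ v → suc z ≤ hits i (starᵇ G (λ _ → true) v) p) →
          ∀ {i C} → IsEDCS G p i C β β⁻ → ∀ v → ¬ (thr ℚ.< toℚ (deg G C v))
        no-heavy p sparse {i} {C} edcs v thr< = <⇒≱ 16z<7β (*-cancelˡ-≤ q {{>-nonZero 1≤q}} (+-cancelʳ-≤ (q * β) _ _ (begin
          q * (7 * β) + q * β            ≡⟨ arr₁ q β ⟩
          8 * q * β                      ≤⟨ above (deg G C v) thr< ⟩
          16 * q * deg G C v + β         ≤⟨ +-mono-≤ (*-monoʳ-≤ (16 * q) deg≤z) (m≤n*m β q {{>-nonZero 1≤q}}) ⟩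
          16 * q * z + q * β             ≡⟨ cong (_+ q * β) (arr₂ q z) ⟩
          q * (16 * z) + q * β           ∎)))
          where
          open ≤-Reasoning
          arr₁ : ∀ q b → q * (7 * b) + q * b ≡ 8 * q * b
          arr₁ = solve-∀
          arr₂ : ∀ q z → 16 * q * z ≡ q * (16 * z)
          arr₂ = solve-∀
          in-piece : ∀ j → 𝟙 (lookup C j) ≤ 𝟙 (restrict G p i (λ _ → true) j)
          in-piece j = cases (lookup C j) refl
            where
            cases : ∀ b → lookup C j ≡ b → 𝟙 b ≤ 𝟙 (hit i (lookup p j))
            cases false _  = z≤n
            cases true  Cj = ≤-reflexive (cong 𝟙 (sym (⌊⌋⁺ (lookup p j ≟ᶠ i) (IsEDCS.sub edcs j (lookup⇒∈ Cj)))))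
          deg≤z : deg G C v ≤ z
          deg≤z = begin
            deg G C v                                         ≡⟨ deg≡degᵇ G C v ⟩
            degᵇ G (lookup C) v                               ≤⟨ wdeg-mono G in-piece v ⟩
            degᵇ G (restrict G p i (λ _ → true)) v            ≡⟨ star-hits G p i (λ _ → true) v ⟨
            hits i (starᵇ G (λ _ → true) v) p                 ≤⟨ s≤s⁻¹ (≰⇒> (λ le → sparse (i , v , le))) ⟩
            z                                                 ∎
          16z<7β : 16 * z < 7 * β
          16z<7β = begin-strict
            16 * z                     <⟨ *-monoˡ-< z {{>-nonZero 1≤z}} {16} {40} (m≤m+n 17 23) ⟩
            40 * z                     ≤⟨ *-monoˡ-≤ z (m≤m*n 40 s) ⟩
            40 * s * z                 ≤⟨ u-large ⟩
            u                          ≤⟨ m≤n*m u s ⟩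
            s * u                      ≤⟨ su≤β ⟩
            β                          ≤⟨ m≤n*m β 7 ⟩
            7 * β                      ∎

        -- A star has at most `m ≤ n² < k` edges, the regime of `rare-crowded`, whose denominator
        -- `k * 2 ^ z` cancels the `k` of the union over pieces. Outside the bad list the transfer
        -- of heavy vertices to `i₀` holds vacuously.
        many-pieces : n * n < k → Σ (List (Partition G k)) λ B → length B * n ^ 1 ≤ k ^ m G × (∀ p → p ∉ˡ B → Good G β β⁻ thr ε p)
        many-pieces n²<k = proj₁ bad , proj₁ (proj₂ bad) , good
          where
          open ≤-Reasoning
          crowded : ∀ i v → Rare (k ^ m G) (2 * m G) (k * 2 ^ z) (λ p → suc z ≤ hits i (starᵇ G (λ _ → true) v) p)
          crowded i v = rare-weaken (*-monoʳ-≤ 2 star≤m) (rare-crowded i (starᵇ G (λ _ → true) v) (suc z) (2 ^ z) 2^z<2^[z+1] (≤-trans star≤m (≤-trans (m≤n² G) (<⇒≤ n²<k))))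
            where
            star≤m : sum (λ j → 𝟙 (starᵇ G (λ _ → true) v j)) ≤ m G
            star≤m = ≤-trans (sum-mono-≤ (λ j → 𝟙≤1 (starᵇ G (λ _ → true) v j))) (≤-reflexive (trans (sum-const (m G) 1) (*-identityʳ (m G))))
            2^z<2^[z+1] : suc (2 ^ z) ≤ 2 ^ suc z
            2^z<2^[z+1] = ≤-trans (+-monoˡ-≤ (2 ^ z) (m^n>0 2 z)) (≤-reflexive (cong (2 ^ z +_) (sym (+-identityʳ (2 ^ z)))))
          events≤ : k * (n * (2 * m G)) * n ≤ k * 2 ^ z
          events≤ = begin
            k * (n * (2 * m G)) * n             ≤⟨ *-monoˡ-≤ n (*-monoʳ-≤ k (*-monoʳ-≤ n (*-monoʳ-≤ 2 (m≤n² G)))) ⟩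
            k * (n * (2 * (n * n))) * n         ≡⟨ arr k n ⟩
            k * (2 * (n * n * (n * n)))         ≤⟨ *-monoʳ-≤ k n⁴≤2^4L ⟩
            k * 2 ^ z                           ∎
            where
            arr : ∀ k n → k * (n * (2 * (n * n))) * n ≡ k * (2 * (n * n * (n * n)))
            arr = solve-∀
          bad : Σ (List (Partition G k)) λ B → length B * n ^ 1 ≤ k ^ m G × (∀ p → p ∉ˡ B → ¬ (∃ λ i → ∃ λ v → suc z ≤ hits i (starᵇ G (λ _ → true) v) p))
          bad = rare⇒bad-list {N = k * (n * (2 * m G))} {Z = k * 2 ^ z} {n = n}
               (*-mono-≤ (>-nonZero⁻¹ k) (m^n>0 2 z)) events≤ (rare-∃ (λ i → rare-∃ (λ v → crowded i v)))
          no-heavy-vertex : ∀ p → p ∉ˡ (proj₁ bad) → ∀ (C : Fin k → Subset (m G)) → (∀ i → IsEDCS G p i (C i) β β⁻) → ∀ i v →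
            thr ℚ.< toℚ (deg G (C i) v) → 4 * q * β ≤ 8 * q * degᵇ G (lookup (C i₀)) v + β
          no-heavy-vertex p p∉B C edcs i v thr< = ⊥-elim (no-heavy p (proj₂ (proj₂ bad) p p∉B) {i = i} {C i} (edcs i) v thr<)
          good : ∀ p → p ∉ˡ (proj₁ bad) → Good G β β⁻ thr ε p
          good p p∉B = good-if-balanced G {k = k} {q} {β} {β⁻} {thr} {ε} p i₀ 1≤q 1≤β split approx (no-heavy-vertex p p∉B)

        mostly-good : Σ (List (Partition G k)) λ B → length B * n ^ 1 ≤ k ^ m G × (∀ p → p ∉ˡ B → Good G β β⁻ thr ε p)
        mostly-good = [ few-pieces , many-pieces ]′ (≤-<-connex k (n * n))

-- Arithmetic of the rational parameters

module Rationals where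

  open Combinatorics using (Calibrated)
  open import Data.Nat as ℕ using (ℕ; zero; suc; z≤n; s≤s)
  import Data.Nat.Properties as ℕ
  open import Data.Nat.DivMod using (m≡m%n+[m/n]*n; m%n<n; m/n*n≤m)
  import Data.Nat.Tactic.RingSolver as ℕ-Solver
  open import Data.Integer as ℤ using (+_; +[1+_]; -[1+_])
  import Data.Integer.Properties as ℤ
  open import Data.Integer.DivMod using ([n/d]*d≤n)
  open import Data.Rational
  open import Data.Rational.Properties
  open import Data.Rational.Unnormalised as ℚᵘ using (mkℚᵘ; *≡*)
  import Data.Rational.Unnormalised.Properties as ℚᵘ
  open import Data.Empty using (⊥-elim)
  open import Data.Maybe using (Maybe; just; nothing)
  open import Data.Product using (_×_; _,_; ∃)
  open import Data.Sum using (_⊎_; inj₁; inj₂)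
  open import Relation.Binary.PropositionalEquality
  open import Relation.Nullary using (Dec; yes; no)
  open import Tactic.RingSolver using (solve-∀)
  open import Tactic.RingSolver.Core.AlmostCommutativeRing using (AlmostCommutativeRing; fromCommutativeRing)

  ℚ-ring : AlmostCommutativeRing _ _
  ℚ-ring = fromCommutativeRing +-*-commutativeRing isZero
    where
    isZero : ∀ x → Maybe (0ℚ ≡ x)
    isZero x with 0ℚ ≟ x
    ... | yes 0≡x = just 0≡x
    ... | no  _   = nothing

  -- `toℚ` normalises by a gcd, which obstructs computation; arithmetic laws are therefore checked
  -- on unnormalised fractions with denominator 1.
  toℚᵘ-toℚ : ∀ n → toℚᵘ (toℚ n) ℚᵘ.≃ mkℚᵘ (+ n) 0
  toℚᵘ-toℚ n = toℚᵘ-fromℚᵘ (mkℚᵘ (+ n) 0)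

  toℚ-+ : ∀ a b → toℚ (a ℕ.+ b) ≡ toℚ a + toℚ b
  toℚ-+ a b = toℚᵘ-injective (begin
    toℚᵘ (toℚ (a ℕ.+ b))              ≈⟨ toℚᵘ-toℚ (a ℕ.+ b) ⟩
    mkℚᵘ (+ (a ℕ.+ b)) 0              ≈⟨ *≡* (cong (ℤ._* + 1) (trans (ℤ.pos-+ a b) (sym (cong₂ ℤ._+_ (ℤ.*-identityʳ (+ a)) (ℤ.*-identityʳ (+ b)))))) ⟩
    mkℚᵘ (+ a) 0 ℚᵘ.+ mkℚᵘ (+ b) 0    ≈⟨ ℚᵘ.+-cong (toℚᵘ-toℚ a) (toℚᵘ-toℚ b) ⟨
    toℚᵘ (toℚ a) ℚᵘ.+ toℚᵘ (toℚ b)    ≈⟨ toℚᵘ-homo-+ (toℚ a) (toℚ b) ⟨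
    toℚᵘ (toℚ a + toℚ b)              ∎)
    where open ℚᵘ.≃-Reasoning

  toℚ-* : ∀ a b → toℚ (a ℕ.* b) ≡ toℚ a * toℚ b
  toℚ-* a b = toℚᵘ-injective (begin
    toℚᵘ (toℚ (a ℕ.* b))              ≈⟨ toℚᵘ-toℚ (a ℕ.* b) ⟩
    mkℚᵘ (+ (a ℕ.* b)) 0              ≈⟨ *≡* (cong (ℤ._* + 1) (ℤ.pos-* a b)) ⟩
    mkℚᵘ (+ a) 0 ℚᵘ.* mkℚᵘ (+ b) 0    ≈⟨ ℚᵘ.*-cong (toℚᵘ-toℚ a) (toℚᵘ-toℚ b) ⟨
    toℚᵘ (toℚ a) ℚᵘ.* toℚᵘ (toℚ b)    ≈⟨ toℚᵘ-homo-* (toℚ a) (toℚ b) ⟨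
    toℚᵘ (toℚ a * toℚ b)              ∎)
    where open ℚᵘ.≃-Reasoning

  toℚ-mono : ∀ {a b} → a ℕ.≤ b → toℚ a ≤ toℚ b
  toℚ-mono {a} {b} a≤b = toℚᵘ-cancel-≤ (ℚᵘ.≤-respˡ-≃ (ℚᵘ.≃-sym (toℚᵘ-toℚ a)) (ℚᵘ.≤-respʳ-≃ (ℚᵘ.≃-sym (toℚᵘ-toℚ b))
    (ℚᵘ.*≤* (ℤ.*-monoʳ-≤-nonNeg (+ 1) (ℤ.+≤+ a≤b)))))

  toℚ-mono-< : ∀ {a b} → a ℕ.< b → toℚ a < toℚ b
  toℚ-mono-< {a} {b} a<b = toℚᵘ-cancel-< (ℚᵘ.<-respˡ-≃ (ℚᵘ.≃-sym (toℚᵘ-toℚ a)) (ℚᵘ.<-respʳ-≃ (ℚᵘ.≃-sym (toℚᵘ-toℚ b))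
    (ℚᵘ.*<* (ℤ.*-monoʳ-<-pos (+ 1) (ℤ.+<+ a<b)))))

  toℚ-cancel-≤ : ∀ {a b} → toℚ a ≤ toℚ b → a ℕ.≤ b
  toℚ-cancel-≤ {a} {b} le = ℕ.≮⇒≥ (λ b<a → <-irrefl refl (<-≤-trans (toℚ-mono-< b<a) le))

  toℚ-cancel-< : ∀ {a b} → toℚ a < toℚ b → a ℕ.< b
  toℚ-cancel-< {a} {b} lt = ℕ.≰⇒> (λ b≤a → <-irrefl refl (<-≤-trans lt (toℚ-mono b≤a)))

  0≤toℚ : ∀ n → 0ℚ ≤ toℚ n
  0≤toℚ n = toℚ-mono {0} {n} z≤n

  *-monoˡ : ∀ {p q} r → 0ℚ ≤ r → p ≤ q → r * p ≤ r * q
  *-monoˡ r 0≤r = *-monoˡ-≤-nonNeg r {{nonNegative 0≤r}}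

  *-monoʳ : ∀ {p q} r → 0ℚ ≤ r → p ≤ q → p * r ≤ q * r
  *-monoʳ r 0≤r = *-monoʳ-≤-nonNeg r {{nonNegative 0≤r}}

  *-nonNeg : ∀ {p q} → 0ℚ ≤ p → 0ℚ ≤ q → 0ℚ ≤ p * q
  *-nonNeg {p} {q} 0≤p 0≤q = nonNegative⁻¹ (p * q) {{nonNeg*nonNeg⇒nonNeg p {{nonNegative 0≤p}} q {{nonNegative 0≤q}}}}

  *-pos : ∀ {p q} → 0ℚ < p → 0ℚ < q → 0ℚ < p * q
  *-pos {p} {q} 0<p 0<q = positive⁻¹ (p * q) {{pos*pos⇒pos p {{positive 0<p}} q {{positive 0<q}}}}

  *-mono : ∀ {p q r s} → 0ℚ ≤ p → 0ℚ ≤ r → p ≤ q → r ≤ s → p * r ≤ q * s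
  *-mono {p} {q} {r} {s} 0≤p 0≤r p≤q r≤s = ≤-trans (*-monoʳ r 0≤r p≤q) (*-monoˡ q (≤-trans 0≤p p≤q) r≤s)

  ^ℚ-nonNeg : ∀ {p} → 0ℚ ≤ p → ∀ e → 0ℚ ≤ p ^ℚ e
  ^ℚ-nonNeg 0≤p zero    = 0≤toℚ 1
  ^ℚ-nonNeg 0≤p (suc e) = *-nonNeg 0≤p (^ℚ-nonNeg 0≤p e)

  ^ℚ-mono : ∀ {p q} → 0ℚ ≤ p → p ≤ q → ∀ e → p ^ℚ e ≤ q ^ℚ e
  ^ℚ-mono 0≤p p≤q zero    = ≤-refl
  ^ℚ-mono 0≤p p≤q (suc e) = *-mono 0≤p (^ℚ-nonNeg 0≤p e) p≤q (^ℚ-mono 0≤p p≤q e)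

  ^ℚ-distrib-* : ∀ p q e → (p * q) ^ℚ e ≡ p ^ℚ e * q ^ℚ e
  ^ℚ-distrib-* p q zero    = refl
  ^ℚ-distrib-* p q (suc e) = trans (cong (p * q *_) (^ℚ-distrib-* p q e)) (arr p q (p ^ℚ e) (q ^ℚ e))
    where
    arr : ∀ a b c d → a * b * (c * d) ≡ a * c * (b * d)
    arr = solve-∀ ℚ-ring

  toℚ-^ : ∀ a e → toℚ (a ℕ.^ e) ≡ toℚ a ^ℚ e
  toℚ-^ a zero    = refl
  toℚ-^ a (suc e) = trans (toℚ-* a (a ℕ.^ e)) (cong (toℚ a *_) (toℚ-^ a e))

  i≤+∣i∣ : ∀ i → i ℤ.≤ + ℤ.∣ i ∣
  i≤+∣i∣ (+ n)    = ℤ.≤-refl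
  i≤+∣i∣ -[1+ n ] = ℤ.-≤+

  -- The ceiling is minus the floor of `- p`, and passing to its absolute value can only increase
  -- it.
  p≤ceilℕ : ∀ p → p ≤ toℚ (ceilℕ p)
  p≤ceilℕ p@record{} = toℚᵘ-cancel-≤ (ℚᵘ.≤-respʳ-≃ (ℚᵘ.≃-sym (toℚᵘ-toℚ (ceilℕ p))) (ℚᵘ.*≤* (begin
    ↥ p ℤ.* + 1                   ≡⟨ ℤ.*-identityʳ (↥ p) ⟩
    ↥ p                           ≡⟨ ℤ.neg-involutive (↥ p) ⟨
    ℤ.- (ℤ.- ↥ p)                 ≡⟨ cong ℤ.-_ (↥-neg p) ⟨
    ℤ.- (↥ (- p))                 ≤⟨ ℤ.neg-mono-≤ (floor-bound (- p)) ⟩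
    ℤ.- (floor (- p) ℤ.* ↧ (- p)) ≡⟨ ℤ.neg-distribˡ-* (floor (- p)) (↧ (- p)) ⟩
    ceiling p ℤ.* ↧ (- p)         ≡⟨ cong (ceiling p ℤ.*_) (↧-neg p) ⟩
    ceiling p ℤ.* ↧ p             ≤⟨ ℤ.*-monoʳ-≤-nonNeg (↧ p) (i≤+∣i∣ (ceiling p)) ⟩
    + ceilℕ p ℤ.* ↧ p             ∎)))
    where
    open ℤ.≤-Reasoning
    floor-bound : ∀ x → floor x ℤ.* ↧ x ℤ.≤ ↥ x
    floor-bound x@record{} = [n/d]*d≤n (↥ x) (↧ x)

  -- For `ε = a/d` the witness is the floor of `d/a` plus one: it is at least `1/ε`, and
  -- `qa ≤ d + a ≤ 2d` because `ε < 1`.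
  reciprocal-scale : ∀ ε → 0ℚ < ε → ε < 1ℚ → ∃ λ q → (1 ℕ.≤ q) × (1ℚ ≤ toℚ q * ε) × (toℚ q * ε ≤ toℚ 2)
  reciprocal-scale (mkℚ (+ zero) _ _) (*<* (ℤ.+<+ ())) _
  reciprocal-scale (mkℚ -[1+ _ ] _ _) (*<* ()) _
  reciprocal-scale ε@(mkℚ +[1+ a ] d′ _) _ ε<1 = q , ℕ.m≤n+m 1 (d ℕ./ suc a) , lower , upper
    where
    d q : ℕ
    d = suc d′
    q = d ℕ./ suc a ℕ.+ 1
    0<d : 0ℚ < toℚ d
    0<d = toℚ-mono-< {0} {d} (s≤s z≤n)
    dε : toℚ d * ε ≡ toℚ (suc a)
    dε = toℚᵘ-injective (begin
      toℚᵘ (toℚ d * ε)                        ≈⟨ toℚᵘ-homo-* (toℚ d) ε ⟩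
      toℚᵘ (toℚ d) ℚᵘ.* mkℚᵘ +[1+ a ] d′      ≈⟨ ℚᵘ.*-congʳ {mkℚᵘ +[1+ a ] d′} (toℚᵘ-toℚ d) ⟩
      mkℚᵘ (+ d) 0 ℚᵘ.* mkℚᵘ +[1+ a ] d′      ≈⟨ *≡* (trans (ℤ.*-identityʳ (+ d ℤ.* +[1+ a ])) (trans (ℤ.*-comm (+ d) +[1+ a ]) (cong (λ x → +[1+ a ] ℤ.* + suc x) (sym (ℕ.+-identityʳ d′))))) ⟩
      mkℚᵘ +[1+ a ] 0                         ≈⟨ toℚᵘ-toℚ (suc a) ⟨
      toℚᵘ (toℚ (suc a))                      ∎)
      where open ℚᵘ.≃-Reasoning
    a<d : suc a ℕ.< d
    a<d = toℚ-cancel-< (subst₂ _<_ dε (*-identityʳ (toℚ d)) (*-monoʳ-<-pos (toℚ d) {{positive 0<d}} ε<1))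
    scaled : toℚ d * (toℚ q * ε) ≡ toℚ (q ℕ.* suc a)
    scaled = trans (arr (toℚ d) (toℚ q) ε) (trans (cong (toℚ q *_) dε) (sym (toℚ-* q (suc a))))
      where
      arr : ∀ d q e → d * (q * e) ≡ q * (d * e)
      arr = solve-∀ ℚ-ring
    q*a : q ℕ.* suc a ≡ d ℕ./ suc a ℕ.* suc a ℕ.+ suc a
    q*a = arr (d ℕ./ suc a) (suc a)
      where
      arr : ∀ x a → (x ℕ.+ 1) ℕ.* a ≡ x ℕ.* a ℕ.+ a
      arr = ℕ-Solver.solve-∀
    lower : 1ℚ ≤ toℚ q * ε
    lower = *-cancelˡ-≤-pos (toℚ d) {{positive 0<d}} (begin
      toℚ d * 1ℚ              ≡⟨ *-identityʳ (toℚ d) ⟩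
      toℚ d                   ≤⟨ toℚ-mono d≤qa ⟩
      toℚ (q ℕ.* suc a)       ≡⟨ scaled ⟨
      toℚ d * (toℚ q * ε)     ∎)
      where
      open ≤-Reasoning
      d≤qa : d ℕ.≤ q ℕ.* suc a
      d≤qa = ℕ.≤-trans (ℕ.≤-reflexive (m≡m%n+[m/n]*n d (suc a))) (ℕ.≤-trans (ℕ.+-monoˡ-≤ (d ℕ./ suc a ℕ.* suc a) (ℕ.<⇒≤ (m%n<n d (suc a))))
        (ℕ.≤-reflexive (trans (ℕ.+-comm (suc a) _) (sym q*a))))
    upper : toℚ q * ε ≤ toℚ 2
    upper = *-cancelˡ-≤-pos (toℚ d) {{positive 0<d}} (begin
      toℚ d * (toℚ q * ε)     ≡⟨ scaled ⟩
      toℚ (q ℕ.* suc a)       ≤⟨ toℚ-mono qa≤2d ⟩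
      toℚ (d ℕ.* 2)           ≡⟨ toℚ-* d 2 ⟩
      toℚ d * toℚ 2           ∎)
      where
      open ≤-Reasoning
      qa≤2d : q ℕ.* suc a ℕ.≤ d ℕ.* 2
      qa≤2d = ℕ.≤-trans (ℕ.≤-reflexive q*a) (ℕ.≤-trans (ℕ.+-mono-≤ (m/n*n≤m d (suc a)) (ℕ.<⇒≤ a<d)) (ℕ.≤-reflexive (arr d)))
        where
        arr : ∀ d → d ℕ.+ d ≡ d ℕ.* 2
        arr = ℕ-Solver.solve-∀

  -- For `split`, two degrees not above the threshold add up to at most `(1 - x)β`, which is less
  -- than `(1 - λ′)β` since `λ′ < x`. The other fields clear denominators in `2 + 1/q ≤ 2 + ε`,
  -- `xβ ≤ β/(8q)` and `λ′β ≤ β/s`.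
  calibrated : ∀ {q s β ε} x λ′ → 1 ℕ.≤ q → 1 ℕ.≤ β → 1ℚ ≤ toℚ q * ε → λ′ < x → toℚ (8 ℕ.* q) * x ≤ 1ℚ → toℚ s * λ′ ≤ 1ℚ →
    Calibrated q s β ((1ℚ - λ′) * toℚ β) ((1ℚ - x) * toℚ β * ½) ε
  calibrated {q} {s} {β} {ε} x λ′ 1≤q 1≤β 1≤qε λ<x 8qx≤1 sλ≤1 = record
    { split = split ; approx = approx ; above = above ; below = below }
    where
    open ≤-Reasoning
    B thr : ℚ
    B   = toℚ β
    thr = (1ℚ - x) * B * ½
    0<B : 0ℚ < B
    0<B = toℚ-mono-< {0} 1≤β
    complement : ∀ y → B ≡ (1ℚ - y) * B + y * B
    complement y = arr y B
      where
      arr : ∀ y b → b ≡ (1ℚ - y) * b + y * b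
      arr = solve-∀ ℚ-ring
    thr+thr : thr + thr ≡ (1ℚ - x) * B
    thr+thr = trans (sym (*-distribˡ-+ ((1ℚ - x) * B) ½ ½)) (*-identityʳ ((1ℚ - x) * B))
    split : ∀ a b → (1ℚ - λ′) * B ≤ toℚ (a ℕ.+ b) → thr < toℚ a ⊎ thr < toℚ b
    split a b large = cases (thr <? toℚ a) (thr <? toℚ b)
      where
      cases : Dec (thr < toℚ a) → Dec (thr < toℚ b) → thr < toℚ a ⊎ thr < toℚ b
      cases (yes a-large) _             = inj₁ a-large
      cases (no  _)       (yes b-large) = inj₂ b-large
      cases (no  a-small) (no b-small)  = ⊥-elim (<-irrefl refl (begin-strict
        (1ℚ - x) * B              <⟨ *-monoˡ-<-pos B {{positive 0<B}} (+-monoʳ-< 1ℚ (neg-antimono-< λ<x)) ⟩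
        (1ℚ - λ′) * B             ≤⟨ large ⟩
        toℚ (a ℕ.+ b)             ≡⟨ toℚ-+ a b ⟩
        toℚ a + toℚ b             ≤⟨ +-mono-≤ (≮⇒≥ a-small) (≮⇒≥ b-small) ⟩
        thr + thr                 ≡⟨ thr+thr ⟩
        (1ℚ - x) * B              ∎))
    approx : ∀ a b → q ℕ.* a ℕ.≤ (2 ℕ.* q ℕ.+ 1) ℕ.* b → toℚ a ≤ (toℚ 2 + ε) * toℚ b
    approx a b le = *-cancelˡ-≤-pos (toℚ q) {{positive (toℚ-mono-< {0} 1≤q)}} (begin
      toℚ q * toℚ a                              ≡⟨ toℚ-* q a ⟨
      toℚ (q ℕ.* a)                              ≤⟨ toℚ-mono le ⟩
      toℚ ((2 ℕ.* q ℕ.+ 1) ℕ.* b)                ≡⟨ trans (toℚ-* (2 ℕ.* q ℕ.+ 1) b) (cong (_* toℚ b) (trans (toℚ-+ (2 ℕ.* q) 1) (cong (_+ 1ℚ) (toℚ-* 2 q)))) ⟩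
      (toℚ 2 * toℚ q + 1ℚ) * toℚ b               ≤⟨ *-monoʳ (toℚ b) (0≤toℚ b) (+-monoʳ-≤ (toℚ 2 * toℚ q) 1≤qε) ⟩
      (toℚ 2 * toℚ q + toℚ q * ε) * toℚ b        ≡⟨ arr (toℚ 2) (toℚ q) ε (toℚ b) ⟩
      toℚ q * ((toℚ 2 + ε) * toℚ b)              ∎)
      where
      arr : ∀ t q e b → (t * q + q * e) * b ≡ q * ((t + e) * b)
      arr = solve-∀ ℚ-ring
    above : ∀ d → thr < toℚ d → 8 ℕ.* q ℕ.* β ℕ.≤ 16 ℕ.* q ℕ.* d ℕ.+ β
    above d thr<d = toℚ-cancel-≤ (begin
      toℚ (8 ℕ.* q ℕ.* β)                                        ≡⟨ toℚ-* (8 ℕ.* q) β ⟩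
      toℚ (8 ℕ.* q) * B                                          ≡⟨ cong (toℚ (8 ℕ.* q) *_) (complement x) ⟩
      toℚ (8 ℕ.* q) * ((1ℚ - x) * B + x * B)                     ≡⟨ arr (toℚ (8 ℕ.* q)) ((1ℚ - x) * B) x B ⟩
      toℚ (8 ℕ.* q) * ((1ℚ - x) * B) + toℚ (8 ℕ.* q) * x * B     ≤⟨ +-mono-≤ (*-monoˡ (toℚ (8 ℕ.* q)) (0≤toℚ (8 ℕ.* q)) 2d-large) (*-monoʳ B (<⇒≤ 0<B) 8qx≤1) ⟩
      toℚ (8 ℕ.* q) * toℚ (d ℕ.+ d) + 1ℚ * B                     ≡⟨ cong₂ _+_ (sym (toℚ-* (8 ℕ.* q) (d ℕ.+ d))) (*-identityˡ B) ⟩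
      toℚ (8 ℕ.* q ℕ.* (d ℕ.+ d)) + B                            ≡⟨ toℚ-+ (8 ℕ.* q ℕ.* (d ℕ.+ d)) β ⟨
      toℚ (8 ℕ.* q ℕ.* (d ℕ.+ d) ℕ.+ β)                          ≡⟨ cong (λ e → toℚ (e ℕ.+ β)) (arr′ q d) ⟩
      toℚ (16 ℕ.* q ℕ.* d ℕ.+ β)                                 ∎)
      where
      arr : ∀ k c x b → k * (c + x * b) ≡ k * c + k * x * b
      arr = solve-∀ ℚ-ring
      arr′ : ∀ q d → 8 ℕ.* q ℕ.* (d ℕ.+ d) ≡ 16 ℕ.* q ℕ.* d
      arr′ = ℕ-Solver.solve-∀
      2d-large : (1ℚ - x) * B ≤ toℚ (d ℕ.+ d)
      2d-large = begin
        (1ℚ - x) * B      ≡⟨ thr+thr ⟨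
        thr + thr         ≤⟨ +-mono-≤ (<⇒≤ thr<d) (<⇒≤ thr<d) ⟩
        toℚ d + toℚ d     ≡⟨ toℚ-+ d d ⟨
        toℚ (d ℕ.+ d)     ∎
    below : ∀ d → (1ℚ - λ′) * B ≤ toℚ d → s ℕ.* β ℕ.≤ s ℕ.* d ℕ.+ β
    below d large = toℚ-cancel-≤ (begin
      toℚ (s ℕ.* β)                                  ≡⟨ toℚ-* s β ⟩
      toℚ s * B                                      ≡⟨ cong (toℚ s *_) (complement λ′) ⟩
      toℚ s * ((1ℚ - λ′) * B + λ′ * B)               ≡⟨ arr (toℚ s) ((1ℚ - λ′) * B) λ′ B ⟩
      toℚ s * ((1ℚ - λ′) * B) + toℚ s * λ′ * B       ≤⟨ +-mono-≤ (*-monoˡ (toℚ s) (0≤toℚ s) large) (*-monoʳ B (<⇒≤ 0<B) sλ≤1) ⟩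
      toℚ s * toℚ d + 1ℚ * B                         ≡⟨ cong₂ _+_ (sym (toℚ-* s d)) (*-identityˡ B) ⟩
      toℚ (s ℕ.* d) + B                              ≡⟨ toℚ-+ (s ℕ.* d) β ⟨
      toℚ (s ℕ.* d ℕ.+ β)                            ∎)
      where
      arr : ∀ k c x b → k * (c + x * b) ≡ k * c + k * x * b
      arr = solve-∀ ℚ-ring

-- The absolute constants and the final bound

open import Data.Nat using (ℕ; _≤_; _+_; _*_; _^_)
open import Data.Rational using (ℚ; 0ℚ; 1ℚ; _<_; _-_; positive) renaming (_*_ to _*ℚ_)
open import Data.Fin.Subset using (∣_∣)
open import Data.Product using (Σ; _×_)
open import Data.List using (List; length)
open import Data.List.Membership.Propositional using (_∉_)

open import Data.Nat using (suc; s≤s; z≤n)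
import Data.Nat as ℕ
import Data.Nat.Properties as ℕ
open import Data.Nat.Tactic.RingSolver using (solve-∀)
open import Data.Integer using (+_)
import Data.Integer as ℤ
import Data.Integer.Properties as ℤ
open import Data.Product using (_,_; proj₁; proj₂)
import Data.Rational as ℚ
import Data.Rational.Properties as ℚ
import Data.Rational.Unnormalised as ℚᵘ
import Data.Rational.Unnormalised.Properties as ℚᵘ
open import Relation.Binary.PropositionalEquality
import Tactic.RingSolver as Ring
open Combinatorics using (coreset-size; Calibrated; mostly-good; 1≤⌈log₂n⌉; n≤2^⌈log₂n⌉)
open Rationals

reciprocal-* : ∀ l → toℚ (suc l) *ℚ (+ 1 ℚ./ suc l) ≡ 1ℚ
reciprocal-* l = ℚ.toℚᵘ-injective (begin
  ℚ.toℚᵘ (toℚ (suc l) *ℚ (+ 1 ℚ./ suc l))               ≈⟨ ℚ.toℚᵘ-homo-* (toℚ (suc l)) (+ 1 ℚ./ suc l) ⟩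
  ℚ.toℚᵘ (toℚ (suc l)) ℚᵘ.* ℚ.toℚᵘ (+ 1 ℚ./ suc l)      ≈⟨ ℚᵘ.*-cong (toℚᵘ-toℚ (suc l)) (ℚ.toℚᵘ-fromℚᵘ (ℚᵘ.mkℚᵘ (+ 1) l)) ⟩
  ℚᵘ.mkℚᵘ (+ suc l) 0 ℚᵘ.* ℚᵘ.mkℚᵘ (+ 1) l               ≈⟨ ℚᵘ.*≡* (trans (ℤ.*-identityʳ (+ suc l ℤ.* + 1)) (trans (ℤ.*-identityʳ (+ suc l)) (trans (cong (λ x → + suc x) (sym (ℕ.+-identityʳ l))) (sym (ℤ.*-identityˡ _))))) ⟩
  ℚᵘ.mkℚᵘ (+ 1) 0                                       ∎)
  where
  open ℚᵘ.≃-Reasoning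

reciprocal-pos : ∀ l → 0ℚ < + 1 ℚ./ suc l
reciprocal-pos l = ℚ.positive⁻¹ (+ 1 ℚ./ suc l) {{ℚ.normalize-pos 1 (suc l)}}

reciprocal≤1 : ∀ l → + 1 ℚ./ suc l ℚ.≤ 1ℚ
reciprocal≤1 l = begin
  + 1 ℚ./ suc l                    ≡⟨ ℚ.*-identityˡ (+ 1 ℚ./ suc l) ⟨
  toℚ 1 *ℚ (+ 1 ℚ./ suc l)         ≤⟨ *-monoʳ (+ 1 ℚ./ suc l) (ℚ.<⇒≤ (reciprocal-pos l)) (toℚ-mono {1} {suc l} (s≤s z≤n)) ⟩
  toℚ (suc l) *ℚ (+ 1 ℚ./ suc l)   ≡⟨ reciprocal-* l ⟩
  1ℚ                               ∎
  where open ℚ.≤-Reasoning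

-- `lamParam` matches on `logN n`; this exposes its second clause where the logarithm is a successor
-- only by a proof.
lamParam-suc : ∀ cλ ε n l → logN n ≡ suc l → lamParam cλ ε n ≡ cλ *ℚ ((ε *ℚ (+ 1 ℚ./ suc l)) ^ℚ 2)
lamParam-suc cλ ε n l eq with logN n
lamParam-suc cλ ε n l refl | suc .l = refl

module _ {ε : ℚ} (ε>0 : 0ℚ < ε) where

  private
    0≤ε : 0ℚ ℚ.≤ ε
    0≤ε = ℚ.<⇒≤ ε>0

  -- Since `y = ε/L ≤ ε < 1`, the square of `y` is at most ε.
  lamParam<xε : ∀ {cλ x} n → 0ℚ < cλ → cλ < x → ε < 1ℚ → 1 ≤ logN n → lamParam cλ ε n < x *ℚ ε
  lamParam<xε {cλ} {x} n 0<cλ cλ<x ε<1 1≤L = bound (logN n) refl 1≤L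
    where
    open ℚ.≤-Reasoning
    bound : ∀ L → logN n ≡ L → 1 ≤ L → lamParam cλ ε n < x *ℚ ε
    bound (suc l) eq _ = begin-strict
      lamParam cλ ε n            ≡⟨ lamParam-suc cλ ε n l eq ⟩
      cλ *ℚ (y *ℚ (y *ℚ 1ℚ))     ≤⟨ *-monoˡ cλ (ℚ.<⇒≤ 0<cλ) (*-mono 0≤y (*-nonNeg 0≤y (0≤toℚ 1)) y≤ε (*-monoʳ 1ℚ (0≤toℚ 1) (ℚ.≤-trans y≤ε (ℚ.<⇒≤ ε<1)))) ⟩
      cλ *ℚ (ε *ℚ (1ℚ *ℚ 1ℚ))    ≡⟨ cong (cλ *ℚ_) (ℚ.*-identityʳ ε) ⟩
      cλ *ℚ ε                    <⟨ ℚ.*-monoˡ-<-pos ε {{positive ε>0}} cλ<x ⟩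
      x *ℚ ε                     ∎
      where
      y : ℚ
      y = ε *ℚ (+ 1 ℚ./ suc l)
      0≤y : 0ℚ ℚ.≤ y
      0≤y = *-nonNeg 0≤ε (ℚ.<⇒≤ (reciprocal-pos l))
      y≤ε : y ℚ.≤ ε
      y≤ε = ℚ.≤-trans (*-monoˡ ε 0≤ε (reciprocal≤1 l)) (ℚ.≤-reflexive (ℚ.*-identityʳ ε))

  -- The product regroups as `(c cλ) (qε)² / L`. As `(qε)²` can be as large as 4, the value of
  -- `c cλ` is a quarter, and the leftover `1/L` is at most 1.
  lamParam-scale : ∀ {cλ} c q n → 0ℚ < cλ → toℚ c *ℚ cλ ≡ + 1 ℚ./ 4 → toℚ q *ℚ ε ℚ.≤ toℚ 2 → 1 ≤ logN n →
    toℚ (c * (q * q) * logN n) *ℚ lamParam cλ ε n ℚ.≤ 1ℚ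
  lamParam-scale {cλ} c q n 0<cλ ccλ qε≤2 1≤L = bound (logN n) refl 1≤L
    where
    open ℚ.≤-Reasoning
    bound : ∀ L → logN n ≡ L → 1 ≤ L → toℚ (c * (q * q) * L) *ℚ lamParam cλ ε n ℚ.≤ 1ℚ
    bound (suc l) eq _ = begin
      toℚ (c * (q * q) * suc l) *ℚ lamParam cλ ε n
        ≡⟨ cong₂ _*ℚ_ (trans (toℚ-* (c * (q * q)) (suc l)) (cong (_*ℚ toℚ (suc l)) (trans (toℚ-* c (q * q)) (cong (toℚ c *ℚ_) (toℚ-* q q))))) (lamParam-suc cλ ε n l eq) ⟩
      toℚ c *ℚ (toℚ q *ℚ toℚ q) *ℚ toℚ (suc l) *ℚ (cλ *ℚ ((ε *ℚ w) *ℚ ((ε *ℚ w) *ℚ 1ℚ)))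
        ≡⟨ arr (toℚ c) (toℚ q) (toℚ (suc l)) cλ ε w ⟩
      (toℚ c *ℚ cλ) *ℚ ((toℚ q *ℚ ε) *ℚ (toℚ q *ℚ ε)) *ℚ ((toℚ (suc l) *ℚ w) *ℚ w)
        ≡⟨ cong₂ (λ a b → a *ℚ ((toℚ q *ℚ ε) *ℚ (toℚ q *ℚ ε)) *ℚ (b *ℚ w)) ccλ (reciprocal-* l) ⟩
      (+ 1 ℚ./ 4) *ℚ ((toℚ q *ℚ ε) *ℚ (toℚ q *ℚ ε)) *ℚ (1ℚ *ℚ w)
        ≤⟨ *-mono (*-nonNeg 0≤¼ (*-nonNeg 0≤qε 0≤qε)) (*-nonNeg (0≤toℚ 1) 0≤w) (*-monoˡ (+ 1 ℚ./ 4) 0≤¼ (*-mono 0≤qε 0≤qε qε≤2 qε≤2)) (*-monoˡ 1ℚ (0≤toℚ 1) (reciprocal≤1 l)) ⟩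
      (+ 1 ℚ./ 4) *ℚ (toℚ 2 *ℚ toℚ 2) *ℚ (1ℚ *ℚ 1ℚ)   ≡⟨⟩
      1ℚ                         ∎
      where
      w : ℚ
      w = + 1 ℚ./ suc l
      0≤w : 0ℚ ℚ.≤ w
      0≤w = ℚ.<⇒≤ (reciprocal-pos l)
      0≤qε : 0ℚ ℚ.≤ toℚ q *ℚ ε
      0≤qε = *-nonNeg (0≤toℚ q) 0≤ε
      0≤¼ : 0ℚ ℚ.≤ + 1 ℚ./ 4
      0≤¼ = ℚ.<⇒≤ (reciprocal-pos 3)
      arr : ∀ c q L cλ ε w → c *ℚ (q *ℚ q) *ℚ L *ℚ (cλ *ℚ ((ε *ℚ w) *ℚ ((ε *ℚ w) *ℚ 1ℚ))) ≡ (c *ℚ cλ) *ℚ ((q *ℚ ε) *ℚ (q *ℚ ε)) *ℚ ((L *ℚ w) *ℚ w)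
      arr = Ring.solve-∀ ℚ-ring

  -- From `q ≤ 2/ε` the sixth power costs `2^6`, the factor 64 in the constant.
  betaParam-large : ∀ K q n → toℚ q *ℚ ε ℚ.≤ toℚ 2 → K * q ^ 6 * logN n ^ 7 ≤ betaParam (toℚ (K * 64)) ε (positive ε>0) n
  betaParam-large K q n qε≤2 = toℚ-cancel-≤ (begin
    toℚ (K * q ^ 6 * logN n ^ 7)                            ≡⟨ trans (toℚ-* (K * q ^ 6) (logN n ^ 7)) (cong (_*ℚ toℚ (logN n ^ 7)) (trans (toℚ-* K (q ^ 6)) (cong (toℚ K *ℚ_) (toℚ-^ q 6)))) ⟩
    toℚ K *ℚ (toℚ q ^ℚ 6) *ℚ toℚ (logN n ^ 7)
      ≤⟨ *-monoʳ (toℚ (logN n ^ 7)) (0≤toℚ (logN n ^ 7)) (*-monoˡ (toℚ K) (0≤toℚ K) (^ℚ-mono (0≤toℚ q) q≤2i 6)) ⟩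
    toℚ K *ℚ ((toℚ 2 *ℚ i) ^ℚ 6) *ℚ toℚ (logN n ^ 7)        ≡⟨ cong (λ x → toℚ K *ℚ x *ℚ toℚ (logN n ^ 7)) (^ℚ-distrib-* (toℚ 2) i 6) ⟩
    toℚ K *ℚ (toℚ 2 ^ℚ 6 *ℚ i ^ℚ 6) *ℚ toℚ (logN n ^ 7)     ≡⟨ cong (_*ℚ toℚ (logN n ^ 7)) (ℚ.*-assoc (toℚ K) (toℚ 2 ^ℚ 6) (i ^ℚ 6)) ⟨
    toℚ K *ℚ toℚ 64 *ℚ (i ^ℚ 6) *ℚ toℚ (logN n ^ 7)         ≡⟨ cong (λ x → x *ℚ (i ^ℚ 6) *ℚ toℚ (logN n ^ 7)) (toℚ-* K 64) ⟨
    toℚ (K * 64) *ℚ (i ^ℚ 6) *ℚ toℚ (logN n ^ 7)            ≤⟨ p≤ceilℕ (toℚ (K * 64) *ℚ (i ^ℚ 6) *ℚ toℚ (logN n ^ 7)) ⟩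
    toℚ (betaParam (toℚ (K * 64)) ε (positive ε>0) n)       ∎)
    where
    open ℚ.≤-Reasoning
    i : ℚ
    i = recipPos ε (positive ε>0)
    i*ε≡1 : i *ℚ ε ≡ 1ℚ
    i*ε≡1 = ℚ.*-inverseˡ ε {{ℚ.pos⇒nonZero ε {{positive ε>0}}}}
    q≤2i : toℚ q ℚ.≤ toℚ 2 *ℚ i
    q≤2i = ℚ.*-cancelʳ-≤-pos ε {{positive ε>0}} (begin
      toℚ q *ℚ ε               ≤⟨ qε≤2 ⟩
      toℚ 2                    ≡⟨ ℚ.*-identityʳ (toℚ 2) ⟨
      toℚ 2 *ℚ 1ℚ              ≡⟨ cong (toℚ 2 *ℚ_) i*ε≡1 ⟨
      toℚ 2 *ℚ (i *ℚ ε)        ≡⟨ ℚ.*-assoc (toℚ 2) i ε ⟨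
      toℚ 2 *ℚ i *ℚ ε          ∎)

-- Since `4L + 1 ≤ 5L`, the left side is at most `5 · 40 · 5 · 5 = 5000` times `α⁴q⁴L³`; the powers
-- of `q, L ≥ 1` are then raised to those in `betaParam`.
parameters-suffice : ∀ α q L → 1 ≤ q → 1 ≤ L → let s = 5 * (α * α) * (q * q) * L in
  s * (40 * s * (4 * L + 1)) ≤ 5000 * (α * α * (α * α)) * q ^ 6 * L ^ 7
parameters-suffice α q L 1≤q 1≤L = begin
  s * (40 * s * (4 * L + 1))                                    ≤⟨ ℕ.*-monoʳ-≤ s (ℕ.*-monoʳ-≤ (40 * s) (ℕ.+-monoʳ-≤ (4 * L) 1≤L)) ⟩
  s * (40 * s * (4 * L + L))                                    ≡⟨ arr₁ α (q * q) L ⟩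
  5000 * (α * α * (α * α)) * (q * q * (q * q)) * (L * L * L)    ≤⟨ ℕ.*-mono-≤ (ℕ.*-monoʳ-≤ (5000 * (α * α * (α * α))) q⁴≤q⁶) L³≤L⁷ ⟩
  5000 * (α * α * (α * α)) * q ^ 6 * L ^ 7                      ∎
  where
  open ℕ.≤-Reasoning
  s : ℕ
  s = 5 * (α * α) * (q * q) * L
  arr₁ : ∀ α Q L → 5 * (α * α) * Q * L * (40 * (5 * (α * α) * Q * L) * (4 * L + L)) ≡ 5000 * (α * α * (α * α)) * (Q * Q) * (L * L * L)
  arr₁ = solve-∀
  q⁴ : ∀ q → q * q * (q * q) ≡ q * (q * (q * (q * 1)))
  q⁴ = solve-∀
  L³ : ∀ L → L * L * L ≡ L * (L * (L * 1))
  L³ = solve-∀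
  q⁴≤q⁶ : q * q * (q * q) ≤ q ^ 6
  q⁴≤q⁶ = ℕ.≤-trans (ℕ.≤-reflexive (q⁴ q)) (ℕ.^-monoʳ-≤ q {{ℕ.>-nonZero 1≤q}} {4} {6} (ℕ.m≤m+n 4 2))
  L³≤L⁷ : L * L * L ≤ L ^ 7
  L³≤L⁷ = ℕ.≤-trans (ℕ.≤-reflexive (L³ L)) (ℕ.^-monoʳ-≤ L {{ℕ.>-nonZero 1≤L}} {3} {7} (ℕ.m≤m+n 3 4))

-- The value only has to satisfy 64 · 40α ≤ 5α²; it is abstract because cλ and cβ would otherwise be
-- normalised as fractions of numbers of order α⁴.
abstract
  α : ℕ
  α = 512

  512≤α : 512 ≤ α
  512≤α = ℕ.≤-refl

theorem5p3 :
    Σ ℚ λ cλ → Σ ℚ λ cβ → Σ ℚ λ cF → Σ ℕ λ cs → Σ ℕ λ c → Σ ℕ λ n₀ →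
    (0ℚ < cλ) × (0ℚ < cβ) × (0ℚ < cF) × (1 ≤ c) ×
    ((n : ℕ) → n₀ ≤ n → (G : Graph n) → (k : ℕ) → 1 ≤ k →
     (ε : ℚ) → (ε>0 : 0ℚ < ε) → ε < 1ℚ →
     let β   = betaParam cβ ε (positive ε>0) n
         β⁻  = (1ℚ - lamParam cλ ε n) *ℚ toℚ β
         thr = thrParam cF ε β
     in ((p : Partition G k) → ∀ i C → IsEDCS G p i C β β⁻ →
           ∣ C ∣ + ∣ heavy G C thr ∣ ≤ cs * n * β)
        × Σ (List (Partition G k)) λ B →
            (length B * n ^ c ≤ k ^ m G)
            × ((p : Partition G k) → p ∉ B → Good G β β⁻ thr ε p))
theorem5p3 = cλ , cβ , cF , 2 , 1 , 2 , 0<cλ , 0<cβ , reciprocal-pos 15 , s≤s z≤n , main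
  where
  open ℚ.≤-Reasoning
  1≤α : 1 ≤ α
  1≤α = ℕ.≤-trans (s≤s z≤n) 512≤α
  5αα K : ℕ
  5αα = 5 * (α * α)
  K   = 5000 * (α * α * (α * α))
  1≤K : 1 ≤ K * 64
  1≤K = ℕ.*-mono-≤ {1} {K} {1} {64} (ℕ.*-mono-≤ {1} {5000} {1} {α * α * (α * α)} (s≤s z≤n) (ℕ.*-mono-≤ (ℕ.*-mono-≤ 1≤α 1≤α) (ℕ.*-mono-≤ 1≤α 1≤α))) (s≤s z≤n)
  5≤5αα : 5 ≤ 5αα
  5≤5αα = ℕ.*-mono-≤ {5} {5} {1} {α * α} ℕ.≤-refl (ℕ.*-mono-≤ 1≤α 1≤α)
  -- The denominator of a fraction has to be a visible successor, while `5αα` does not reduce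
  -- because `α` is abstract.
  l : ℕ
  l = ℕ.pred 5αα
  suc-l : suc l ≡ 5αα
  suc-l = ℕ.suc-pred 5αα {{ℕ.>-nonZero (ℕ.≤-trans (s≤s z≤n) 5≤5αα)}}
  w cλ cβ cF : ℚ
  w  = + 1 ℚ./ suc l
  -- `1/w` is the factor `5αα` of `q²L` in `s`; the quarter compensates `(qε)² ≤ 4`.
  cλ = (+ 1 ℚ./ 4) *ℚ w
  cβ = toℚ (K * 64)
  -- Chosen so that `8q · cF ε = qε/2 ≤ 1`.
  cF = + 1 ℚ./ 16
  0<w : 0ℚ < w
  0<w = reciprocal-pos l
  0<cλ : 0ℚ < cλ
  0<cλ = *-pos {+ 1 ℚ./ 4} {w} (reciprocal-pos 3) 0<w
  0<cβ : 0ℚ < cβ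
  0<cβ = toℚ-mono-< {0} {K * 64} 1≤K
  5αα*w : toℚ 5αα *ℚ w ≡ 1ℚ
  5αα*w = trans (cong (λ x → toℚ x *ℚ w) (sym suc-l)) (reciprocal-* l)
  5αα*cλ : toℚ 5αα *ℚ cλ ≡ + 1 ℚ./ 4
  5αα*cλ = trans (arr (toℚ 5αα) (+ 1 ℚ./ 4) w) (trans (cong ((+ 1 ℚ./ 4) *ℚ_) 5αα*w) (ℚ.*-identityʳ (+ 1 ℚ./ 4)))
    where
    arr : ∀ a b c → a *ℚ (b *ℚ c) ≡ b *ℚ (a *ℚ c)
    arr = Ring.solve-∀ ℚ-ring
  w<¼ : w < + 1 ℚ./ 4
  w<¼ = ℚ.*-cancelˡ-<-nonNeg (toℚ 4) (begin-strict
    toℚ 4 *ℚ w          <⟨ ℚ.*-monoˡ-<-pos w {{positive 0<w}} (toℚ-mono-< {4} {5αα} 5≤5αα) ⟩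
    toℚ 5αα *ℚ w        ≡⟨ 5αα*w ⟩
    1ℚ                  ≡⟨⟩
    toℚ 4 *ℚ (+ 1 ℚ./ 4) ∎)
  cλ<cF : cλ < cF
  cλ<cF = ℚ.*-monoʳ-<-pos (+ 1 ℚ./ 4) w<¼
  main : (n : ℕ) → 2 ≤ n → (G : Graph n) → (k : ℕ) → 1 ≤ k →
     (ε : ℚ) → (ε>0 : 0ℚ < ε) → ε < 1ℚ →
     let β   = betaParam cβ ε (positive ε>0) n
         β⁻  = (1ℚ - lamParam cλ ε n) *ℚ toℚ β
         thr = thrParam cF ε β
     in ((p : Partition G k) → ∀ i C → IsEDCS G p i C β β⁻ →
           ∣ C ∣ + ∣ heavy G C thr ∣ ≤ 2 * n * β)
        × Σ (List (Partition G k)) λ B →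
            (length B * n ^ 1 ≤ k ^ m G)
            × ((p : Partition G k) → p ∉ B → Good G β β⁻ thr ε p)
  main n 2≤n G k 1≤k ε ε>0 ε<1 =
    (λ p i C edcs → coreset-size G thr edcs 1≤β) ,
    mostly-good α q L β n s z 512≤α 1≤q 1≤L (n≤2^⌈log₂n⌉ n) refl refl β-large G {k} {{ℕ.>-nonZero 1≤k}} {β⁻} {thr} {ε} cal
    where
    L β q s z : ℕ
    L = logN n
    β = betaParam cβ ε (positive ε>0) n
    q = proj₁ (reciprocal-scale ε ε>0 ε<1)
    s = 5αα * (q * q) * L
    z = 4 * L + 1
    β⁻ thr : ℚ
    β⁻  = (1ℚ - lamParam cλ ε n) *ℚ toℚ β
    thr = thrParam cF ε β
    1≤q : 1 ≤ q
    1≤q = proj₁ (proj₂ (reciprocal-scale ε ε>0 ε<1))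
    1≤qε : 1ℚ ℚ.≤ toℚ q *ℚ ε
    1≤qε = proj₁ (proj₂ (proj₂ (reciprocal-scale ε ε>0 ε<1)))
    qε≤2 : toℚ q *ℚ ε ℚ.≤ toℚ 2
    qε≤2 = proj₂ (proj₂ (proj₂ (reciprocal-scale ε ε>0 ε<1)))
    1≤L : 1 ≤ L
    1≤L = 1≤⌈log₂n⌉ 2≤n
    β-large : s * (40 * s * z) ≤ β
    β-large = ℕ.≤-trans (parameters-suffice α q L 1≤q 1≤L) (betaParam-large ε>0 K q n qε≤2)
    1≤s : 1 ≤ s
    1≤s = ℕ.*-mono-≤ (ℕ.*-mono-≤ (ℕ.≤-trans (s≤s z≤n) 5≤5αα) (ℕ.*-mono-≤ 1≤q 1≤q)) 1≤L
    1≤β : 1 ≤ β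
    1≤β = ℕ.≤-trans (ℕ.*-mono-≤ {1} {s} 1≤s (ℕ.*-mono-≤ {1} {40 * s} {1} {z} (ℕ.*-mono-≤ {1} {40} {1} {s} (s≤s z≤n) 1≤s) (ℕ.m≤n+m 1 (4 * L)))) β-large
    8qx≤1 : toℚ (8 * q) *ℚ (cF *ℚ ε) ℚ.≤ 1ℚ
    8qx≤1 = begin
      toℚ (8 * q) *ℚ (cF *ℚ ε)           ≡⟨ cong (_*ℚ (cF *ℚ ε)) (toℚ-* 8 q) ⟩
      toℚ 8 *ℚ toℚ q *ℚ (cF *ℚ ε)        ≡⟨ arr (toℚ 8) (toℚ q) cF ε ⟩
      toℚ 8 *ℚ cF *ℚ (toℚ q *ℚ ε)        ≤⟨ *-monoˡ (toℚ 8 *ℚ cF) (*-nonNeg (0≤toℚ 8) (ℚ.<⇒≤ (reciprocal-pos 15))) qε≤2 ⟩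
      toℚ 8 *ℚ cF *ℚ toℚ 2               ≡⟨⟩
      1ℚ                                 ∎
      where
      arr : ∀ a b c d → a *ℚ b *ℚ (c *ℚ d) ≡ a *ℚ c *ℚ (b *ℚ d)
      arr = Ring.solve-∀ ℚ-ring
    cal : Calibrated q s β β⁻ thr ε
    cal = calibrated (cF *ℚ ε) (lamParam cλ ε n) 1≤q 1≤β 1≤qε (lamParam<xε ε>0 n 0<cλ cλ<cF ε<1 1≤L) 8qx≤1 (lamParam-scale ε>0 5αα q n 0<cλ 5αα*cλ qε≤2 1≤L)
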